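{- There is an absolute constant $C>0$ such that the following holds. Let $\mathcal{C}:\{\pm1\}^n\times\{\pm1\}^n\to\{\pm1\}$ be a deterministic two-party communication protocol with total communication at most $d$ bits, and let $h$ be its XOR-fiber. Then for every $\rho\in[-1,1]$, $$\Bigl|\mathbb{E}_{\mathbf{z}\sim\nu_\rho}[h(\mathbf{z})]-\mathbb{E}_{\mathbf{z}\sim\nu_0}[h(\mathbf{z})]\Bigr|\le C\,|\rho|\sqrt d .$$
   Context: For $\rho\in[-1,1]$, $\nu_\rho$ denotes the product distribution on $\{\pm1\}^n$ in which each coordinate independently has expectation $\rho$ (so $\nu_0$ is uniform). For $x,y\in\{\pm1\}^n$, $x\odot y$ is the entrywise product. The XOR-fiber of $\mathcal{C}$ is $h(z)=\mathbb{E}[\mathcal{C}(\mathbf{x},\mathbf{y})\mid \mathbf{x}\odot\mathbf{y}=z]$ with $\mathbf{x},\mathbf{y}$ independent uniform on $\{\pm1\}^n$. -}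

module Defs where

open import Data.Bool.Base using (Bool; true; false)
open import Data.Integer.Base as ℤ using (+_; +[1+_]; -[1+_])
import Data.Integer.Properties as ℤₚ
open import Data.List.Base using (List; []; _∷_; _++_; map; filter; foldr; length; cartesianProduct)
open import Data.Nat.Base as ℕ using (ℕ; zero; suc)
import Data.Nat.Properties as ℕₚ
open import Data.Nat.Tactic.RingSolver using (solve-∀)
open import Data.Product.Base using (_×_; _,_; proj₁; proj₂; ∃-syntax; uncurry)
open import Data.Rational.Base
import Data.Rational.Properties as ℚₚ
open import Data.Rational.Solver using (module +-*-Solver)
open import Data.Rational.Unnormalised.Base as ℚᵘ using (ℚᵘ; mkℚᵘ; *≤*; *≡*)
import Data.Rational.Unnormalised.Properties as ℚᵘₚ
open import Data.Sign.Base as Sign using (Sign)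
import Data.Sign.Properties as Signₚ
open import Data.Sum.Base using (inj₁; inj₂)
open import Data.Vec.Base using (Vec; []; _∷_; zipWith)
open import Data.Vec.Properties using (≡-dec)
open import Relation.Binary.PropositionalEquality
  using (_≡_; refl; sym; trans; cong; cong₂; subst; subst₂)
open import Relation.Nullary.Decidable.Core using (yes; no)

-- Real numbers: Cauchy sequences of rationals, ordered by their limits, with
-- termwise operations.

Cauchy : (ℕ → ℚ) → Set
Cauchy s = ∀ ε → 0ℚ < ε →
  ∃[ N ] (∀ m n → N ℕ.≤ m → N ℕ.≤ n → ∣ s m - s n ∣ ≤ ε)

record ℝ : Set where
  constructor mkℝ
  field
    seq    : ℕ → ℚ
    cauchy : Cauchy seq

open ℝ public

infix 4 _≤ℝ_ _<ℝ_

_≤ℝ_ : ℝ → ℝ → Set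
x ≤ℝ y = ∀ ε → 0ℚ < ε → ∃[ N ] (∀ n → N ℕ.≤ n → seq x n ≤ seq y n + ε)

_<ℝ_ : ℝ → ℝ → Set
x <ℝ y = ∃[ ε ] (0ℚ < ε × ∃[ N ] (∀ n → N ℕ.≤ n → seq x n + ε ≤ seq y n))

module CauchyLemmas where

  ⊔-≤ˡ : ∀ {a b c} → a ℕ.⊔ b ℕ.≤ c → a ℕ.≤ c
  ⊔-≤ˡ {a} {b} = ℕₚ.≤-trans (ℕₚ.m≤m⊔n a b)

  ⊔-≤ʳ : ∀ {a b c} → a ℕ.⊔ b ℕ.≤ c → b ℕ.≤ c
  ⊔-≤ʳ {a} {b} = ℕₚ.≤-trans (ℕₚ.m≤n⊔m a b)

  scale-pos : ∀ ε δ → .{{Positive δ}} → 0ℚ < ε → 0ℚ < ε * δ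
  scale-pos ε δ 0<ε = subst (_< ε * δ) (ℚₚ.*-zeroˡ δ) (ℚₚ.*-monoˡ-<-pos δ 0<ε)

  const-cauchy : ∀ q → Cauchy (λ _ → q)
  const-cauchy q ε 0<ε = 0 , λ _ _ _ _ →
    subst (λ t → ∣ t ∣ ≤ ε) (sym (ℚₚ.+-inverseʳ q)) (ℚₚ.<⇒≤ 0<ε)

  +-cauchy : ∀ {s t} → Cauchy s → Cauchy t → Cauchy (λ n → s n + t n)
  +-cauchy {s} {t} cs ct ε 0<ε
    with cs (ε * ½) (scale-pos ε ½ 0<ε) | ct (ε * ½) (scale-pos ε ½ 0<ε)
  ... | M , hM | N , hN = M ℕ.⊔ N , λ m n m≥ n≥ → begin
    ∣ s m + t m - (s n + t n) ∣      ≡⟨ cong ∣_∣ (regroup (s m) (t m) (s n) (t n)) ⟩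
    ∣ (s m - s n) + (t m - t n) ∣    ≤⟨ ℚₚ.∣p+q∣≤∣p∣+∣q∣ (s m - s n) (t m - t n) ⟩
    ∣ s m - s n ∣ + ∣ t m - t n ∣    ≤⟨ ℚₚ.+-mono-≤ (hM m n (⊔-≤ˡ m≥) (⊔-≤ˡ n≥))
                                                    (hN m n (⊔-≤ʳ {M} m≥) (⊔-≤ʳ {M} n≥)) ⟩
    ε * ½ + ε * ½                    ≡⟨ sym (ℚₚ.*-distribˡ-+ ε ½ ½) ⟩
    ε * 1ℚ                           ≡⟨ ℚₚ.*-identityʳ ε ⟩
    ε                                ∎
    where
    open ℚₚ.≤-Reasoning
    open +-*-Solver
    regroup : ∀ a b c d → a + b - (c + d) ≡ (a - c) + (b - d)
    regroup = solve 4 (λ a b c d → a :+ b :- (c :+ d) := (a :- c) :+ (b :- d)) refl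

  neg-cauchy : ∀ {s} → Cauchy s → Cauchy (λ n → - s n)
  neg-cauchy {s} cs ε 0<ε with cs ε 0<ε
  ... | N , hN = N , λ m n m≥ n≥ →
    subst (_≤ ε) (trans (sym (ℚₚ.∣-p∣≡∣p∣ (s m - s n)))
                        (cong ∣_∣ (ℚₚ.neg-distrib-+ (s m) (- s n))))
          (hN m n m≥ n≥)

  bound : ∀ {s} → Cauchy s →
          ∃[ B ] (Positive B × ∃[ N ] (∀ n → N ℕ.≤ n → ∣ s n ∣ ≤ B))
  bound {s} cs with cs 1ℚ (ℚₚ.positive⁻¹ 1ℚ)
  ... | N , hN = ∣ s N ∣ + 1ℚ
               , positive (ℚₚ.+-mono-≤-< (ℚₚ.0≤∣p∣ (s N)) (ℚₚ.positive⁻¹ 1ℚ))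
               , N , λ n n≥ → begin
    ∣ s n ∣                  ≡⟨ cong ∣_∣ (split (s n) (s N)) ⟩
    ∣ s N + (s n - s N) ∣    ≤⟨ ℚₚ.∣p+q∣≤∣p∣+∣q∣ (s N) (s n - s N) ⟩
    ∣ s N ∣ + ∣ s n - s N ∣  ≤⟨ ℚₚ.+-monoʳ-≤ ∣ s N ∣ (hN n N n≥ ℕₚ.≤-refl) ⟩
    ∣ s N ∣ + 1ℚ             ∎
    where
    open ℚₚ.≤-Reasoning
    open +-*-Solver
    split : ∀ a b → a ≡ b + (a - b)
    split = solve 2 (λ a b → a := b :+ (a :- b)) refl

  ∣*∣-mono-≤ : ∀ {p q a b} → ∣ p ∣ ≤ a → ∣ q ∣ ≤ b → ∣ p * q ∣ ≤ a * b
  ∣*∣-mono-≤ {p} {q} {a} {b} p≤a q≤b = begin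
    ∣ p * q ∣      ≡⟨ ℚₚ.∣p*q∣≡∣p∣*∣q∣ p q ⟩
    ∣ p ∣ * ∣ q ∣  ≤⟨ ℚₚ.*-monoʳ-≤-nonNeg ∣ q ∣ {{nonNegative (ℚₚ.0≤∣p∣ q)}} p≤a ⟩
    a * ∣ q ∣      ≤⟨ ℚₚ.*-monoˡ-≤-nonNeg a {{nonNegative (ℚₚ.≤-trans (ℚₚ.0≤∣p∣ p) p≤a)}} q≤b ⟩
    a * b          ∎
    where open ℚₚ.≤-Reasoning

  -- A tolerance δ with A δ + δ B = ε.
  tolerance : ∀ A B → Positive A → Positive B → ∀ ε → 0ℚ < ε →
              ∃[ δ ] (0ℚ < δ × A * δ + δ * B ≡ ε)
  tolerance A B A>0 B>0 ε 0<ε = scaled (A + B) refl A+B>0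
    where
    open +-*-Solver
    A+B>0 : Positive (A + B)
    A+B>0 = positive (ℚₚ.+-mono-< (ℚₚ.positive⁻¹ A {{A>0}}) (ℚₚ.positive⁻¹ B {{B>0}}))
    collect : ∀ a b e i → a * (e * i) + (e * i) * b ≡ e * (i * (a + b))
    collect = solve 4 (λ a b e i → a :* (e :* i) :+ (e :* i) :* b := e :* (i :* (a :+ b))) refl
    scaled : ∀ S → A + B ≡ S → Positive S → ∃[ δ ] (0ℚ < δ × A * δ + δ * B ≡ ε)
    scaled S A+B≡S S>0 = ε * S⁻¹ , scale-pos ε S⁻¹ {{ℚₚ.1/pos⇒pos S {{S>0}}}} 0<ε ,
      trans (collect A B ε S⁻¹)
        (trans (cong (λ t → ε * (S⁻¹ * t)) A+B≡S)
          (trans (cong (ε *_) (ℚₚ.*-inverseˡ S {{S≢0}})) (ℚₚ.*-identityʳ ε)))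
      where
      S≢0 : NonZero S
      S≢0 = ℚₚ.pos⇒nonZero S {{S>0}}
      S⁻¹ : ℚ
      S⁻¹ = (1/ S) {{S≢0}}

  *-difference : ∀ {a b c d A B δ} → ∣ a ∣ ≤ A → ∣ d ∣ ≤ B → ∣ a - c ∣ ≤ δ → ∣ b - d ∣ ≤ δ →
                 ∣ a * b - c * d ∣ ≤ A * δ + δ * B
  *-difference {a} {b} {c} {d} {A} {B} {δ} a≤ d≤ ac≤ bd≤ = begin
    ∣ a * b - c * d ∣                ≡⟨ cong ∣_∣ (regroup a b c d) ⟩
    ∣ a * (b - d) + (a - c) * d ∣    ≤⟨ ℚₚ.∣p+q∣≤∣p∣+∣q∣ (a * (b - d)) ((a - c) * d) ⟩
    ∣ a * (b - d) ∣ + ∣ (a - c) * d ∣  ≤⟨ ℚₚ.+-mono-≤ (∣*∣-mono-≤ {a} {b - d} a≤ bd≤)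
                                                     (∣*∣-mono-≤ {a - c} {d} ac≤ d≤) ⟩
    A * δ + δ * B                    ∎
    where
    open ℚₚ.≤-Reasoning
    open +-*-Solver
    regroup : ∀ a b c d → a * b - c * d ≡ a * (b - d) + (a - c) * d
    regroup = solve 4 (λ a b c d → a :* b :- c :* d := a :* (b :- d) :+ (a :- c) :* d) refl

  *-cauchy : ∀ {s t} → Cauchy s → Cauchy t → Cauchy (λ n → s n * t n)
  *-cauchy {s} {t} cs ct ε 0<ε =
    let A , A>0 , K , hK = bound cs
        B , B>0 , L , hL = bound ct
        δ , 0<δ , Aδ+δB≡ε = tolerance A B A>0 B>0 ε 0<ε
        M , hM = cs δ 0<δ
        N , hN = ct δ 0<δ
    in (K ℕ.⊔ L) ℕ.⊔ (M ℕ.⊔ N) , λ m n m≥ n≥ →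
      subst (∣ s m * t m - s n * t n ∣ ≤_) Aδ+δB≡ε
        (*-difference {s m} {t m} {s n} {t n} {A} {B} {δ}
          (hK m (⊔-≤ˡ (⊔-≤ˡ m≥)))
          (hL n (⊔-≤ʳ {K} (⊔-≤ˡ n≥)))
          (hM m n (⊔-≤ˡ (⊔-≤ʳ {K ℕ.⊔ L} m≥)) (⊔-≤ˡ (⊔-≤ʳ {K ℕ.⊔ L} n≥)))
          (hN m n (⊔-≤ʳ {M} (⊔-≤ʳ {K ℕ.⊔ L} m≥)) (⊔-≤ʳ {M} (⊔-≤ʳ {K ℕ.⊔ L} n≥))))

  p-q≤r : ∀ {p q r} → p ≤ q + r → p - q ≤ r
  p-q≤r {p} {q} {r} p≤ = subst (p - q ≤_) (cancel q r) (ℚₚ.+-monoˡ-≤ (- q) p≤)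
    where
    open +-*-Solver
    cancel : ∀ a b → a + b - a ≡ b
    cancel = solve 2 (λ a b → a :+ b :- a := b) refl

  ∣p-q∣≤r : ∀ {p q r} → p ≤ q + r → q ≤ p + r → ∣ p - q ∣ ≤ r
  ∣p-q∣≤r {p} {q} {r} p≤ q≤ with ℚₚ.∣p∣≡p∨∣p∣≡-p (p - q)
  ... | inj₁ eq = subst (_≤ r) (sym eq) (p-q≤r p≤)
  ... | inj₂ eq = subst (_≤ r) (trans (flip p q) (sym eq)) (p-q≤r q≤)
    where
    open +-*-Solver
    flip : ∀ a b → b - a ≡ - (a - b)
    flip = solve 2 (λ a b → b :- a := :- (a :- b)) refl

  ∣p∣≤∣q∣+∣p-q∣ : ∀ p q → ∣ p ∣ ≤ ∣ q ∣ + ∣ p - q ∣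
  ∣p∣≤∣q∣+∣p-q∣ p q = subst (λ t → ∣ t ∣ ≤ ∣ q ∣ + ∣ p - q ∣) (join p q) (ℚₚ.∣p+q∣≤∣p∣+∣q∣ q (p - q))
    where
    open +-*-Solver
    join : ∀ a b → b + (a - b) ≡ a
    join = solve 2 (λ a b → b :+ (a :- b) := a) refl

  abs-cauchy : ∀ {s} → Cauchy s → Cauchy (λ n → ∣ s n ∣)
  abs-cauchy {s} cs ε 0<ε with cs ε 0<ε
  ... | N , hN = N , λ m n m≥ n≥ → ∣p-q∣≤r (step m n m≥ n≥) (step n m n≥ m≥)
    where
    step : ∀ m n → N ℕ.≤ m → N ℕ.≤ n → ∣ s m ∣ ≤ ∣ s n ∣ + ε
    step m n m≥ n≥ = ℚₚ.≤-trans (∣p∣≤∣q∣+∣p-q∣ (s m) (s n)) (ℚₚ.+-monoʳ-≤ ∣ s n ∣ (hN m n m≥ n≥))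

open CauchyLemmas

infixl 6 _+ℝ_ _-ℝ_
infixl 7 _*ℝ_
infix  8 -ℝ_

fromℚ : ℚ → ℝ
fromℚ q = mkℝ (λ _ → q) (const-cauchy q)

0ℝ 1ℝ : ℝ
0ℝ = fromℚ 0ℚ
1ℝ = fromℚ 1ℚ

_+ℝ_ : ℝ → ℝ → ℝ
x +ℝ y = mkℝ (λ n → seq x n + seq y n) (+-cauchy {seq x} {seq y} (cauchy x) (cauchy y))

-ℝ_ : ℝ → ℝ
-ℝ x = mkℝ (λ n → - seq x n) (neg-cauchy {seq x} (cauchy x))

_-ℝ_ : ℝ → ℝ → ℝ
x -ℝ y = x +ℝ (-ℝ y)

_*ℝ_ : ℝ → ℝ → ℝ
x *ℝ y = mkℝ (λ n → seq x n * seq y n) (*-cauchy {seq x} {seq y} (cauchy x) (cauchy y))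

∣_∣ℝ : ℝ → ℝ
∣ x ∣ℝ = mkℝ (λ n → ∣ seq x n ∣) (abs-cauchy {seq x} (cauchy x))

-- The integer square root ⌊√ n ⌋.
isqrt : ℕ → ℕ
isqrt zero = zero
isqrt (suc n) with suc (isqrt n) ℕ.* suc (isqrt n) ℕₚ.≤? suc n
... | yes _ = suc (isqrt n)
... | no  _ = isqrt n

-- ⌊√ (d (k+1)²) ⌋ / (k+1), which lies in the interval (√ d - 1/(k+1) , √ d].
√-seq : ℕ → ℕ → ℚ
√-seq d k = + isqrt (d ℕ.* (suc k ℕ.* suc k)) / suc k

isqrt-lower : ∀ n → isqrt n ℕ.* isqrt n ℕ.≤ n
isqrt-lower zero = ℕ.z≤n
isqrt-lower (suc n) with suc (isqrt n) ℕ.* suc (isqrt n) ℕₚ.≤? suc n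
... | yes r²≤ = r²≤
... | no  _   = ℕₚ.m≤n⇒m≤1+n (isqrt-lower n)

isqrt-upper : ∀ n → n ℕ.< suc (isqrt n) ℕ.* suc (isqrt n)
isqrt-upper zero = ℕ.s≤s ℕ.z≤n
isqrt-upper (suc n) with suc (isqrt n) ℕ.* suc (isqrt n) ℕₚ.≤? suc n
... | no  r²≰ = ℕₚ.≰⇒> r²≰
... | yes _   = ℕₚ.<-≤-trans (ℕ.s≤s (isqrt-upper n))
                  (ℕₚ.*-mono-< (ℕₚ.n<1+n (suc (isqrt n))) (ℕₚ.n<1+n (suc (isqrt n))))

module √-Lemmas where

  square-cancel-≤ : ∀ a b → a ℕ.* a ℕ.≤ b ℕ.* b → a ℕ.≤ b
  square-cancel-≤ a b a²≤b² with a ℕₚ.≤? b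
  ... | yes a≤b = a≤b
  ... | no  a≰b with ℕₚ.<⇒≱ (ℕₚ.*-mono-< (ℕₚ.≰⇒> a≰b) (ℕₚ.≰⇒> a≰b)) a²≤b²
  ...   | ()

  isqrt-cross : ∀ d k l →
    isqrt (d ℕ.* (suc k ℕ.* suc k)) ℕ.* suc l ℕ.≤ suc (isqrt (d ℕ.* (suc l ℕ.* suc l))) ℕ.* suc k
  isqrt-cross d k l = square-cancel-≤ _ _ (begin
    a ℕ.* L ℕ.* (a ℕ.* L)                ≡⟨ swap a L ⟩
    a ℕ.* a ℕ.* (L ℕ.* L)                ≤⟨ ℕₚ.*-monoˡ-≤ (L ℕ.* L) (isqrt-lower (d ℕ.* (K ℕ.* K))) ⟩
    d ℕ.* (K ℕ.* K) ℕ.* (L ℕ.* L)        ≡⟨ exchange d K L ⟩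
    d ℕ.* (L ℕ.* L) ℕ.* (K ℕ.* K)        ≤⟨ ℕₚ.*-monoˡ-≤ (K ℕ.* K) (ℕₚ.<⇒≤ (isqrt-upper (d ℕ.* (L ℕ.* L)))) ⟩
    b ℕ.* b ℕ.* (K ℕ.* K)                ≡⟨ sym (swap b K) ⟩
    b ℕ.* K ℕ.* (b ℕ.* K)                ∎)
    where
    open ℕₚ.≤-Reasoning
    K = suc k
    L = suc l
    a = isqrt (d ℕ.* (K ℕ.* K))
    b = suc (isqrt (d ℕ.* (L ℕ.* L)))
    swap : ∀ x y → x ℕ.* y ℕ.* (x ℕ.* y) ≡ x ℕ.* x ℕ.* (y ℕ.* y)
    swap = solve-∀
    exchange : ∀ x y z → x ℕ.* (y ℕ.* y) ℕ.* (z ℕ.* z) ≡ x ℕ.* (z ℕ.* z) ℕ.* (y ℕ.* y)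
    exchange = solve-∀

  /-mono-≤ : ∀ a b k l → a ℕ.* suc l ℕ.≤ b ℕ.* suc k → + a / suc k ≤ + b / suc l
  /-mono-≤ a b k l h = ℚₚ.toℚᵘ-cancel-≤ (begin
    toℚᵘ (+ a / suc k)  ≃⟨ ℚₚ.toℚᵘ-fromℚᵘ (mkℚᵘ (+ a) k) ⟩
    mkℚᵘ (+ a) k        ≤⟨ *≤* (subst₂ ℤ._≤_ (ℤₚ.pos-* a (suc l)) (ℤₚ.pos-* b (suc k)) (ℤ.+≤+ h)) ⟩
    mkℚᵘ (+ b) l        ≃⟨ ℚₚ.toℚᵘ-fromℚᵘ (mkℚᵘ (+ b) l) ⟨
    toℚᵘ (+ b / suc l)  ∎)
    where open ℚᵘₚ.≤-Reasoning

  /-suc : ∀ a k → + suc a / suc k ≡ + a / suc k + + 1 / suc k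
  /-suc a k = ℚₚ.toℚᵘ-injective (begin
    toℚᵘ (+ suc a / suc k)                        ≈⟨ ℚₚ.toℚᵘ-fromℚᵘ (mkℚᵘ (+ suc a) k) ⟩
    mkℚᵘ (+ suc a) k                              ≈⟨ *≡* cross ⟩
    mkℚᵘ (+ a) k ℚᵘ.+ mkℚᵘ (+ 1) k                ≈⟨ ℚᵘₚ.+-cong (ℚₚ.toℚᵘ-fromℚᵘ (mkℚᵘ (+ a) k))
                                                                 (ℚₚ.toℚᵘ-fromℚᵘ (mkℚᵘ (+ 1) k)) ⟨
    toℚᵘ (+ a / suc k) ℚᵘ.+ toℚᵘ (+ 1 / suc k)    ≈⟨ ℚₚ.toℚᵘ-homo-+ (+ a / suc k) (+ 1 / suc k) ⟨
    toℚᵘ (+ a / suc k + + 1 / suc k)              ∎)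
    where
    open import Relation.Binary.Reasoning.Setoid ℚᵘₚ.≃-setoid
    open import Data.Integer.Tactic.RingSolver using () renaming (solve-∀ to solveℤ-∀)
    expand : ∀ x y → (ℤ.1ℤ ℤ.+ x) ℤ.* (y ℤ.* y) ≡ (x ℤ.* y ℤ.+ ℤ.1ℤ ℤ.* y) ℤ.* y
    expand = solveℤ-∀
    cross : + suc a ℤ.* + (suc k ℕ.* suc k) ≡ (+ a ℤ.* + suc k ℤ.+ + 1 ℤ.* + suc k) ℤ.* + suc k
    cross = trans (cong (+ suc a ℤ.*_) (ℤₚ.pos-* (suc k) (suc k))) (expand (+ a) (+ suc k))

  archimedean : ∀ ε → 0ℚ < ε → ∃[ N ] (∀ n → N ℕ.≤ n → + 1 / suc n ≤ ε)
  archimedean ε@(mkℚ +[1+ a ] b c) 0<ε = b , λ n b≤n →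
    subst (+ 1 / suc n ≤_) (ℚₚ.fromℚᵘ-toℚᵘ ε)
      (/-mono-≤ 1 (suc a) n b (ℕₚ.*-mono-≤ {1} {suc a} (ℕ.s≤s ℕ.z≤n) (ℕ.s≤s b≤n)))
  archimedean (mkℚ (+ 0) b c) 0<ε with () ← positive 0<ε
  archimedean (mkℚ -[1+ a ] b c) 0<ε with () ← positive 0<ε

  √-cauchy : ∀ d → Cauchy (√-seq d)
  √-cauchy d ε 0<ε with archimedean ε 0<ε
  ... | N , hN = N , λ m n m≥ n≥ → ∣p-q∣≤r (step m n n≥) (step n m m≥)
    where
    approx : ℕ → ℕ
    approx k = isqrt (d ℕ.* (suc k ℕ.* suc k))
    step : ∀ m n → N ℕ.≤ n → √-seq d m ≤ √-seq d n + ε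
    step m n n≥ = begin
      √-seq d m                ≤⟨ /-mono-≤ (approx m) (suc (approx n)) m n (isqrt-cross d m n) ⟩
      + suc (approx n) / suc n ≡⟨ /-suc (approx n) n ⟩
      √-seq d n + + 1 / suc n  ≤⟨ ℚₚ.+-monoʳ-≤ (√-seq d n) (hN n n≥) ⟩
      √-seq d n + ε            ∎
      where open ℚₚ.≤-Reasoning

open √-Lemmas

√_ : ℕ → ℝ
√ d = mkℝ (√-seq d) (√-cauchy d)

Cube : ℕ → Set
Cube n = Vec Sign n

infixl 7 _⊙_

_⊙_ : ∀ {n} → Cube n → Cube n → Cube n
_⊙_ = zipWith Sign._*_

-- All points of the cube, each listed exactly once.
cube : ∀ n → List (Cube n)
cube zero    = [] ∷ []
cube (suc n) = map (Sign.+ ∷_) (cube n) ++ map (Sign.- ∷_) (cube n)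

value : Sign → ℚ
value Sign.+ = 1ℚ
value Sign.- = - 1ℚ

-- Deterministic two-party protocols computing a sign.  At an internal node
-- one player sends a bit that depends on that player's input only (and on
-- the node, i.e. on the transcript so far); the output is determined by the
-- full transcript.

data Protocol (n : ℕ) : Set where
  output : Sign → Protocol n
  alice  : (Cube n → Bool) → (Bool → Protocol n) → Protocol n
  bob    : (Cube n → Bool) → (Bool → Protocol n) → Protocol n

run : ∀ {n} → Protocol n → Cube n → Cube n → Sign
run (output s)       x y = s
run (alice msg next) x y = run (next (msg x)) x y
run (bob   msg next) x y = run (next (msg y)) x y

-- Worst-case number of bits exchanged.
cost : ∀ {n} → Protocol n → ℕ
cost (output _)     = 0
cost (alice _ next) = suc (cost (next true) ℕ.⊔ cost (next false))
cost (bob   _ next) = suc (cost (next true) ℕ.⊔ cost (next false))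

-- The mean of a nonempty list (with junk value 0 on the empty list).
mean : List ℚ → ℚ
mean []         = 0ℚ
mean qs@(_ ∷ _) = foldr _+_ 0ℚ qs * (+ 1 / length qs)

-- Conditioning a pair of independent uniform points on x ⊙ y ≡ z leaves it
-- uniform on the pairs that satisfy x ⊙ y ≡ z, a nonempty set.
xorFiber : ∀ {n} → (Cube n → Cube n → Sign) → Cube n → ℚ
xorFiber {n} f z =
  mean (map (λ (x , y) → value (f x y))
            (filter (λ (x , y) → ≡-dec Signₚ._≟_ (x ⊙ y) z)
                    (cartesianProduct (cube n) (cube n))))

-- A ±1-valued variable with expectation ρ takes the value s with
-- probability (1 + ρ s) / 2.
ν : ∀ {n} → ℝ → Cube n → ℝ
ν ρ []      = 1ℝ
ν ρ (s ∷ z) = fromℚ ½ *ℝ (1ℝ +ℝ ρ *ℝ fromℚ (value s)) *ℝ ν ρ z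

𝔼ν : ∀ {n} → ℝ → (Cube n → ℚ) → ℝ
𝔼ν {n} ρ h = foldr _+ℝ_ 0ℝ (map (λ z → ν ρ z *ℝ fromℚ (h z)) (cube n))

{-# OPTIONS --safe #-}

-- Let (x , y) be uniform on a rectangle A × B.  For all functions u and v,
-- E(⟨x , y⟩ - u(x) - v(y))² ≥ Σᵢ Vᵢ Wᵢ, where Vᵢ and Wᵢ are the mean conditional
-- variances of xᵢ given x₁ … xᵢ₋₁ and of yᵢ given yᵢ₊₁ … yₙ; the opposite orders
-- make the martingale differences orthogonal.  Since Vᵢ Wᵢ ≥ 1 - (1 - Vᵢ) - (1 - Wᵢ),
-- this is at least n - φ→(A) - φ←(B) for the normalised potentials Σᵢ (1 - Vᵢ) and
-- Σᵢ (1 - Wᵢ), and each bit of communication raises the mean of φ→ + φ← by at most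
-- 128.  Summed over the rectangles of a protocol C of cost d, with the constant
-- λ C in place of u + v, this gives E(⟨x , y⟩ - λ C)² ≥ n - 128 d for
-- every λ.  As E⟨x , y⟩² = n, we get 2 λ E[C ⟨x , y⟩] ≤ λ² + 128 d, and λ ≈ √ d
-- bounds the level-one sum E[C ⟨x , y⟩] of the XOR-fiber by O(√ d).
--
-- E[C ⟨x , y⟩] is the derivative at 0 of ρ ↦ E_ρ[C].  Fixing each coordinate with
-- probability a (xᵢ = u, yᵢ = σ u with u uniform) turns a protocol into one of the
-- same cost and moves the correlation from t to σ a + (1 - a) t, so the bound
-- holds at every |ρ| ≤ 1/2, and E_ρ[C] is O(√ d)-Lipschitz there.  For larger |ρ|
-- the claim is trivial.  Real ρ may have approximations slightly outside
-- [-1 , 1], on which E_ρ[C] is still bounded by 2.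

module Submission where

import Data.Integer.Base as ℤ
open import Data.Bool.Base using (Bool; true; false)
open import Data.List.Base using (List; []; _∷_; _++_; cartesianProduct; filter; foldr; length; map)
open import Data.List.Properties using (map-++; map-∘)
open import Data.Maybe.Base using (Maybe; just; nothing)
open import Data.Nat.Base as ℕ using (ℕ; zero; suc)
import Data.Nat.Properties as ℕₚ
open import Data.Product.Base using (_×_; _,_; proj₁; proj₂; ∃-syntax)
open import Data.Rational.Base
import Data.Rational.Properties as ℚₚ
open import Data.Sign.Base as Sign using (Sign)
import Data.Sign.Properties as Signₚ
open import Data.Sum.Base using (_⊎_; inj₁; inj₂)
open import Data.Vec.Base using (Vec; []; _∷_)
open import Data.Vec.Properties using (≡-dec; ∷-injectiveʳ)
open import Level using (0ℓ)
open import Relation.Binary.PropositionalEquality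
  using (_≡_; _≢_; refl; sym; trans; cong; cong₂; subst; subst₂; module ≡-Reasoning)
open import Relation.Nullary.Decidable.Core using (Dec; yes; no)
open import Relation.Nullary.Negation.Core using (¬_; contradiction)
open import Tactic.RingSolver using (solve-∀)
open import Tactic.RingSolver.Core.AlmostCommutativeRing using (AlmostCommutativeRing; fromCommutativeRing)
open import Defs
open CauchyLemmas using (∣*∣-mono-≤; ∣p-q∣≤r)

-- The obstacle is the price of one bit. A message cuts a weight f into two parts, and since `rt` is
-- convex the potentials rise at every one of the n coordinates; the total rise must stay O(1) per
-- bit. With logarithms the entropy of the cut would pay for it, by a chain rule over the
-- coordinates. Over the rationals the payment comes from `Ξ J`: it is superadditive, its gain at
-- each coordinate is at least 1/64 of the rise of `rt`, and it is at most twice the mass, whence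
-- 128 = 64 · 2. It is built from the parallel sums `κ t`, because the gain of `κ t` and the rise of
-- `rt` have the same squared 2 × 2 determinant as numerator. A single `κ t` pays only for cuts
-- whose ratio is near t, so dyadic scales are summed; the bounds on the summands decrease
-- geometrically, so the number of scales does not enter the price. Finitely many scales reach every
-- cut because the weights count points: a nonzero mass is at least 1 and at most 2ᴶ.

0ℚ≟ : ∀ p → Maybe (0ℚ ≡ p)
0ℚ≟ p with 0ℚ ℚₚ.≟ p
... | yes eq = just eq
... | no  _  = nothing

ℚ-ring : AlmostCommutativeRing 0ℓ 0ℓ
ℚ-ring = fromCommutativeRing ℚₚ.+-*-commutativeRing 0ℚ≟

2ℚ : ℚ
2ℚ = ℤ.+ 2 / 1

sq : ℚ → ℚ
sq p = p * p

0≤1 : 0ℚ ≤ 1ℚ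
0≤1 = ℚₚ.nonNegative⁻¹ 1ℚ

0≤+ : ∀ {p q} → 0ℚ ≤ p → 0ℚ ≤ q → 0ℚ ≤ p + q
0≤+ = ℚₚ.+-mono-≤

*-monoˡ-≤ : ∀ {p q r} → 0ℚ ≤ r → p ≤ q → r * p ≤ r * q
*-monoˡ-≤ {r = r} 0≤r = ℚₚ.*-monoˡ-≤-nonNeg r {{nonNegative 0≤r}}

*-monoʳ-≤ : ∀ {p q r} → 0ℚ ≤ r → p ≤ q → p * r ≤ q * r
*-monoʳ-≤ {r = r} 0≤r = ℚₚ.*-monoʳ-≤-nonNeg r {{nonNegative 0≤r}}

0≤* : ∀ {p q} → 0ℚ ≤ p → 0ℚ ≤ q → 0ℚ ≤ p * q
0≤* {p} {q} 0≤p 0≤q = subst (_≤ p * q) (ℚₚ.*-zeroʳ p) (*-monoˡ-≤ 0≤p 0≤q)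

0≤sq : ∀ p → 0ℚ ≤ sq p
0≤sq p with ℚₚ.≤-total 0ℚ p
... | inj₁ 0≤p = 0≤* 0≤p 0≤p
... | inj₂ p≤0 = subst (0ℚ ≤_) (neg-sq p) (0≤* (ℚₚ.neg-antimono-≤ p≤0) (ℚₚ.neg-antimono-≤ p≤0))
  where
  neg-sq : ∀ p → - p * - p ≡ p * p
  neg-sq = solve-∀ ℚ-ring

≤-by : ∀ {p q} r → 0ℚ ≤ r → p + r ≡ q → p ≤ q
≤-by {p} r 0≤r eq = subst₂ _≤_ (ℚₚ.+-identityʳ p) eq (ℚₚ.+-monoʳ-≤ p 0≤r)

0≤q-p : ∀ {p q} → p ≤ q → 0ℚ ≤ q - p
0≤q-p {p} {q} p≤q = subst (_≤ q - p) (ℚₚ.+-inverseʳ p) (ℚₚ.+-monoˡ-≤ (- p) p≤q)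

+-nonneg-zeroˡ : ∀ {p q} → 0ℚ ≤ p → 0ℚ ≤ q → p + q ≡ 0ℚ → p ≡ 0ℚ
+-nonneg-zeroˡ {p} {q} 0≤p 0≤q eq = ℚₚ.≤-antisym (≤-by q 0≤q eq) 0≤p

+-nonneg-zeroʳ : ∀ {p q} → 0ℚ ≤ p → 0ℚ ≤ q → p + q ≡ 0ℚ → q ≡ 0ℚ
+-nonneg-zeroʳ {p} {q} 0≤p 0≤q eq = +-nonneg-zeroˡ 0≤q 0≤p (trans (ℚₚ.+-comm q p) eq)

≢0⇒0< : ∀ {p} → 0ℚ ≤ p → p ≢ 0ℚ → 0ℚ < p
≢0⇒0< 0≤p p≢0 = ℚₚ.≰⇒> (λ p≤0 → p≢0 (ℚₚ.≤-antisym p≤0 0≤p))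

-- Total inverse, with inv 0ℚ ≡ 0ℚ.
inv : ℚ → ℚ
inv p with p ℚₚ.≟ 0ℚ
... | yes _   = 0ℚ
... | no  p≢0 = (1/ p) {{≢-nonZero p≢0}}

*-inv : ∀ {p} → p ≢ 0ℚ → p * inv p ≡ 1ℚ
*-inv {p} p≢0 with p ℚₚ.≟ 0ℚ
... | yes p≡0 = contradiction p≡0 p≢0
... | no  p≢  = ℚₚ.*-inverseʳ p {{≢-nonZero p≢}}

0≤inv : ∀ {p} → 0ℚ ≤ p → 0ℚ ≤ inv p
0≤inv {p} 0≤p with p ℚₚ.≟ 0ℚ
... | yes _   = ℚₚ.≤-refl
... | no  p≢0 = ℚₚ.<⇒≤ (ℚₚ.positive⁻¹ _ {{ℚₚ.1/pos⇒pos p {{positive (≢0⇒0< 0≤p p≢0)}}}})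

cancelˡ : ∀ {p q r} i → r * i ≡ 1ℚ → r * p ≡ r * q → p ≡ q
cancelˡ {p} {q} {r} i r*i≡1 eq = begin
  p            ≡⟨ sym (ℚₚ.*-identityˡ p) ⟩
  1ℚ * p       ≡⟨ cong (_* p) (sym r*i≡1) ⟩
  r * i * p    ≡⟨ swap r i p ⟩
  i * (r * p)  ≡⟨ cong (i *_) eq ⟩
  i * (r * q)  ≡⟨ sym (swap r i q) ⟩
  r * i * q    ≡⟨ cong (_* q) r*i≡1 ⟩
  1ℚ * q       ≡⟨ ℚₚ.*-identityˡ q ⟩
  q            ∎
  where
  open ≡-Reasoning
  swap : ∀ r i p → r * i * p ≡ i * (r * p)
  swap = solve-∀ ℚ-ring

-- Sums over the cube and the two potentials

infixl 9 _⁺ _⁻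

_⁺ _⁻ : ∀ {n} {A : Set} → (Cube (suc n) → A) → Cube n → A
(f ⁺) x = f (Sign.+ ∷ x)
(f ⁻) x = f (Sign.- ∷ x)

∑ : ∀ {n} → (Cube n → ℚ) → ℚ
∑ {zero}  f = f []
∑ {suc n} f = ∑ (f ⁺) + ∑ (f ⁻)

∑-cong : ∀ {n} {f g : Cube n → ℚ} → (∀ x → f x ≡ g x) → ∑ f ≡ ∑ g
∑-cong {zero}  f≡g = f≡g []
∑-cong {suc n} f≡g = cong₂ _+_ (∑-cong (λ x → f≡g (Sign.+ ∷ x))) (∑-cong (λ x → f≡g (Sign.- ∷ x)))

∑-mono : ∀ {n} {f g : Cube n → ℚ} → (∀ x → f x ≤ g x) → ∑ f ≤ ∑ g
∑-mono {zero}  f≤g = f≤g []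
∑-mono {suc n} f≤g = ℚₚ.+-mono-≤ (∑-mono (λ x → f≤g (Sign.+ ∷ x))) (∑-mono (λ x → f≤g (Sign.- ∷ x)))

interchange : ∀ p q r s → (p + q) + (r + s) ≡ (p + r) + (q + s)
interchange = solve-∀ ℚ-ring

∑-+ : ∀ {n} (f g : Cube n → ℚ) → ∑ (λ x → f x + g x) ≡ ∑ f + ∑ g
∑-+ {zero}  f g = refl
∑-+ {suc n} f g = trans (cong₂ _+_ (∑-+ (f ⁺) (g ⁺)) (∑-+ (f ⁻) (g ⁻)))
                        (interchange (∑ (f ⁺)) (∑ (g ⁺)) (∑ (f ⁻)) (∑ (g ⁻)))

∑-*ˡ : ∀ {n} c (f : Cube n → ℚ) → ∑ (λ x → c * f x) ≡ c * ∑ f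
∑-*ˡ {zero}  c f = refl
∑-*ˡ {suc n} c f = trans (cong₂ _+_ (∑-*ˡ c (f ⁺)) (∑-*ˡ c (f ⁻)))
                         (sym (ℚₚ.*-distribˡ-+ c (∑ (f ⁺)) (∑ (f ⁻))))

∑-*ʳ : ∀ {n} c (f : Cube n → ℚ) → ∑ (λ x → f x * c) ≡ ∑ f * c
∑-*ʳ {n} c f = trans (∑-cong {n} (λ x → ℚₚ.*-comm (f x) c)) (trans (∑-*ˡ c f) (ℚₚ.*-comm c (∑ f)))

∑-0 : ∀ n → ∑ {n} (λ _ → 0ℚ) ≡ 0ℚ
∑-0 zero    = refl
∑-0 (suc n) = cong₂ _+_ (∑-0 n) (∑-0 n)

∑-nonneg : ∀ {n} {f : Cube n → ℚ} → (∀ x → 0ℚ ≤ f x) → 0ℚ ≤ ∑ f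
∑-nonneg {n} {f} 0≤f = subst (_≤ ∑ f) (∑-0 n) (∑-mono 0≤f)

∑-swap : ∀ {m n} (f : Cube m → Cube n → ℚ) → ∑ (λ x → ∑ (λ y → f x y)) ≡ ∑ (λ y → ∑ (λ x → f x y))
∑-swap {zero}  f = refl
∑-swap {suc m} f = trans (cong₂ _+_ (∑-swap (f ⁺)) (∑-swap (f ⁻)))
                         (sym (∑-+ (λ y → ∑ (λ x → (f ⁺) x y)) (λ y → ∑ (λ x → (f ⁻) x y))))

∑-minus : ∀ {n} (f g : Cube n → ℚ) → ∑ (λ x → f x - g x) ≡ ∑ f - ∑ g
∑-minus {zero}  f g = refl
∑-minus {suc n} f g = trans (cong₂ _+_ (∑-minus (f ⁺) (g ⁺)) (∑-minus (f ⁻) (g ⁻)))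
                            (regroup (∑ (f ⁺)) (∑ (g ⁺)) (∑ (f ⁻)) (∑ (g ⁻)))
  where
  regroup : ∀ p q r s → (p - q) + (r - s) ≡ (p + r) - (q + s)
  regroup = solve-∀ ℚ-ring

ip : ∀ {n} → Cube n → Cube n → ℚ
ip []      []      = 0ℚ
ip (s ∷ x) (t ∷ y) = value s * value t + ip x y

natℚ : ℕ → ℚ
natℚ zero    = 0ℚ
natℚ (suc n) = 1ℚ + natℚ n

-- For a two-point weight (a , b): (a + b) times the squared mean of the sign.
rt : ℚ → ℚ → ℚ
rt a b = sq (a - b) * inv (a + b)

0≤rt : ∀ {a b} → 0ℚ ≤ a → 0ℚ ≤ b → 0ℚ ≤ rt a b
0≤rt {a} {b} 0≤a 0≤b = 0≤* (0≤sq (a - b)) (0≤inv (0≤+ 0≤a 0≤b))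

-- With x uniform on the weight f, φ→ f / ∑ f is the sum of E[E[xᵢ | x₁ … xᵢ₋₁]²].
φ→ : ∀ {n} → (Cube n → ℚ) → ℚ
φ→ {zero}  f = 0ℚ
φ→ {suc n} f = rt (∑ (f ⁺)) (∑ (f ⁻)) + (φ→ (f ⁺) + φ→ (f ⁻))

-- The same with conditioning on the later coordinates xᵢ₊₁ … xₙ.
φ← : ∀ {n} → (Cube n → ℚ) → ℚ
φ← {zero}  g = 0ℚ
φ← {suc n} g = ∑ (λ y → rt ((g ⁺) y) ((g ⁻) y)) + φ← (λ y → (g ⁺) y + (g ⁻) y)

two-point : ∀ {a b} → 0ℚ ≤ a → 0ℚ ≤ b → ∀ e c v w →
  a * sq (e * 1ℚ + c - v) + b * sq (e * - 1ℚ + c - w)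
  ≡ (a + b) * sq (c - ((a * v + b * w) * inv (a + b) - e * ((a - b) * inv (a + b))))
    + (a + b - rt a b) * sq (e - ½ * (v - w))
two-point {a} {b} 0≤a 0≤b e c v w with (a + b) ℚₚ.≟ 0ℚ
... | yes s≡0 rewrite +-nonneg-zeroˡ 0≤a 0≤b s≡0 | +-nonneg-zeroʳ 0≤a 0≤b s≡0 = zero-weights e c v w
  where
  zero-weights : ∀ e c v w → 0ℚ * sq (e * 1ℚ + c - v) + 0ℚ * sq (e * - 1ℚ + c - w)
    ≡ 0ℚ * sq (c - ((0ℚ * v + 0ℚ * w) * 0ℚ - e * (0ℚ * 0ℚ))) + 0ℚ * sq (e - ½ * (v - w))
  zero-weights e c v w = trans (cong₂ _+_ (ℚₚ.*-zeroˡ (sq (e * 1ℚ + c - v))) (ℚₚ.*-zeroˡ (sq (e * - 1ℚ + c - w))))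
    (sym (cong₂ _+_ (ℚₚ.*-zeroˡ (sq (c - ((0ℚ * v + 0ℚ * w) * 0ℚ - e * (0ℚ * 0ℚ))))) (ℚₚ.*-zeroˡ (sq (e - ½ * (v - w))))))
... | no s≢0 = generic ((1/ (a + b)) {{≢-nonZero s≢0}}) (ℚₚ.*-inverseʳ (a + b) {{≢-nonZero s≢0}})
  where
  -- The solver cannot use (a + b) i = 1. Both identities are therefore polynomial, with a factor
  -- that is (a + b) * i in `right` and 1 in `left`; rewriting this factor joins them.
  right : ∀ a b e c v w i →
    let p = c - ((a * v + b * w) * i - e * ((a - b) * i))
        q = e - ½ * (v - w)
        k = (a + b) * i
        p′ = (a + b) * c - ((a * v + b * w) * k - e * ((a - b) * k))
    in (a + b) * ((a + b) * (p * p) + (a + b - (a - b) * (a - b) * i) * (q * q))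
       ≡ p′ * p′ + ((a + b) * (a + b) - (a - b) * (a - b) * k) * (q * q)
  right = solve-∀ ℚ-ring
  left : ∀ a b e c v w →
    let p₊ = e * 1ℚ + c - v
        p₋ = e * - 1ℚ + c - w
        q = e - ½ * (v - w)
        p′ = (a + b) * c - ((a * v + b * w) * 1ℚ - e * ((a - b) * 1ℚ))
    in (a + b) * (a * (p₊ * p₊) + b * (p₋ * p₋))
       ≡ p′ * p′ + ((a + b) * (a + b) - (a - b) * (a - b) * 1ℚ) * (q * q)
  left = solve-∀ ℚ-ring
  generic : ∀ i → (a + b) * i ≡ 1ℚ →
    a * sq (e * 1ℚ + c - v) + b * sq (e * - 1ℚ + c - w)
    ≡ (a + b) * sq (c - ((a * v + b * w) * i - e * ((a - b) * i)))
      + (a + b - sq (a - b) * i) * sq (e - ½ * (v - w))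
  generic i s*i≡1 = cancelˡ {r = a + b} i s*i≡1 (trans (left a b e c v w)
    (trans (cong (λ k → sq ((a + b) * c - ((a * v + b * w) * k - e * ((a - b) * k)))
                        + ((a + b) * (a + b) - (a - b) * (a - b) * k) * sq (e - ½ * (v - w))) (sym s*i≡1))
      (sym (right a b e c v w i))))

-- `two-point` at the c for which the bias vanishes: the variance alone remains, and it equals a sum
-- of weighted squares.
rt≤+ : ∀ {a b} → 0ℚ ≤ a → 0ℚ ≤ b → 0ℚ ≤ a + b - rt a b
rt≤+ {a} {b} 0≤a 0≤b = subst (0ℚ ≤_)
  (trans (two-point 0≤a 0≤b 1ℚ c 0ℚ 0ℚ) (vanish (a + b) (a + b - rt a b) c))
  (0≤+ (0≤* 0≤a (0≤sq (1ℚ * 1ℚ + c - 0ℚ))) (0≤* 0≤b (0≤sq (1ℚ * - 1ℚ + c - 0ℚ))))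
  where
  c : ℚ
  c = (a * 0ℚ + b * 0ℚ) * inv (a + b) - 1ℚ * ((a - b) * inv (a + b))
  vanish : ∀ s w c → s * ((c - c) * (c - c)) + w * ((1ℚ - ½ * (0ℚ - 0ℚ)) * (1ℚ - ½ * (0ℚ - 0ℚ))) ≡ w
  vanish = solve-∀ ℚ-ring

rt-minimal : ∀ {a b} → 0ℚ ≤ a → 0ℚ ≤ b → ∀ d → a + b - rt a b ≤ a * sq (1ℚ - d) + b * sq (- 1ℚ - d)
rt-minimal {a} {b} 0≤a 0≤b d = ≤-by ((a + b) * sq r) (0≤* (0≤+ 0≤a 0≤b) (0≤sq r))
  (trans (unfoldˡ (a + b) (a + b - rt a b) r d) (trans (sym (two-point 0≤a 0≤b 1ℚ 0ℚ d d)) (unfoldʳ a b d)))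
  where
  r : ℚ
  r = 0ℚ - ((a * d + b * d) * inv (a + b) - 1ℚ * ((a - b) * inv (a + b)))
  unfoldˡ : ∀ s w r d → w + s * (r * r) ≡ s * (r * r) + w * ((1ℚ - ½ * (d - d)) * (1ℚ - ½ * (d - d)))
  unfoldˡ = solve-∀ ℚ-ring
  unfoldʳ : ∀ a b d → a * ((1ℚ * 1ℚ + 0ℚ - d) * (1ℚ * 1ℚ + 0ℚ - d)) + b * ((1ℚ * - 1ℚ + 0ℚ - d) * (1ℚ * - 1ℚ + 0ℚ - d))
    ≡ a * ((1ℚ - d) * (1ℚ - d)) + b * ((- 1ℚ - d) * (- 1ℚ - d))
  unfoldʳ = solve-∀ ℚ-ring

-- The quadratic bound for a rectangle

residual : ∀ {n} → (f g u v : Cube n → ℚ) → ℚ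
residual f g u v = ∑ (λ x → ∑ (λ y → f x * g y * sq (ip x y - u x - v y)))

module Peel {n : ℕ} (g : Cube (suc n) → ℚ) (0≤g : ∀ y → 0ℚ ≤ g y) (v : Cube (suc n) → ℚ) where

  marginal : Cube n → ℚ
  marginal y = (g ⁺) y + (g ⁻) y

  variance : Cube n → ℚ
  variance y = marginal y - rt ((g ⁺) y) ((g ⁻) y)

  -- The conditional mean of v - e y₁ given the later coordinates of y, where e is the value of x₁.
  -- Subtracting it absorbs y₁ into a new v and keeps the form of the residual.
  correction : ℚ → Cube n → ℚ
  correction e y = ((g ⁺) y * (v ⁺) y + (g ⁻) y * (v ⁻) y) * inv (marginal y)
                   - e * (((g ⁺) y - (g ⁻) y) * inv (marginal y))

  slope : Cube n → ℚ
  slope y = ½ * ((v ⁺) y - (v ⁻) y)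

  noise : ℚ → ℚ
  noise e = ∑ (λ y → variance y * sq (e - slope y))

  peel-point : ∀ (c e k u : ℚ) y →
    c * (g ⁺) y * sq (e * 1ℚ + k - u - (v ⁺) y) + c * (g ⁻) y * sq (e * - 1ℚ + k - u - (v ⁻) y)
    ≡ c * marginal y * sq (k - u - correction e y) + c * (variance y * sq (e - slope y))
  peel-point c e k u y = trans (before c ((g ⁺) y) ((g ⁻) y) e k u ((v ⁺) y) ((v ⁻) y))
    (trans (cong (c *_) (two-point (0≤g (Sign.+ ∷ y)) (0≤g (Sign.- ∷ y)) e (k - u) ((v ⁺) y) ((v ⁻) y)))
           (after c (marginal y) (sq (k - u - correction e y)) (variance y * sq (e - slope y))))
    where
    before : ∀ c a b e k u v w → let p = e * 1ℚ + k - u - v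
                                     q = e * - 1ℚ + k - u - w
                                     p′ = e * 1ℚ + (k - u) - v
                                     q′ = e * - 1ℚ + (k - u) - w
      in c * a * (p * p) + c * b * (q * q) ≡ c * (a * (p′ * p′) + b * (q′ * q′))
    before = solve-∀ ℚ-ring
    after : ∀ c m p w → c * (m * p + w) ≡ c * m * p + c * w
    after = solve-∀ ℚ-ring

  peel-row : ∀ (c e u : ℚ) (x : Cube n) →
    ∑ (λ y → c * (g ⁺) y * sq (e * 1ℚ + ip x y - u - (v ⁺) y))
      + ∑ (λ y → c * (g ⁻) y * sq (e * - 1ℚ + ip x y - u - (v ⁻) y))
    ≡ ∑ (λ y → c * marginal y * sq (ip x y - u - correction e y)) + c * noise e
  peel-row c e u x = begin
    ∑ p + ∑ q                             ≡⟨ sym (∑-+ p q) ⟩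
    ∑ (λ y → p y + q y)                   ≡⟨ ∑-cong (λ y → peel-point c e (ip x y) u y) ⟩
    ∑ (λ y → r y + c * s y)               ≡⟨ ∑-+ r (λ y → c * s y) ⟩
    ∑ r + ∑ (λ y → c * s y)               ≡⟨ cong (∑ r +_) (∑-*ˡ c s) ⟩
    ∑ r + c * ∑ s                         ∎
    where
    open ≡-Reasoning
    p q r s : Cube n → ℚ
    p y = c * (g ⁺) y * sq (e * 1ℚ + ip x y - u - (v ⁺) y)
    q y = c * (g ⁻) y * sq (e * - 1ℚ + ip x y - u - (v ⁻) y)
    r y = c * marginal y * sq (ip x y - u - correction e y)
    s y = variance y * sq (e - slope y)

  peel : ∀ (e : ℚ) (f u : Cube n → ℚ) →
    ∑ (λ x → ∑ (λ y → f x * (g ⁺) y * sq (e * 1ℚ + ip x y - u x - (v ⁺) y))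
             + ∑ (λ y → f x * (g ⁻) y * sq (e * - 1ℚ + ip x y - u x - (v ⁻) y)))
    ≡ residual f marginal u (correction e) + ∑ f * noise e
  peel e f u = trans (∑-cong (λ x → peel-row (f x) e (u x) x))
    (trans (∑-+ (λ x → ∑ (λ y → f x * marginal y * sq (ip x y - u x - correction e y))) (λ x → f x * noise e))
           (cong (residual f marginal u (correction e) +_) (∑-*ʳ (noise e) f)))

  ∑-variance : ∑ variance ≡ ∑ g - ∑ (λ y → rt ((g ⁺) y) ((g ⁻) y))
  ∑-variance = trans (∑-minus marginal (λ y → rt ((g ⁺) y) ((g ⁻) y)))
                     (cong (_- ∑ (λ y → rt ((g ⁺) y) ((g ⁻) y))) (∑-+ (g ⁺) (g ⁻)))

  -- The slope of v in y₁ does not depend on x₁, so it cannot fit both x₁ = 1 and x₁ = -1. Averaged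
  -- over x₁, the squared misfit is at least the variance of x₁, by `rt-minimal`; this produces the
  -- product of the variances of x₁ and y₁.
  noise-bound : ∀ {a b} → 0ℚ ≤ a → 0ℚ ≤ b →
    (a + b - rt a b) * (∑ g - ∑ (λ y → rt ((g ⁺) y) ((g ⁻) y))) ≤ a * noise 1ℚ + b * noise (- 1ℚ)
  noise-bound {a} {b} 0≤a 0≤b = begin
    (a + b - rt a b) * (∑ g - ∑ (λ y → rt ((g ⁺) y) ((g ⁻) y)))  ≡⟨ cong ((a + b - rt a b) *_) (sym ∑-variance) ⟩
    (a + b - rt a b) * ∑ variance                     ≡⟨ sym (∑-*ˡ (a + b - rt a b) variance) ⟩
    ∑ (λ y → (a + b - rt a b) * variance y)           ≤⟨ ∑-mono point ⟩
    ∑ (λ y → a * p y + b * q y)                       ≡⟨ ∑-+ (λ y → a * p y) (λ y → b * q y) ⟩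
    ∑ (λ y → a * p y) + ∑ (λ y → b * q y)             ≡⟨ cong₂ _+_ (∑-*ˡ a p) (∑-*ˡ b q) ⟩
    a * noise 1ℚ + b * noise (- 1ℚ)                   ∎
    where
    open ℚₚ.≤-Reasoning
    p q : Cube n → ℚ
    p y = variance y * sq (1ℚ - slope y)
    q y = variance y * sq (- 1ℚ - slope y)
    collect : ∀ w a b p q → (a * p + b * q) * w ≡ a * (w * p) + b * (w * q)
    collect = solve-∀ ℚ-ring
    point : ∀ y → (a + b - rt a b) * variance y ≤ a * p y + b * q y
    point y = subst ((a + b - rt a b) * variance y ≤_)
      (collect (variance y) a b (sq (1ℚ - slope y)) (sq (- 1ℚ - slope y)))
      (*-monoʳ-≤ (rt≤+ (0≤g (Sign.+ ∷ y)) (0≤g (Sign.- ∷ y))) (rt-minimal 0≤a 0≤b (slope y)))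

-- The functions u and v are needed for the induction: averaging over y₁ leaves
-- the same inequality for the later coordinates with v replaced by a correction
-- that depends on x₁.
residual-bound : ∀ {n} (f g u v : Cube n → ℚ) → (∀ x → 0ℚ ≤ f x) → (∀ y → 0ℚ ≤ g y) →
  natℚ n * (∑ f * ∑ g) - ∑ g * φ→ f - ∑ f * φ← g ≤ residual f g u v
residual-bound {zero} f g u v 0≤f 0≤g = subst (_≤ residual f g u v) (sym (vanish (f []) (g [])))
  (0≤* (0≤* (0≤f []) (0≤g [])) (0≤sq (0ℚ - u [] - v [])))
  where
  vanish : ∀ p q → 0ℚ * (p * q) - q * 0ℚ - p * 0ℚ ≡ 0ℚ
  vanish = solve-∀ ℚ-ring
residual-bound {suc n} f g u v 0≤f 0≤g = begin
  natℚ (suc n) * ((F₊ + F₋) * G) - G * (rt F₊ F₋ + (φ→ (f ⁺) + φ→ (f ⁻))) - (F₊ + F₋) * (R + φ← marginal)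
    -- The product of the two variances, multiplied out: dropping the nonnegative `rt F₊ F₋ * R` is
    -- what makes the bound linear in the potentials.
    ≤⟨ ≤-by (rt F₊ F₋ * R) (0≤* (0≤rt 0≤F₊ 0≤F₋) (∑-nonneg (λ y → 0≤rt (0≤g (Sign.+ ∷ y)) (0≤g (Sign.- ∷ y)))))
            (regroup (natℚ n) F₊ F₋ G (rt F₊ F₋) (φ→ (f ⁺)) (φ→ (f ⁻)) R (φ← marginal)) ⟩
  (lower F₊ (φ→ (f ⁺)) G + lower F₋ (φ→ (f ⁻)) G) + (F₊ + F₋ - rt F₊ F₋) * (G - R)
    ≡⟨ cong (λ t → (lower F₊ (φ→ (f ⁺)) t + lower F₋ (φ→ (f ⁻)) t) + (F₊ + F₋ - rt F₊ F₋) * (G - R))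
            (sym (∑-+ (g ⁺) (g ⁻))) ⟩
  (lower F₊ (φ→ (f ⁺)) (∑ marginal) + lower F₋ (φ→ (f ⁻)) (∑ marginal)) + (F₊ + F₋ - rt F₊ F₋) * (G - R)
    ≤⟨ ℚₚ.+-mono-≤ (ℚₚ.+-mono-≤
         (residual-bound (f ⁺) marginal (u ⁺) (correction 1ℚ) (λ x → 0≤f (Sign.+ ∷ x)) 0≤marginal)
         (residual-bound (f ⁻) marginal (u ⁻) (correction (- 1ℚ)) (λ x → 0≤f (Sign.- ∷ x)) 0≤marginal))
         (noise-bound 0≤F₊ 0≤F₋) ⟩
  (r₊ + r₋) + (F₊ * noise 1ℚ + F₋ * noise (- 1ℚ))
    ≡⟨ interchange r₊ r₋ (F₊ * noise 1ℚ) (F₋ * noise (- 1ℚ)) ⟩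
  (r₊ + F₊ * noise 1ℚ) + (r₋ + F₋ * noise (- 1ℚ))
    ≡⟨ cong₂ _+_ (sym (peel 1ℚ (f ⁺) (u ⁺))) (sym (peel (- 1ℚ) (f ⁻) (u ⁻))) ⟩
  residual f g u v ∎
  where
  open ℚₚ.≤-Reasoning
  open Peel g 0≤g v
  F₊ F₋ G R r₊ r₋ : ℚ
  F₊ = ∑ (f ⁺)
  F₋ = ∑ (f ⁻)
  G = ∑ g
  R = ∑ (λ y → rt ((g ⁺) y) ((g ⁻) y))
  r₊ = residual (f ⁺) marginal (u ⁺) (correction 1ℚ)
  r₋ = residual (f ⁻) marginal (u ⁻) (correction (- 1ℚ))
  lower : ℚ → ℚ → ℚ → ℚ
  lower F φ G = natℚ n * (F * G) - G * φ - F * φ← marginal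
  0≤F₊ : 0ℚ ≤ F₊
  0≤F₊ = ∑-nonneg (λ x → 0≤f (Sign.+ ∷ x))
  0≤F₋ : 0ℚ ≤ F₋
  0≤F₋ = ∑-nonneg (λ x → 0≤f (Sign.- ∷ x))
  0≤marginal : ∀ y → 0ℚ ≤ marginal y
  0≤marginal y = 0≤+ (0≤g (Sign.+ ∷ y)) (0≤g (Sign.- ∷ y))
  regroup : ∀ N F₊ F₋ G t p q R s →
    ((1ℚ + N) * ((F₊ + F₋) * G) - G * (t + (p + q)) - (F₊ + F₋) * (R + s)) + t * R
    ≡ ((N * (F₊ * G) - G * p - F₊ * s) + (N * (F₋ * G) - G * q - F₋ * s)) + (F₊ + F₋ - t) * (G - R)
  regroup = solve-∀ ℚ-ring

-- The price of one bit

two^ : ℕ → ℚ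
two^ zero    = 1ℚ
two^ (suc n) = 2ℚ * two^ n

0≤two^ : ∀ n → 0ℚ ≤ two^ n
0≤two^ zero    = 0≤1
0≤two^ (suc n) = 0≤* (ℚₚ.nonNegative⁻¹ 2ℚ) (0≤two^ n)

1≤two^ : ∀ n → 1ℚ ≤ two^ n
1≤two^ zero    = ℚₚ.≤-refl
1≤two^ (suc n) = ℚₚ.≤-trans (≤-by {1ℚ} {2ℚ} 1ℚ 0≤1 refl) (*-monoˡ-≤ {r = 2ℚ} (ℚₚ.nonNegative⁻¹ 2ℚ) (1≤two^ n))

*-units : ∀ p {q r} → q ≡ 1ℚ → r ≡ 1ℚ → p * (q * r) ≡ p
*-units p refl refl = ℚₚ.*-identityʳ p

-- The parallel sum of t a and b, divided by t.
κ : ℚ → ℚ → ℚ → ℚ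
κ t a b = a * b * inv (t * a + b)

-- The squared determinant of the table with rows (a , c) and (b , d). Rows are the two parts of a
-- cut, columns the two values of a coordinate. Merging rows changes `rt`, merging columns changes
-- `κ t`, and both changes are multiples of this determinant.
Δ² : ℚ → ℚ → ℚ → ℚ → ℚ
Δ² a c b d = sq (a * d - c * b)

-- `rt` is the perspective function x² / s at x = a - c, s = a + c. Merging x² / s and y² / r loses
-- (x r - y s)² / (s r (s + r)), and here x r - y s = 2 (a d - c b). Padding each term with factors
-- p * `inv p` turns the claim into a polynomial identity in the inverses.
rt-split : ∀ a c b d → a + c ≢ 0ℚ → b + d ≢ 0ℚ → (a + c) + (b + d) ≢ 0ℚ →
  rt a c + rt b d ≡ rt (a + b) (c + d)
    + ℤ.+ 4 / 1 * Δ² a c b d * (inv (a + c) * inv (b + d) * inv ((a + c) + (b + d)))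
rt-split a c b d A≢0 B≢0 S≢0 = begin
  rt a c + rt b d
    ≡⟨ cong₂ _+_ (sym (*-units (rt a c) eβ eσ)) (sym (*-units (rt b d) eα eσ)) ⟩
  rt a c * ((b + d) * β * (((a + c) + (b + d)) * σ)) + rt b d * ((a + c) * α * (((a + c) + (b + d)) * σ))
    ≡⟨ identity a c b d α β σ ⟩
  sq ((a + b) - (c + d)) * σ * ((a + c) * α * ((b + d) * β)) + ℤ.+ 4 / 1 * Δ² a c b d * (α * β * σ)
    ≡⟨ cong (_+ ℤ.+ 4 / 1 * Δ² a c b d * (α * β * σ)) (*-units (sq ((a + b) - (c + d)) * σ) eα eβ) ⟩
  sq ((a + b) - (c + d)) * σ + ℤ.+ 4 / 1 * Δ² a c b d * (α * β * σ)
    ≡⟨ cong (λ s → sq ((a + b) - (c + d)) * inv s + ℤ.+ 4 / 1 * Δ² a c b d * (α * β * σ)) (interchange a c b d) ⟩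
  rt (a + b) (c + d) + ℤ.+ 4 / 1 * Δ² a c b d * (α * β * σ) ∎
  where
  open ≡-Reasoning
  α β σ : ℚ
  α = inv (a + c)
  β = inv (b + d)
  σ = inv ((a + c) + (b + d))
  eα : (a + c) * α ≡ 1ℚ
  eα = *-inv A≢0
  eβ : (b + d) * β ≡ 1ℚ
  eβ = *-inv B≢0
  eσ : ((a + c) + (b + d)) * σ ≡ 1ℚ
  eσ = *-inv S≢0
  identity : ∀ a c b d α β σ →
    (a - c) * (a - c) * α * ((b + d) * β * (((a + c) + (b + d)) * σ))
      + (b - d) * (b - d) * β * ((a + c) * α * (((a + c) + (b + d)) * σ))
    ≡ ((a + b) - (c + d)) * ((a + b) - (c + d)) * σ * ((a + c) * α * ((b + d) * β))
      + ℤ.+ 4 / 1 * ((a * d - c * b) * (a * d - c * b)) * (α * β * σ)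
  identity = solve-∀ ℚ-ring

-- The defect of the parallel sum, with the numerator of `rt-split`; only the denominators differ,
-- so comparing the two is a matter of their sizes.
κ-split : ∀ t a c b d → t * (a + c) + (b + d) ≢ 0ℚ → t * a + b ≢ 0ℚ → t * c + d ≢ 0ℚ →
  κ t (a + c) (b + d) ≡ (κ t a b + κ t c d)
    + t * Δ² a c b d * (inv (t * (a + c) + (b + d)) * inv (t * a + b) * inv (t * c + d))
κ-split t a c b d P≢0 Q≢0 R≢0 = begin
  κ t (a + c) (b + d)
    ≡⟨ sym (*-units (κ t (a + c) (b + d)) ej ek) ⟩
  (a + c) * (b + d) * i * ((t * a + b) * j * ((t * c + d) * k))
    ≡⟨ identity t a c b d i j k ⟩
  (a * b * j * ((t * (a + c) + (b + d)) * i * ((t * c + d) * k))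
    + c * d * k * ((t * (a + c) + (b + d)) * i * ((t * a + b) * j)))
    + t * Δ² a c b d * (i * j * k)
    ≡⟨ cong (_+ t * Δ² a c b d * (i * j * k)) (cong₂ _+_ (*-units (κ t a b) ei ek) (*-units (κ t c d) ei ej)) ⟩
  (κ t a b + κ t c d) + t * Δ² a c b d * (i * j * k) ∎
  where
  open ≡-Reasoning
  i j k : ℚ
  i = inv (t * (a + c) + (b + d))
  j = inv (t * a + b)
  k = inv (t * c + d)
  ei : (t * (a + c) + (b + d)) * i ≡ 1ℚ
  ei = *-inv P≢0
  ej : (t * a + b) * j ≡ 1ℚ
  ej = *-inv Q≢0
  ek : (t * c + d) * k ≡ 1ℚ
  ek = *-inv R≢0
  identity : ∀ t a c b d i j k →
    (a + c) * (b + d) * i * ((t * a + b) * j * ((t * c + d) * k))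
    ≡ (a * b * j * ((t * (a + c) + (b + d)) * i * ((t * c + d) * k))
        + c * d * k * ((t * (a + c) + (b + d)) * i * ((t * a + b) * j)))
      + t * ((a * d - c * b) * (a * d - c * b)) * (i * j * k)
  identity = solve-∀ ℚ-ring

inv-lower : ∀ {p w} → 0ℚ ≤ p → p ≢ 0ℚ → w * p ≤ 1ℚ → w ≤ inv p
inv-lower {p} {w} 0≤p p≢0 wp≤1 = subst₂ _≤_
  (trans (ℚₚ.*-assoc w p (inv p)) (trans (cong (w *_) (*-inv p≢0)) (ℚₚ.*-identityʳ w)))
  (ℚₚ.*-identityˡ (inv p))
  (*-monoʳ-≤ (0≤inv 0≤p) wp≤1)

*-mono-≤ : ∀ {p q r s} → 0ℚ ≤ p → 0ℚ ≤ s → p ≤ q → r ≤ s → p * r ≤ q * s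
*-mono-≤ 0≤p 0≤s p≤q r≤s = ℚₚ.≤-trans (*-monoˡ-≤ 0≤p r≤s) (*-monoʳ-≤ 0≤s p≤q)

*-zero-pos : ∀ {t a} → 0ℚ < t → t * a ≡ 0ℚ → a ≡ 0ℚ
*-zero-pos {t} {a} 0<t ta≡0 = cancelˡ {r = t} (inv t) (*-inv (λ t≡0 → ℚₚ.<⇒≢ 0<t (sym t≡0))) (trans ta≡0 (sym (ℚₚ.*-zeroʳ t)))

κ-gain-zeroˡ : ∀ {t a c b d} w → a ≡ 0ℚ → b ≡ 0ℚ →
  (κ t a b + κ t c d) + t * Δ² a c b d * w ≡ κ t (a + c) (b + d)
κ-gain-zeroˡ {t} {_} {c} {_} {d} w refl refl = trans (vanish t c d w (inv (t * 0ℚ + 0ℚ)) (κ t c d))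
  (sym (cong₂ (κ t) (ℚₚ.+-identityˡ c) (ℚₚ.+-identityˡ d)))
  where
  vanish : ∀ t c d w i k → (0ℚ * 0ℚ * i + k) + t * ((0ℚ * d - c * 0ℚ) * (0ℚ * d - c * 0ℚ)) * w ≡ k
  vanish = solve-∀ ℚ-ring

κ-gain-zeroʳ : ∀ {t a c b d} w → c ≡ 0ℚ → d ≡ 0ℚ →
  (κ t a b + κ t c d) + t * Δ² a c b d * w ≡ κ t (a + c) (b + d)
κ-gain-zeroʳ {t} {a} {_} {b} {_} w refl refl = trans (vanish t a b w (inv (t * 0ℚ + 0ℚ)) (κ t a b))
  (sym (cong₂ (κ t) (ℚₚ.+-identityʳ a) (ℚₚ.+-identityʳ b)))
  where
  vanish : ∀ t a b w i k → (k + 0ℚ * 0ℚ * i) + t * ((a * 0ℚ - 0ℚ * b) * (a * 0ℚ - 0ℚ * b)) * w ≡ k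
  vanish = solve-∀ ℚ-ring

-- Since Q and R are at most P = Q + R, one w with w P ≤ 1 lies below all three inverses in
-- `κ-split`. If Q or R is 0, a whole column of the table vanishes and with it the determinant.
κ-gain : ∀ {t a c b d} w → 0ℚ < t → 0ℚ ≤ a → 0ℚ ≤ c → 0ℚ ≤ b → 0ℚ ≤ d →
  0ℚ ≤ w → w * (t * (a + c) + (b + d)) ≤ 1ℚ →
  (κ t a b + κ t c d) + t * Δ² a c b d * (w * w * w) ≤ κ t (a + c) (b + d)
κ-gain {t} {a} {c} {b} {d} w 0<t 0≤a 0≤c 0≤b 0≤d 0≤w wP≤1 = cases (Q ℚₚ.≟ 0ℚ) (R ℚₚ.≟ 0ℚ)
  where
  open ℚₚ.≤-Reasoning
  P Q R : ℚ
  P = t * (a + c) + (b + d)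
  Q = t * a + b
  R = t * c + d
  P≡Q+R : ∀ t a c b d → t * (a + c) + (b + d) ≡ (t * a + b) + (t * c + d)
  P≡Q+R = solve-∀ ℚ-ring
  0≤Q : 0ℚ ≤ Q
  0≤Q = 0≤+ (0≤* (ℚₚ.<⇒≤ 0<t) 0≤a) 0≤b
  0≤R : 0ℚ ≤ R
  0≤R = 0≤+ (0≤* (ℚₚ.<⇒≤ 0<t) 0≤c) 0≤d
  0≤P : 0ℚ ≤ P
  0≤P = subst (0ℚ ≤_) (sym (P≡Q+R t a c b d)) (0≤+ 0≤Q 0≤R)
  P≢0 : Q ≢ 0ℚ → P ≢ 0ℚ
  P≢0 Q≢0 P≡0 = Q≢0 (+-nonneg-zeroˡ 0≤Q 0≤R (trans (sym (P≡Q+R t a c b d)) P≡0))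
  Q≤P : Q ≤ P
  Q≤P = ≤-by R 0≤R (sym (P≡Q+R t a c b d))
  R≤P : R ≤ P
  R≤P = ≤-by Q 0≤Q (trans (ℚₚ.+-comm R Q) (sym (P≡Q+R t a c b d)))
  cases : Dec (Q ≡ 0ℚ) → Dec (R ≡ 0ℚ) → (κ t a b + κ t c d) + t * Δ² a c b d * (w * w * w) ≤ κ t (a + c) (b + d)
  cases (yes Q≡0) _ = ℚₚ.≤-reflexive (κ-gain-zeroˡ {t} {a} {c} {b} {d} (w * w * w)
    (*-zero-pos 0<t (+-nonneg-zeroˡ (0≤* (ℚₚ.<⇒≤ 0<t) 0≤a) 0≤b Q≡0)) (+-nonneg-zeroʳ (0≤* (ℚₚ.<⇒≤ 0<t) 0≤a) 0≤b Q≡0))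
  cases (no _) (yes R≡0) = ℚₚ.≤-reflexive (κ-gain-zeroʳ {t} {a} {c} {b} {d} (w * w * w)
    (*-zero-pos 0<t (+-nonneg-zeroˡ (0≤* (ℚₚ.<⇒≤ 0<t) 0≤c) 0≤d R≡0)) (+-nonneg-zeroʳ (0≤* (ℚₚ.<⇒≤ 0<t) 0≤c) 0≤d R≡0))
  cases (no Q≢0) (no R≢0) = begin
    (κ t a b + κ t c d) + t * Δ² a c b d * (w * w * w)
      ≤⟨ ℚₚ.+-monoʳ-≤ (κ t a b + κ t c d) (*-monoˡ-≤ (0≤* (ℚₚ.<⇒≤ 0<t) (0≤sq (a * d - c * b)))
           (*-mono-≤ (0≤* 0≤w 0≤w) (0≤inv 0≤R) (*-mono-≤ 0≤w (0≤inv 0≤Q) w≤i w≤j) w≤k)) ⟩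
    (κ t a b + κ t c d) + t * Δ² a c b d * (inv P * inv Q * inv R)
      ≡⟨ sym (κ-split t a c b d (P≢0 Q≢0) Q≢0 R≢0) ⟩
    κ t (a + c) (b + d) ∎
    where
    w≤i : w ≤ inv P
    w≤i = inv-lower 0≤P (P≢0 Q≢0) wP≤1
    w≤j : w ≤ inv Q
    w≤j = inv-lower 0≤Q Q≢0 (ℚₚ.≤-trans (*-monoˡ-≤ 0≤w Q≤P) wP≤1)
    w≤k : w ≤ inv R
    w≤k = inv-lower 0≤R R≢0 (ℚₚ.≤-trans (*-monoˡ-≤ 0≤w R≤P) wP≤1)

κ-superadditive : ∀ {t a c b d} → 0ℚ < t → 0ℚ ≤ a → 0ℚ ≤ c → 0ℚ ≤ b → 0ℚ ≤ d →
  κ t a b + κ t c d ≤ κ t (a + c) (b + d)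
κ-superadditive {t} {a} {c} {b} {d} 0<t 0≤a 0≤c 0≤b 0≤d = subst (_≤ κ t (a + c) (b + d))
  (vanish (κ t a b + κ t c d) (t * Δ² a c b d))
  (κ-gain 0ℚ 0<t 0≤a 0≤c 0≤b 0≤d ℚₚ.≤-refl
    (subst (_≤ 1ℚ) (sym (ℚₚ.*-zeroˡ (t * (a + c) + (b + d)))) 0≤1))
  where
  vanish : ∀ k e → k + e * (0ℚ * 0ℚ * 0ℚ) ≡ k
  vanish = solve-∀ ℚ-ring

64ℚ : ℚ
64ℚ = ℤ.+ 64 / 1

-- The choice of t with t a ≈ b makes the gain of κ t comparable to that of rt.
rt-κ-gain : ∀ {t a c b d} → 0ℚ < t → 0ℚ ≤ a → 0ℚ ≤ c → 0ℚ ≤ b → 0ℚ ≤ d →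
  0ℚ < a + c → 0ℚ < b + d → t * (a + c) ≤ b + d → b + d ≤ 2ℚ * (t * (a + c)) →
  (rt a c + rt b d) + 64ℚ * (κ t a b + κ t c d) ≤ rt (a + b) (c + d) + 64ℚ * κ t (a + c) (b + d)
rt-κ-gain {t} {a} {c} {b} {d} 0<t 0≤a 0≤c 0≤b 0≤d 0<A 0<B tA≤B B≤2tA = begin
  (rt a c + rt b d) + 64ℚ * (κ t a b + κ t c d)
    ≡⟨ cong (_+ 64ℚ * (κ t a b + κ t c d)) (rt-split a c b d A≢0 B≢0 S≢0) ⟩
  (rt (a + b) (c + d) + ℤ.+ 4 / 1 * D * (α * β * σ)) + 64ℚ * (κ t a b + κ t c d)
    ≤⟨ ℚₚ.+-monoˡ-≤ (64ℚ * (κ t a b + κ t c d)) (ℚₚ.+-monoʳ-≤ (rt (a + b) (c + d)) compare) ⟩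
  (rt (a + b) (c + d) + 64ℚ * (t * D * (w * w * w))) + 64ℚ * (κ t a b + κ t c d)
    ≡⟨ regroup (rt (a + b) (c + d)) (t * D * (w * w * w)) (κ t a b + κ t c d) ⟩
  rt (a + b) (c + d) + 64ℚ * ((κ t a b + κ t c d) + t * D * (w * w * w))
    ≤⟨ ℚₚ.+-monoʳ-≤ (rt (a + b) (c + d)) (*-monoˡ-≤ (ℚₚ.nonNegative⁻¹ 64ℚ) (κ-gain w 0<t 0≤a 0≤c 0≤b 0≤d 0≤w wP≤1)) ⟩
  rt (a + b) (c + d) + 64ℚ * κ t (a + c) (b + d) ∎
  where
  open ℚₚ.≤-Reasoning
  A B D α β σ w : ℚ
  A = a + c
  B = b + d
  D = Δ² a c b d
  α = inv A
  β = inv B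
  σ = inv (A + B)
  -- From t A ≤ B one has P = t A + B ≤ 2 B, hence w P ≤ 1.
  w = ½ * β
  A≢0 : A ≢ 0ℚ
  A≢0 A≡0 = ℚₚ.<⇒≢ 0<A (sym A≡0)
  B≢0 : B ≢ 0ℚ
  B≢0 B≡0 = ℚₚ.<⇒≢ 0<B (sym B≡0)
  0≤A : 0ℚ ≤ A
  0≤A = ℚₚ.<⇒≤ 0<A
  0≤B : 0ℚ ≤ B
  0≤B = ℚₚ.<⇒≤ 0<B
  S≢0 : A + B ≢ 0ℚ
  S≢0 S≡0 = A≢0 (+-nonneg-zeroˡ 0≤A 0≤B S≡0)
  0≤α : 0ℚ ≤ α
  0≤α = 0≤inv 0≤A
  0≤β : 0ℚ ≤ β
  0≤β = 0≤inv 0≤B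
  0≤w : 0ℚ ≤ w
  0≤w = 0≤* (ℚₚ.nonNegative⁻¹ ½) 0≤β
  wP≤1 : w * (t * A + B) ≤ 1ℚ
  wP≤1 = begin
    w * (t * A + B)  ≤⟨ *-monoˡ-≤ 0≤w (ℚₚ.+-monoˡ-≤ B tA≤B) ⟩
    w * (B + B)      ≡⟨ half B β ⟩
    B * β            ≡⟨ *-inv B≢0 ⟩
    1ℚ               ∎
    where
    half : ∀ B β → ½ * β * (B + B) ≡ B * β
    half = solve-∀ ℚ-ring
  σ≤β : σ ≤ β
  σ≤β = inv-lower 0≤B B≢0 (begin
    σ * B        ≤⟨ *-monoˡ-≤ (0≤inv (0≤+ 0≤A 0≤B)) (≤-by A 0≤A (ℚₚ.+-comm B A)) ⟩
    σ * (A + B)  ≡⟨ trans (ℚₚ.*-comm σ (A + B)) (*-inv S≢0) ⟩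
    1ℚ           ∎)
  α≤2tβ : α ≤ 2ℚ * t * β
  α≤2tβ = begin
    α                        ≡⟨ sym (trans (cong (α *_) (*-inv B≢0)) (ℚₚ.*-identityʳ α)) ⟩
    α * (B * β)              ≤⟨ *-monoˡ-≤ 0≤α (*-monoʳ-≤ 0≤β B≤2tA) ⟩
    α * (2ℚ * (t * A) * β)   ≡⟨ rearrange α A t β ⟩
    2ℚ * t * β * (A * α)     ≡⟨ trans (cong (2ℚ * t * β *_) (*-inv A≢0)) (ℚₚ.*-identityʳ (2ℚ * t * β)) ⟩
    2ℚ * t * β               ∎
    where
    rearrange : ∀ α A t β → α * (ℤ.+ 2 / 1 * (t * A) * β) ≡ ℤ.+ 2 / 1 * t * β * (A * α)
    rearrange = solve-∀ ℚ-ring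
  -- By α ≤ 2 t β and σ ≤ β the rise of `rt` is at most 8 t D β³, while the gain of `κ t` is at
  -- least t D w³ = t D β³ / 8. The quotient is 64.
  compare : ℤ.+ 4 / 1 * D * (α * β * σ) ≤ 64ℚ * (t * D * (w * w * w))
  compare = begin
    ℤ.+ 4 / 1 * D * (α * β * σ)
      ≤⟨ *-monoˡ-≤ (0≤* (ℚₚ.nonNegative⁻¹ (ℤ.+ 4 / 1)) (0≤sq (a * d - c * b)))
           (*-mono-≤ (0≤* 0≤α 0≤β) 0≤β (*-monoʳ-≤ 0≤β α≤2tβ) σ≤β) ⟩
    ℤ.+ 4 / 1 * D * (2ℚ * t * β * β * β)
      ≡⟨ rescale D t β ⟩
    64ℚ * (t * D * (w * w * w)) ∎
    where
    rescale : ∀ D t β → ℤ.+ 4 / 1 * D * (ℤ.+ 2 / 1 * t * β * β * β) ≡ ℤ.+ 64 / 1 * (t * D * (½ * β * (½ * β) * (½ * β)))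
    rescale = solve-∀ ℚ-ring
  regroup : ∀ r g k → (r + ℤ.+ 64 / 1 * g) + ℤ.+ 64 / 1 * k ≡ r + ℤ.+ 64 / 1 * (k + g)
  regroup = solve-∀ ℚ-ring

0≤κ : ∀ {t a b} → 0ℚ ≤ t → 0ℚ ≤ a → 0ℚ ≤ b → 0ℚ ≤ κ t a b
0≤κ 0≤t 0≤a 0≤b = 0≤* (0≤* 0≤a 0≤b) (0≤inv (0≤+ (0≤* 0≤t 0≤a) 0≤b))

*-inv≤1 : ∀ p → p * inv p ≤ 1ℚ
*-inv≤1 p = cases (p ℚₚ.≟ 0ℚ)
  where
  cases : Dec (p ≡ 0ℚ) → p * inv p ≤ 1ℚ
  cases (yes p≡0) = subst (_≤ 1ℚ) (sym (trans (cong (_* inv p) p≡0) (ℚₚ.*-zeroˡ (inv p)))) 0≤1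
  cases (no p≢0)  = ℚₚ.≤-reflexive (*-inv p≢0)

κ-bound : ∀ {t a b} → 0ℚ ≤ t → 0ℚ ≤ a → 0ℚ ≤ b → t * κ t a b ≤ b
κ-bound {t} {a} {b} 0≤t 0≤a 0≤b = begin
  t * κ t a b        ≡⟨ rearrange t a b i ⟩
  b * (t * a * i)    ≤⟨ *-monoˡ-≤ 0≤b (*-monoʳ-≤ (0≤inv (0≤+ (0≤* 0≤t 0≤a) 0≤b)) (≤-by {t * a} b 0≤b refl)) ⟩
  b * ((t * a + b) * i)  ≤⟨ *-monoˡ-≤ 0≤b (*-inv≤1 (t * a + b)) ⟩
  b * 1ℚ             ≡⟨ ℚₚ.*-identityʳ b ⟩
  b                  ∎
  where
  open ℚₚ.≤-Reasoning
  i : ℚ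
  i = inv (t * a + b)
  rearrange : ∀ t a b i → t * (a * b * i) ≡ b * (t * a * i)
  rearrange = solve-∀ ℚ-ring

-- The sum of κ over the dyadic scales t, 2 t, …, 2ᴶ t; it plays the role of the
-- entropy of the split (a , b), which is not rational.
ξ : ℕ → ℚ → ℚ → ℚ → ℚ
ξ zero    t a b = κ t a b
ξ (suc J) t a b = κ t a b + ξ J (2ℚ * t) a b

0<2* : ∀ {t} → 0ℚ < t → 0ℚ < 2ℚ * t
0<2* {t} 0<t = subst (_< 2ℚ * t) (ℚₚ.*-zeroʳ 2ℚ) (ℚₚ.*-monoʳ-<-pos 2ℚ 0<t)

0≤ξ : ∀ J {t a b} → 0ℚ < t → 0ℚ ≤ a → 0ℚ ≤ b → 0ℚ ≤ ξ J t a b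
0≤ξ zero    0<t 0≤a 0≤b = 0≤κ (ℚₚ.<⇒≤ 0<t) 0≤a 0≤b
0≤ξ (suc J) 0<t 0≤a 0≤b = 0≤+ (0≤κ (ℚₚ.<⇒≤ 0<t) 0≤a 0≤b) (0≤ξ J (0<2* 0<t) 0≤a 0≤b)

-- At scale 2ʲ t the summand is at most b / (2ʲ t), a geometric series. The bound does not involve
-- J, so the price of a bit will not depend on n.
ξ-bound : ∀ J {t a b} → 0ℚ < t → 0ℚ ≤ a → 0ℚ ≤ b → t * ξ J t a b ≤ 2ℚ * b
ξ-bound zero    {t} {a} {b} 0<t 0≤a 0≤b = ℚₚ.≤-trans (κ-bound (ℚₚ.<⇒≤ 0<t) 0≤a 0≤b) (≤-by b 0≤b (double b))
  where
  double : ∀ b → b + b ≡ ℤ.+ 2 / 1 * b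
  double = solve-∀ ℚ-ring
ξ-bound (suc J) {t} {a} {b} 0<t 0≤a 0≤b = begin
  t * (κ t a b + ξ J (2ℚ * t) a b)             ≡⟨ rearrange t (κ t a b) (ξ J (2ℚ * t) a b) ⟩
  t * κ t a b + ½ * (2ℚ * t * ξ J (2ℚ * t) a b)
    ≤⟨ ℚₚ.+-mono-≤ (κ-bound (ℚₚ.<⇒≤ 0<t) 0≤a 0≤b) (*-monoˡ-≤ (ℚₚ.nonNegative⁻¹ ½) (ξ-bound J (0<2* 0<t) 0≤a 0≤b)) ⟩
  b + ½ * (2ℚ * b)                             ≡⟨ double b ⟩
  2ℚ * b                                       ∎
  where
  open ℚₚ.≤-Reasoning
  rearrange : ∀ t k x → t * (k + x) ≡ t * k + ½ * (ℤ.+ 2 / 1 * t * x)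
  rearrange = solve-∀ ℚ-ring
  double : ∀ b → b + ½ * (ℤ.+ 2 / 1 * b) ≡ ℤ.+ 2 / 1 * b
  double = solve-∀ ℚ-ring

ξ-superadditive : ∀ J {t a c b d} → 0ℚ < t → 0ℚ ≤ a → 0ℚ ≤ c → 0ℚ ≤ b → 0ℚ ≤ d →
  ξ J t a b + ξ J t c d ≤ ξ J t (a + c) (b + d)
ξ-superadditive zero    0<t 0≤a 0≤c 0≤b 0≤d = κ-superadditive 0<t 0≤a 0≤c 0≤b 0≤d
ξ-superadditive (suc J) {t} {a} {c} {b} {d} 0<t 0≤a 0≤c 0≤b 0≤d = subst (_≤ ξ (suc J) t (a + c) (b + d))
  (sym (interchange (κ t a b) (ξ J (2ℚ * t) a b) (κ t c d) (ξ J (2ℚ * t) c d)))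
  (ℚₚ.+-mono-≤ (κ-superadditive {t} 0<t 0≤a 0≤c 0≤b 0≤d) (ξ-superadditive J (0<2* 0<t) 0≤a 0≤c 0≤b 0≤d))

add-gain : ∀ {x y z w p q : ℚ} → x + 64ℚ * y ≤ z + 64ℚ * w → p ≤ q → x + 64ℚ * (y + p) ≤ z + 64ℚ * (w + q)
add-gain {x} {y} {z} {w} {p} {q} h p≤q = subst₂ _≤_ (regroup x y p) (regroup z w q)
  (ℚₚ.+-mono-≤ h (*-monoˡ-≤ (ℚₚ.nonNegative⁻¹ 64ℚ) p≤q))
  where
  regroup : ∀ x y p → (x + ℤ.+ 64 / 1 * y) + ℤ.+ 64 / 1 * p ≡ x + ℤ.+ 64 / 1 * (y + p)
  regroup = solve-∀ ℚ-ring

-- The ratio of b + d to a + c lies between 2ʲ t and 2ʲ⁺¹ t for some j ≤ J. That scale pays for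
-- `rt`; at the others superadditivity suffices.
rt-ξ-gain : ∀ J {t a c b d} → 0ℚ < t → 0ℚ ≤ a → 0ℚ ≤ c → 0ℚ ≤ b → 0ℚ ≤ d →
  0ℚ < a + c → 0ℚ < b + d → t * (a + c) ≤ b + d → b + d ≤ two^ J * (2ℚ * (t * (a + c))) →
  (rt a c + rt b d) + 64ℚ * (ξ J t a b + ξ J t c d) ≤ rt (a + b) (c + d) + 64ℚ * ξ J t (a + c) (b + d)
rt-ξ-gain zero {t} {a} {c} {b} {d} 0<t 0≤a 0≤c 0≤b 0≤d 0<A 0<B tA≤B B≤ =
  rt-κ-gain 0<t 0≤a 0≤c 0≤b 0≤d 0<A 0<B tA≤B
    (subst (b + d ≤_) (ℚₚ.*-identityˡ (2ℚ * (t * (a + c)))) B≤)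
rt-ξ-gain (suc J) {t} {a} {c} {b} {d} 0<t 0≤a 0≤c 0≤b 0≤d 0<A 0<B tA≤B B≤ =
  cases (ℚₚ.≤-total (b + d) (2ℚ * (t * (a + c))))
  where
  Goal : Set
  Goal = (rt a c + rt b d) + 64ℚ * (ξ (suc J) t a b + ξ (suc J) t c d)
           ≤ rt (a + b) (c + d) + 64ℚ * ξ (suc J) t (a + c) (b + d)
  κ₁ κ₂ ξ₁ ξ₂ : ℚ
  κ₁ = κ t a b
  κ₂ = κ t c d
  ξ₁ = ξ J (2ℚ * t) a b
  ξ₂ = ξ J (2ℚ * t) c d
  combine : ∀ {k e : ℚ} → (rt a c + rt b d) + 64ℚ * (κ₁ + κ₂) ≤ rt (a + b) (c + d) + 64ℚ * k → ξ₁ + ξ₂ ≤ e →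
    (rt a c + rt b d) + 64ℚ * ((κ₁ + ξ₁) + (κ₂ + ξ₂)) ≤ rt (a + b) (c + d) + 64ℚ * (k + e)
  combine {k} {e} h₁ h₂ = subst (λ s → (rt a c + rt b d) + 64ℚ * s ≤ rt (a + b) (c + d) + 64ℚ * (k + e))
    (interchange κ₁ κ₂ ξ₁ ξ₂)
    (add-gain {rt a c + rt b d} {κ₁ + κ₂} {rt (a + b) (c + d)} {k} {ξ₁ + ξ₂} {e} h₁ h₂)
  combine′ : ∀ {k e : ℚ} → (rt a c + rt b d) + 64ℚ * (ξ₁ + ξ₂) ≤ rt (a + b) (c + d) + 64ℚ * e → κ₁ + κ₂ ≤ k →
    (rt a c + rt b d) + 64ℚ * ((κ₁ + ξ₁) + (κ₂ + ξ₂)) ≤ rt (a + b) (c + d) + 64ℚ * (k + e)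
  combine′ {k} {e} h₁ h₂ = subst₂ (λ s s′ → (rt a c + rt b d) + 64ℚ * s ≤ rt (a + b) (c + d) + 64ℚ * s′)
    (trans (ℚₚ.+-comm (ξ₁ + ξ₂) (κ₁ + κ₂)) (interchange κ₁ κ₂ ξ₁ ξ₂)) (ℚₚ.+-comm e k)
    (add-gain {rt a c + rt b d} {ξ₁ + ξ₂} {rt (a + b) (c + d)} {e} {κ₁ + κ₂} {k} h₁ h₂)
  reassoc : ∀ t A → ℤ.+ 2 / 1 * (t * A) ≡ ℤ.+ 2 / 1 * t * A
  reassoc = solve-∀ ℚ-ring
  reassoc′ : ∀ p t A → ℤ.+ 2 / 1 * p * (ℤ.+ 2 / 1 * (t * A)) ≡ p * (ℤ.+ 2 / 1 * (ℤ.+ 2 / 1 * t * A))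
  reassoc′ = solve-∀ ℚ-ring
  cases : (b + d ≤ 2ℚ * (t * (a + c))) ⊎ (2ℚ * (t * (a + c)) ≤ b + d) → Goal
  cases (inj₁ B≤2tA) = combine {κ t (a + c) (b + d)} {ξ J (2ℚ * t) (a + c) (b + d)}
    (rt-κ-gain 0<t 0≤a 0≤c 0≤b 0≤d 0<A 0<B tA≤B B≤2tA)
    (ξ-superadditive J (0<2* 0<t) 0≤a 0≤c 0≤b 0≤d)
  cases (inj₂ 2tA≤B) = combine′ {κ t (a + c) (b + d)} {ξ J (2ℚ * t) (a + c) (b + d)}
    (rt-ξ-gain J (0<2* 0<t) 0≤a 0≤c 0≤b 0≤d 0<A 0<B
      (subst (_≤ b + d) (reassoc t (a + c)) 2tA≤B)
      (subst (b + d ≤_) (reassoc′ (two^ J) t (a + c)) B≤))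
    (κ-superadditive {t} 0<t 0≤a 0≤c 0≤b 0≤d)

-- The scales start at 1, so `ξ J 1ℚ` serves only cuts whose second part is the heavier one. The sum
-- of both orders serves every cut.
Ξ : ℕ → ℚ → ℚ → ℚ
Ξ J a b = ξ J 1ℚ a b + ξ J 1ℚ b a

0<1 : 0ℚ < 1ℚ
0<1 = ℚₚ.positive⁻¹ 1ℚ

0≤Ξ : ∀ J {a b} → 0ℚ ≤ a → 0ℚ ≤ b → 0ℚ ≤ Ξ J a b
0≤Ξ J 0≤a 0≤b = 0≤+ (0≤ξ J 0<1 0≤a 0≤b) (0≤ξ J 0<1 0≤b 0≤a)

Ξ-bound : ∀ J {a b} → 0ℚ ≤ a → 0ℚ ≤ b → 64ℚ * Ξ J a b ≤ ℤ.+ 128 / 1 * (a + b)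
Ξ-bound J {a} {b} 0≤a 0≤b = begin
  64ℚ * (ξ J 1ℚ a b + ξ J 1ℚ b a)
    ≡⟨ cong₂ (λ x y → 64ℚ * (x + y)) (sym (ℚₚ.*-identityˡ (ξ J 1ℚ a b))) (sym (ℚₚ.*-identityˡ (ξ J 1ℚ b a))) ⟩
  64ℚ * (1ℚ * ξ J 1ℚ a b + 1ℚ * ξ J 1ℚ b a)
    ≤⟨ *-monoˡ-≤ (ℚₚ.nonNegative⁻¹ 64ℚ) (ℚₚ.+-mono-≤ (ξ-bound J 0<1 0≤a 0≤b) (ξ-bound J 0<1 0≤b 0≤a)) ⟩
  64ℚ * (2ℚ * b + 2ℚ * a)
    ≡⟨ collect a b ⟩
  ℤ.+ 128 / 1 * (a + b) ∎
  where
  open ℚₚ.≤-Reasoning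
  collect : ∀ a b → ℤ.+ 64 / 1 * (ℤ.+ 2 / 1 * b + ℤ.+ 2 / 1 * a) ≡ ℤ.+ 128 / 1 * (a + b)
  collect = solve-∀ ℚ-ring

Ξ-superadditive : ∀ J {a c b d} → 0ℚ ≤ a → 0ℚ ≤ c → 0ℚ ≤ b → 0ℚ ≤ d → Ξ J a b + Ξ J c d ≤ Ξ J (a + c) (b + d)
Ξ-superadditive J {a} {c} {b} {d} 0≤a 0≤c 0≤b 0≤d = subst (_≤ Ξ J (a + c) (b + d))
  (interchange (ξ J 1ℚ a b) (ξ J 1ℚ c d) (ξ J 1ℚ b a) (ξ J 1ℚ d c))
  (ℚₚ.+-mono-≤ (ξ-superadditive J {1ℚ} 0<1 0≤a 0≤c 0≤b 0≤d) (ξ-superadditive J {1ℚ} 0<1 0≤b 0≤d 0≤a 0≤c))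

-- The property of counting weights that survives summation. Together with masses at most 2ᴶ it
-- confines the ratio of two nonzero masses to [2⁻ᴶ , 2ᴶ], the range covered by `Ξ J`.
ZeroOr≥1 : ℚ → Set
ZeroOr≥1 p = p ≡ 0ℚ ⊎ 1ℚ ≤ p

ZeroOr≥1⇒0≤ : ∀ {p} → ZeroOr≥1 p → 0ℚ ≤ p
ZeroOr≥1⇒0≤ (inj₁ refl) = ℚₚ.≤-refl
ZeroOr≥1⇒0≤ (inj₂ 1≤p)  = ℚₚ.≤-trans 0≤1 1≤p

ZeroOr≥1-+ : ∀ {p q} → ZeroOr≥1 p → ZeroOr≥1 q → ZeroOr≥1 (p + q)
ZeroOr≥1-+ {p} {q} (inj₁ p≡0) q⋆ = subst ZeroOr≥1 (sym (trans (cong (_+ q) p≡0) (ℚₚ.+-identityˡ q))) q⋆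
ZeroOr≥1-+ {p} {q} (inj₂ 1≤p) q⋆ = inj₂ (ℚₚ.≤-trans 1≤p (≤-by q (ZeroOr≥1⇒0≤ q⋆) refl))

∑-ZeroOr≥1 : ∀ {n} {f : Cube n → ℚ} → (∀ x → ZeroOr≥1 (f x)) → ZeroOr≥1 (∑ f)
∑-ZeroOr≥1 {zero}  f⋆ = f⋆ []
∑-ZeroOr≥1 {suc n} f⋆ = ZeroOr≥1-+ (∑-ZeroOr≥1 (λ x → f⋆ (Sign.+ ∷ x))) (∑-ZeroOr≥1 (λ x → f⋆ (Sign.- ∷ x)))

rt-zeroˡ : ∀ {a c b d} → a ≡ 0ℚ → c ≡ 0ℚ → rt a c + rt b d ≡ rt (a + b) (c + d)
rt-zeroˡ {_} {_} {b} {d} refl refl = trans (ℚₚ.+-identityˡ (rt b d))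
  (sym (cong₂ rt (ℚₚ.+-identityˡ b) (ℚₚ.+-identityˡ d)))

rt-zeroʳ : ∀ {a c b d} → b ≡ 0ℚ → d ≡ 0ℚ → rt a c + rt b d ≡ rt (a + b) (c + d)
rt-zeroʳ {a} {c} refl refl = trans (ℚₚ.+-identityʳ (rt a c))
  (sym (cong₂ rt (ℚₚ.+-identityʳ a) (ℚₚ.+-identityʳ c)))

two^-scale-≤ : ∀ J {p q} → 1ℚ ≤ p → q ≤ two^ J → q ≤ two^ J * (2ℚ * (1ℚ * p))
two^-scale-≤ J {p} {q} 1≤p q≤ = ℚₚ.≤-trans q≤ (≤-by (two^ J * (p + (p - 1ℚ)))
  (0≤* (0≤two^ J) (0≤+ (ℚₚ.≤-trans 0≤1 1≤p) (0≤q-p 1≤p))) (expand (two^ J) p))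
  where
  expand : ∀ t p → t + t * (p + (p - 1ℚ)) ≡ t * (ℤ.+ 2 / 1 * (1ℚ * p))
  expand = solve-∀ ℚ-ring

rt-Ξ-gain : ∀ J {a c b d} → 0ℚ ≤ a → 0ℚ ≤ c → 0ℚ ≤ b → 0ℚ ≤ d →
  ZeroOr≥1 (a + c) → ZeroOr≥1 (b + d) → a + c ≤ two^ J → b + d ≤ two^ J →
  (rt a c + rt b d) + 64ℚ * (Ξ J a b + Ξ J c d) ≤ rt (a + b) (c + d) + 64ℚ * Ξ J (a + c) (b + d)
rt-Ξ-gain J {a} {c} {b} {d} 0≤a 0≤c 0≤b 0≤d = cases
  where
  Goal : Set
  Goal = (rt a c + rt b d) + 64ℚ * (Ξ J a b + Ξ J c d) ≤ rt (a + b) (c + d) + 64ℚ * Ξ J (a + c) (b + d)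
  no-loss : rt a c + rt b d ≡ rt (a + b) (c + d) → Goal
  no-loss eq = ℚₚ.+-mono-≤ (ℚₚ.≤-reflexive eq)
    (*-monoˡ-≤ (ℚₚ.nonNegative⁻¹ 64ℚ) (Ξ-superadditive J 0≤a 0≤c 0≤b 0≤d))
  ξ₁ ξ₂ η₁ η₂ ξ₀ η₀ : ℚ
  ξ₁ = ξ J 1ℚ a b
  ξ₂ = ξ J 1ℚ c d
  ξ₀ = ξ J 1ℚ (a + c) (b + d)
  η₁ = ξ J 1ℚ b a
  η₂ = ξ J 1ℚ d c
  η₀ = ξ J 1ℚ (b + d) (a + c)
  by-ξ : (rt a c + rt b d) + 64ℚ * (ξ₁ + ξ₂) ≤ rt (a + b) (c + d) + 64ℚ * ξ₀ → Goal
  by-ξ h = subst (λ s → (rt a c + rt b d) + 64ℚ * s ≤ rt (a + b) (c + d) + 64ℚ * (ξ₀ + η₀))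
    (interchange ξ₁ ξ₂ η₁ η₂)
    (add-gain {rt a c + rt b d} {ξ₁ + ξ₂} {rt (a + b) (c + d)} {ξ₀} {η₁ + η₂} {η₀} h
      (ξ-superadditive J {1ℚ} 0<1 0≤b 0≤d 0≤a 0≤c))
  by-η : (rt b d + rt a c) + 64ℚ * (η₁ + η₂) ≤ rt (b + a) (d + c) + 64ℚ * η₀ → Goal
  by-η h = subst₂ (λ s s′ → (rt a c + rt b d) + 64ℚ * s ≤ rt (a + b) (c + d) + 64ℚ * s′)
    (trans (ℚₚ.+-comm (η₁ + η₂) (ξ₁ + ξ₂)) (interchange ξ₁ ξ₂ η₁ η₂)) (ℚₚ.+-comm η₀ ξ₀)
    (add-gain {rt a c + rt b d} {η₁ + η₂} {rt (a + b) (c + d)} {η₀} {ξ₁ + ξ₂} {ξ₀}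
      (subst₂ (λ s s′ → s + 64ℚ * (η₁ + η₂) ≤ s′ + 64ℚ * η₀) (ℚₚ.+-comm (rt b d) (rt a c))
        (cong₂ rt (ℚₚ.+-comm b a) (ℚₚ.+-comm d c)) h)
      (ξ-superadditive J {1ℚ} 0<1 0≤a 0≤c 0≤b 0≤d))
  1≤⇒0< : ∀ {p} → 1ℚ ≤ p → 0ℚ < p
  1≤⇒0< = ℚₚ.<-≤-trans 0<1
  cases : ZeroOr≥1 (a + c) → ZeroOr≥1 (b + d) → a + c ≤ two^ J → b + d ≤ two^ J → Goal
  cases (inj₁ A≡0) _ _ _ = no-loss (rt-zeroˡ (+-nonneg-zeroˡ 0≤a 0≤c A≡0) (+-nonneg-zeroʳ 0≤a 0≤c A≡0))
  cases (inj₂ _) (inj₁ B≡0) _ _ = no-loss (rt-zeroʳ {a} {c} (+-nonneg-zeroˡ 0≤b 0≤d B≡0) (+-nonneg-zeroʳ 0≤b 0≤d B≡0))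
  cases (inj₂ 1≤A) (inj₂ 1≤B) A≤ B≤ = order (ℚₚ.≤-total (a + c) (b + d))
    where
    order : (a + c ≤ b + d) ⊎ (b + d ≤ a + c) → Goal
    order (inj₁ A≤B) = by-ξ (rt-ξ-gain J {1ℚ} 0<1 0≤a 0≤c 0≤b 0≤d (1≤⇒0< 1≤A) (1≤⇒0< 1≤B)
      (subst (_≤ b + d) (sym (ℚₚ.*-identityˡ (a + c))) A≤B) (two^-scale-≤ J 1≤A B≤))
    order (inj₂ B≤A) = by-η (rt-ξ-gain J {1ℚ} 0<1 0≤b 0≤d 0≤a 0≤c (1≤⇒0< 1≤B) (1≤⇒0< 1≤A)
      (subst (_≤ a + c) (sym (ℚₚ.*-identityˡ (b + d))) B≤A) (two^-scale-≤ J 1≤B A≤))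

-- The potentials under a cut of the weight

φ→-cong : ∀ {n} {f g : Cube n → ℚ} → (∀ x → f x ≡ g x) → φ→ f ≡ φ→ g
φ→-cong {zero}  f≡g = refl
φ→-cong {suc n} f≡g = cong₂ _+_
  (cong₂ rt (∑-cong (λ x → f≡g (Sign.+ ∷ x))) (∑-cong (λ x → f≡g (Sign.- ∷ x))))
  (cong₂ _+_ (φ→-cong (λ x → f≡g (Sign.+ ∷ x))) (φ→-cong (λ x → f≡g (Sign.- ∷ x))))

φ←-cong : ∀ {n} {f g : Cube n → ℚ} → (∀ x → f x ≡ g x) → φ← f ≡ φ← g
φ←-cong {zero}  f≡g = refl
φ←-cong {suc n} f≡g = cong₂ _+_
  (∑-cong (λ x → cong₂ rt (f≡g (Sign.+ ∷ x)) (f≡g (Sign.- ∷ x))))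
  (φ←-cong (λ x → cong₂ _+_ (f≡g (Sign.+ ∷ x)) (f≡g (Sign.- ∷ x))))

-- A chain rule. The halves x₁ = 1 and x₁ = -1 charge `Ξ J a b` and `Ξ J c d`; `rt-Ξ-gain` merges
-- these with the rise at x₁ into the single charge for the whole cut, so nothing accumulates over
-- the coordinates.
φ→-split : ∀ {n} J (f g : Cube n → ℚ) → (∀ x → ZeroOr≥1 (f x)) → (∀ x → ZeroOr≥1 (g x)) →
  ∑ f ≤ two^ J → ∑ g ≤ two^ J →
  φ→ f + φ→ g ≤ φ→ (λ x → f x + g x) + 64ℚ * Ξ J (∑ f) (∑ g)
φ→-split {zero}  J f g f⋆ g⋆ ∑f≤ ∑g≤ = 0≤+ {0ℚ} ℚₚ.≤-refl
  (0≤* (ℚₚ.nonNegative⁻¹ 64ℚ) (0≤Ξ J (ZeroOr≥1⇒0≤ (f⋆ [])) (ZeroOr≥1⇒0≤ (g⋆ []))))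
φ→-split {suc n} J f g f⋆ g⋆ ∑f≤ ∑g≤ = begin
  (rt a c + (φ→ (f ⁺) + φ→ (f ⁻))) + (rt b d + (φ→ (g ⁺) + φ→ (g ⁻)))
    ≡⟨ regroup (rt a c) (φ→ (f ⁺)) (φ→ (f ⁻)) (rt b d) (φ→ (g ⁺)) (φ→ (g ⁻)) ⟩
  (rt a c + rt b d) + ((φ→ (f ⁺) + φ→ (g ⁺)) + (φ→ (f ⁻) + φ→ (g ⁻)))
    ≤⟨ ℚₚ.+-monoʳ-≤ (rt a c + rt b d) (ℚₚ.+-mono-≤
         (φ→-split J (f ⁺) (g ⁺) (λ x → f⋆ (Sign.+ ∷ x)) (λ x → g⋆ (Sign.+ ∷ x)) a≤ b≤)
         (φ→-split J (f ⁻) (g ⁻) (λ x → f⋆ (Sign.- ∷ x)) (λ x → g⋆ (Sign.- ∷ x)) c≤ d≤)) ⟩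
  (rt a c + rt b d) + ((φ→ h₊ + 64ℚ * Ξ J a b) + (φ→ h₋ + 64ℚ * Ξ J c d))
    ≡⟨ regroup′ (rt a c + rt b d) (φ→ h₊) (φ→ h₋) (Ξ J a b) (Ξ J c d) ⟩
  ((rt a c + rt b d) + 64ℚ * (Ξ J a b + Ξ J c d)) + (φ→ h₊ + φ→ h₋)
    ≤⟨ ℚₚ.+-monoˡ-≤ (φ→ h₊ + φ→ h₋) (rt-Ξ-gain J 0≤a 0≤c 0≤b 0≤d (∑-ZeroOr≥1 f⋆) (∑-ZeroOr≥1 g⋆) ∑f≤ ∑g≤) ⟩
  (rt (a + b) (c + d) + 64ℚ * Ξ J (a + c) (b + d)) + (φ→ h₊ + φ→ h₋)
    ≡⟨ cong (λ r → (r + 64ℚ * Ξ J (a + c) (b + d)) + (φ→ h₊ + φ→ h₋))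
            (cong₂ rt (sym (∑-+ (f ⁺) (g ⁺))) (sym (∑-+ (f ⁻) (g ⁻)))) ⟩
  (rt (∑ h₊) (∑ h₋) + 64ℚ * Ξ J (a + c) (b + d)) + (φ→ h₊ + φ→ h₋)
    ≡⟨ regroup″ (rt (∑ h₊) (∑ h₋)) (64ℚ * Ξ J (a + c) (b + d)) (φ→ h₊ + φ→ h₋) ⟩
  (rt (∑ h₊) (∑ h₋) + (φ→ h₊ + φ→ h₋)) + 64ℚ * Ξ J (a + c) (b + d) ∎
  where
  open ℚₚ.≤-Reasoning
  a b c d : ℚ
  a = ∑ (f ⁺)
  c = ∑ (f ⁻)
  b = ∑ (g ⁺)
  d = ∑ (g ⁻)
  h₊ h₋ : Cube n → ℚ
  h₊ x = (f ⁺) x + (g ⁺) x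
  h₋ x = (f ⁻) x + (g ⁻) x
  0≤a : 0ℚ ≤ a
  0≤a = ∑-nonneg (λ x → ZeroOr≥1⇒0≤ (f⋆ (Sign.+ ∷ x)))
  0≤c : 0ℚ ≤ c
  0≤c = ∑-nonneg (λ x → ZeroOr≥1⇒0≤ (f⋆ (Sign.- ∷ x)))
  0≤b : 0ℚ ≤ b
  0≤b = ∑-nonneg (λ x → ZeroOr≥1⇒0≤ (g⋆ (Sign.+ ∷ x)))
  0≤d : 0ℚ ≤ d
  0≤d = ∑-nonneg (λ x → ZeroOr≥1⇒0≤ (g⋆ (Sign.- ∷ x)))
  a≤ : a ≤ two^ J
  a≤ = ℚₚ.≤-trans (≤-by {a} c 0≤c refl) ∑f≤
  c≤ : c ≤ two^ J
  c≤ = ℚₚ.≤-trans (≤-by {c} a 0≤a (ℚₚ.+-comm c a)) ∑f≤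
  b≤ : b ≤ two^ J
  b≤ = ℚₚ.≤-trans (≤-by {b} d 0≤d refl) ∑g≤
  d≤ : d ≤ two^ J
  d≤ = ℚₚ.≤-trans (≤-by {d} b 0≤b (ℚₚ.+-comm d b)) ∑g≤
  regroup : ∀ r p q s t u → (r + (p + q)) + (s + (t + u)) ≡ (r + s) + ((p + t) + (q + u))
  regroup = solve-∀ ℚ-ring
  regroup′ : ∀ r p q x y → r + ((p + ℤ.+ 64 / 1 * x) + (q + ℤ.+ 64 / 1 * y)) ≡ (r + ℤ.+ 64 / 1 * (x + y)) + (p + q)
  regroup′ = solve-∀ ℚ-ring
  regroup″ : ∀ r x p → (r + x) + p ≡ (r + p) + x
  regroup″ = solve-∀ ℚ-ring

term≤∑ : ∀ {n} (f : Cube n → ℚ) → (∀ x → 0ℚ ≤ f x) → ∀ x → f x ≤ ∑ f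
term≤∑ f 0≤f [] = ℚₚ.≤-refl
term≤∑ f 0≤f (Sign.+ ∷ x) = ℚₚ.≤-trans (term≤∑ (f ⁺) (λ y → 0≤f (Sign.+ ∷ y)) x)
  (≤-by {∑ (f ⁺)} (∑ (f ⁻)) (∑-nonneg (λ y → 0≤f (Sign.- ∷ y))) refl)
term≤∑ f 0≤f (Sign.- ∷ x) = ℚₚ.≤-trans (term≤∑ (f ⁻) (λ y → 0≤f (Sign.- ∷ y)) x)
  (≤-by {∑ (f ⁻)} (∑ (f ⁺)) (∑-nonneg (λ y → 0≤f (Sign.+ ∷ y))) (ℚₚ.+-comm (∑ (f ⁻)) (∑ (f ⁺))))

-- The sum on the left is the part of the potential spent on the tails y₂ … yₙ;
-- without it the induction would charge the full potential at every level.
φ←-split : ∀ {n} J (f g : Cube n → ℚ) → (∀ x → ZeroOr≥1 (f x)) → (∀ x → ZeroOr≥1 (g x)) →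
  ∑ f ≤ two^ J → ∑ g ≤ two^ J →
  (φ← f + φ← g) + 64ℚ * ∑ (λ y → Ξ J (f y) (g y)) ≤ φ← (λ x → f x + g x) + 64ℚ * Ξ J (∑ f) (∑ g)
φ←-split {zero}  J f g f⋆ g⋆ ∑f≤ ∑g≤ = ℚₚ.≤-refl
φ←-split {suc n} J f g f⋆ g⋆ ∑f≤ ∑g≤ = begin
  ((∑ rf + φ← f̄) + (∑ rg + φ← ḡ)) + 64ℚ * (∑ (Ξfg ⁺) + ∑ (Ξfg ⁻))
    ≡⟨ regroup (∑ rf) (φ← f̄) (∑ rg) (φ← ḡ) (∑ (Ξfg ⁺)) (∑ (Ξfg ⁻)) ⟩
  ((∑ rf + ∑ rg) + 64ℚ * (∑ (Ξfg ⁺) + ∑ (Ξfg ⁻))) + (φ← f̄ + φ← ḡ)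
    ≡⟨ cong (_+ (φ← f̄ + φ← ḡ)) (sym collect-left) ⟩
  ∑ (λ y → (rf y + rg y) + 64ℚ * ((Ξfg ⁺) y + (Ξfg ⁻) y)) + (φ← f̄ + φ← ḡ)
    ≤⟨ ℚₚ.+-monoˡ-≤ (φ← f̄ + φ← ḡ) (∑-mono point) ⟩
  ∑ (λ y → rfg y + 64ℚ * Ξ J (f̄ y) (ḡ y)) + (φ← f̄ + φ← ḡ)
    ≡⟨ cong (_+ (φ← f̄ + φ← ḡ)) collect-right ⟩
  (∑ rfg + 64ℚ * ∑ (λ y → Ξ J (f̄ y) (ḡ y))) + (φ← f̄ + φ← ḡ)
    ≡⟨ regroup′ (∑ rfg) (64ℚ * ∑ (λ y → Ξ J (f̄ y) (ḡ y))) (φ← f̄ + φ← ḡ) ⟩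
  ∑ rfg + ((φ← f̄ + φ← ḡ) + 64ℚ * ∑ (λ y → Ξ J (f̄ y) (ḡ y)))
    ≤⟨ ℚₚ.+-monoʳ-≤ (∑ rfg) (φ←-split J f̄ ḡ f̄⋆ ḡ⋆
         (subst (_≤ two^ J) (sym (∑-+ (f ⁺) (f ⁻))) ∑f≤) (subst (_≤ two^ J) (sym (∑-+ (g ⁺) (g ⁻))) ∑g≤)) ⟩
  ∑ rfg + (φ← (λ y → f̄ y + ḡ y) + 64ℚ * Ξ J (∑ f̄) (∑ ḡ))
    ≡⟨ cong₂ (λ p q → ∑ rfg + (p + 64ℚ * q))
         (φ←-cong (λ y → interchange ((f ⁺) y) ((f ⁻) y) ((g ⁺) y) ((g ⁻) y)))
         (cong₂ (Ξ J) (∑-+ (f ⁺) (f ⁻)) (∑-+ (g ⁺) (g ⁻))) ⟩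
  ∑ rfg + (φ← h̄ + 64ℚ * Ξ J (∑ f) (∑ g))
    ≡⟨ sym (ℚₚ.+-assoc (∑ rfg) (φ← h̄) (64ℚ * Ξ J (∑ f) (∑ g))) ⟩
  (∑ rfg + φ← h̄) + 64ℚ * Ξ J (∑ f) (∑ g) ∎
  where
  open ℚₚ.≤-Reasoning
  rf rg rfg f̄ ḡ h̄ : Cube n → ℚ
  rf y = rt ((f ⁺) y) ((f ⁻) y)
  rg y = rt ((g ⁺) y) ((g ⁻) y)
  rfg y = rt ((f ⁺) y + (g ⁺) y) ((f ⁻) y + (g ⁻) y)
  f̄ y = (f ⁺) y + (f ⁻) y
  ḡ y = (g ⁺) y + (g ⁻) y
  h̄ y = ((f ⁺) y + (g ⁺) y) + ((f ⁻) y + (g ⁻) y)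
  Ξfg : Cube (suc n) → ℚ
  Ξfg y = Ξ J (f y) (g y)
  f̄⋆ : ∀ y → ZeroOr≥1 (f̄ y)
  f̄⋆ y = ZeroOr≥1-+ (f⋆ (Sign.+ ∷ y)) (f⋆ (Sign.- ∷ y))
  ḡ⋆ : ∀ y → ZeroOr≥1 (ḡ y)
  ḡ⋆ y = ZeroOr≥1-+ (g⋆ (Sign.+ ∷ y)) (g⋆ (Sign.- ∷ y))
  f̄≤ : ∀ y → f̄ y ≤ two^ J
  f̄≤ y = ℚₚ.≤-trans (term≤∑ f̄ (λ x → ZeroOr≥1⇒0≤ (f̄⋆ x)) y) (subst (_≤ two^ J) (sym (∑-+ (f ⁺) (f ⁻))) ∑f≤)
  ḡ≤ : ∀ y → ḡ y ≤ two^ J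
  ḡ≤ y = ℚₚ.≤-trans (term≤∑ ḡ (λ x → ZeroOr≥1⇒0≤ (ḡ⋆ x)) y) (subst (_≤ two^ J) (sym (∑-+ (g ⁺) (g ⁻))) ∑g≤)
  point : ∀ y → (rf y + rg y) + 64ℚ * ((Ξfg ⁺) y + (Ξfg ⁻) y) ≤ rfg y + 64ℚ * Ξ J (f̄ y) (ḡ y)
  point y = rt-Ξ-gain J (ZeroOr≥1⇒0≤ (f⋆ (Sign.+ ∷ y))) (ZeroOr≥1⇒0≤ (f⋆ (Sign.- ∷ y)))
    (ZeroOr≥1⇒0≤ (g⋆ (Sign.+ ∷ y))) (ZeroOr≥1⇒0≤ (g⋆ (Sign.- ∷ y))) (f̄⋆ y) (ḡ⋆ y) (f̄≤ y) (ḡ≤ y)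
  collect-left : ∑ (λ y → (rf y + rg y) + 64ℚ * ((Ξfg ⁺) y + (Ξfg ⁻) y))
    ≡ (∑ rf + ∑ rg) + 64ℚ * (∑ (Ξfg ⁺) + ∑ (Ξfg ⁻))
  collect-left = trans (∑-+ (λ y → rf y + rg y) (λ y → 64ℚ * ((Ξfg ⁺) y + (Ξfg ⁻) y)))
    (cong₂ _+_ (∑-+ rf rg) (trans (∑-*ˡ 64ℚ (λ y → (Ξfg ⁺) y + (Ξfg ⁻) y)) (cong (64ℚ *_) (∑-+ (Ξfg ⁺) (Ξfg ⁻)))))
  collect-right : ∑ (λ y → rfg y + 64ℚ * Ξ J (f̄ y) (ḡ y)) ≡ ∑ rfg + 64ℚ * ∑ (λ y → Ξ J (f̄ y) (ḡ y))
  collect-right = trans (∑-+ rfg (λ y → 64ℚ * Ξ J (f̄ y) (ḡ y)))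
    (cong (∑ rfg +_) (∑-*ˡ 64ℚ (λ y → Ξ J (f̄ y) (ḡ y))))
  regroup : ∀ r p s q x y → ((r + p) + (s + q)) + ℤ.+ 64 / 1 * (x + y) ≡ ((r + s) + ℤ.+ 64 / 1 * (x + y)) + (p + q)
  regroup = solve-∀ ℚ-ring
  regroup′ : ∀ r x p → (r + x) + p ≡ r + (p + x)
  regroup′ = solve-∀ ℚ-ring

-- Protocols

S : ∀ {n} → (Cube n → Cube n → ℚ) → ℚ
S C = ∑ (λ x → ∑ (λ y → C x y))

S-cong : ∀ {n} {C D : Cube n → Cube n → ℚ} → (∀ x y → C x y ≡ D x y) → S C ≡ S D
S-cong C≡D = ∑-cong (λ x → ∑-cong (λ y → C≡D x y))

S-mono : ∀ {n} {C D : Cube n → Cube n → ℚ} → (∀ x y → C x y ≤ D x y) → S C ≤ S D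
S-mono C≤D = ∑-mono (λ x → ∑-mono (λ y → C≤D x y))

S-+ : ∀ {n} (C D : Cube n → Cube n → ℚ) → S (λ x y → C x y + D x y) ≡ S C + S D
S-+ C D = trans (∑-cong (λ x → ∑-+ (C x) (D x))) (∑-+ (λ x → ∑ (C x)) (λ x → ∑ (D x)))

S-*ˡ : ∀ {n} c (C : Cube n → Cube n → ℚ) → S (λ x y → c * C x y) ≡ c * S C
S-*ˡ c C = trans (∑-cong (λ x → ∑-*ˡ c (C x))) (∑-*ˡ c (λ x → ∑ (C x)))

infixl 9 _⟦_,_⟧

_⟦_,_⟧ : ∀ {n} {A : Set} → (Cube (suc n) → Cube (suc n) → A) → Sign → Sign → Cube n → Cube n → A
(C ⟦ s , t ⟧) x y = C (s ∷ x) (t ∷ y)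

S-suc : ∀ {n} (C : Cube (suc n) → Cube (suc n) → ℚ) →
  S C ≡ (S (C ⟦ Sign.+ , Sign.+ ⟧) + S (C ⟦ Sign.+ , Sign.- ⟧)) + (S (C ⟦ Sign.- , Sign.+ ⟧) + S (C ⟦ Sign.- , Sign.- ⟧))
S-suc C = cong₂ _+_
  (∑-+ (λ x → ∑ ((C ⟦ Sign.+ , Sign.+ ⟧) x)) (λ x → ∑ ((C ⟦ Sign.+ , Sign.- ⟧) x)))
  (∑-+ (λ x → ∑ ((C ⟦ Sign.- , Sign.+ ⟧) x)) (λ x → ∑ ((C ⟦ Sign.- , Sign.- ⟧) x)))

natℚ-mono : ∀ {m n} → m ℕ.≤ n → natℚ m ≤ natℚ n
natℚ-mono {zero}  {n} ℕ.z≤n = 0≤natℚ n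
  where
  0≤natℚ : ∀ n → 0ℚ ≤ natℚ n
  0≤natℚ zero    = ℚₚ.≤-refl
  0≤natℚ (suc n) = 0≤+ 0≤1 (0≤natℚ n)
natℚ-mono (ℕ.s≤s m≤n) = ℚₚ.+-monoʳ-≤ 1ℚ (natℚ-mono m≤n)

128ℚ : ℚ
128ℚ = ℤ.+ 128 / 1

-- The unnormalised bound of `residual-bound` for a rectangle of masses F and G, lowered by 128 for
-- each of c bits per unit of mass F G.
lower : (N F G φ ψ c : ℚ) → ℚ
lower N F G φ ψ c = N * (F * G) - G * φ - F * ψ - 128ℚ * c * (F * G)

lower-swap : ∀ N F G φ ψ c → lower N F G φ ψ c ≡ lower N G F ψ φ c
lower-swap N F G φ ψ c = swap N F G φ ψ c
  where
  swap : ∀ N F G φ ψ c → N * (F * G) - G * φ - F * ψ - ℤ.+ 128 / 1 * c * (F * G)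
                       ≡ N * (G * F) - F * ψ - G * φ - ℤ.+ 128 / 1 * c * (G * F)
  swap = solve-∀ ℚ-ring

-- Weighted by G, the permitted rise of φ is 128 (F₁ + F₂) G, exactly what `lower` charges for one
-- more bit.
lower-split : ∀ N {G F₁ F₂ φ φ₁ φ₂} ψ {m c₁ c₂} → 0ℚ ≤ G → 0ℚ ≤ F₁ → 0ℚ ≤ F₂ →
  φ₁ + φ₂ ≤ φ + 128ℚ * (F₁ + F₂) → c₁ ≤ m → c₂ ≤ m →
  lower N (F₁ + F₂) G φ ψ (1ℚ + m) ≤ lower N F₁ G φ₁ ψ c₁ + lower N F₂ G φ₂ ψ c₂
lower-split N {G} {F₁} {F₂} {φ} {φ₁} {φ₂} ψ {m} {c₁} {c₂} 0≤G 0≤F₁ 0≤F₂ hφ h₁ h₂ =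
  ≤-by (G * ((φ + 128ℚ * (F₁ + F₂)) - (φ₁ + φ₂)) + 128ℚ * G * (F₁ * (m - c₁) + F₂ * (m - c₂)))
    (0≤+ (0≤* 0≤G (0≤q-p hφ))
      (0≤* (0≤* (ℚₚ.nonNegative⁻¹ 128ℚ) 0≤G) (0≤+ (0≤* 0≤F₁ (0≤q-p h₁)) (0≤* 0≤F₂ (0≤q-p h₂)))))
    (identity N G F₁ F₂ φ φ₁ φ₂ ψ m c₁ c₂)
  where
  identity : ∀ N G F₁ F₂ φ φ₁ φ₂ ψ m c₁ c₂ → let K = ℤ.+ 128 / 1; F = F₁ + F₂ in
    (N * (F * G) - G * φ - F * ψ - K * (1ℚ + m) * (F * G))
      + (G * ((φ + K * F) - (φ₁ + φ₂)) + K * G * (F₁ * (m - c₁) + F₂ * (m - c₂)))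
    ≡ (N * (F₁ * G) - G * φ₁ - F₁ * ψ - K * c₁ * (F₁ * G)) + (N * (F₂ * G) - G * φ₂ - F₂ * ψ - K * c₂ * (F₂ * G))
  identity = solve-∀ ℚ-ring

keep : Bool → Bool → ℚ → ℚ
keep true  true  p = p
keep true  false p = 0ℚ
keep false true  p = 0ℚ
keep false false p = p

keep-ZeroOr≥1 : ∀ a b {p} → ZeroOr≥1 p → ZeroOr≥1 (keep a b p)
keep-ZeroOr≥1 true  true  p⋆ = p⋆
keep-ZeroOr≥1 true  false p⋆ = inj₁ refl
keep-ZeroOr≥1 false true  p⋆ = inj₁ refl
keep-ZeroOr≥1 false false p⋆ = p⋆

keep-+ : ∀ b p → keep true b p + keep false b p ≡ p
keep-+ true  p = ℚₚ.+-identityʳ p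
keep-+ false p = ℚₚ.+-identityˡ p

keep-select : ∀ b p q (h : Bool → ℚ) → keep true b p * q * h true + keep false b p * q * h false ≡ p * q * h b
keep-select true  p q h = drop (p * q * h true) q (h false)
  where
  drop : ∀ r q h → r + 0ℚ * q * h ≡ r
  drop = solve-∀ ℚ-ring
keep-select false p q h = drop (p * q * h false) q (h true)
  where
  drop : ∀ r q h → 0ℚ * q * h + r ≡ r
  drop = solve-∀ ℚ-ring

module Message {n : ℕ} (msg : Cube n → Bool) (f : Cube n → ℚ) (f⋆ : ∀ x → ZeroOr≥1 (f x)) {J : ℕ} (∑f≤ : ∑ f ≤ two^ J) where

  sent : Bool → Cube n → ℚ
  sent b x = keep b (msg x) (f x)

  sent⋆ : ∀ b x → ZeroOr≥1 (sent b x)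
  sent⋆ b x = keep-ZeroOr≥1 b (msg x) (f⋆ x)

  0≤∑sent : ∀ b → 0ℚ ≤ ∑ (sent b)
  0≤∑sent b = ∑-nonneg (λ x → ZeroOr≥1⇒0≤ (sent⋆ b x))

  ∑-sent : ∑ (sent true) + ∑ (sent false) ≡ ∑ f
  ∑-sent = trans (sym (∑-+ (sent true) (sent false))) (∑-cong (λ x → keep-+ (msg x) (f x)))

  ∑-sent≤ : ∀ b → ∑ (sent b) ≤ two^ J
  ∑-sent≤ true  = ℚₚ.≤-trans (≤-by (∑ (sent false)) (0≤∑sent false) ∑-sent) ∑f≤
  ∑-sent≤ false = ℚₚ.≤-trans (≤-by (∑ (sent true)) (0≤∑sent true)
    (trans (ℚₚ.+-comm (∑ (sent false)) (∑ (sent true))) ∑-sent)) ∑f≤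

  Ξ-sent≤ : 64ℚ * Ξ J (∑ (sent true)) (∑ (sent false)) ≤ 128ℚ * (∑ (sent true) + ∑ (sent false))
  Ξ-sent≤ = Ξ-bound J (0≤∑sent true) (0≤∑sent false)

  φ→-sent : φ→ (sent true) + φ→ (sent false) ≤ φ→ f + 128ℚ * (∑ (sent true) + ∑ (sent false))
  φ→-sent = ℚₚ.≤-trans (φ→-split J (sent true) (sent false) (sent⋆ true) (sent⋆ false) (∑-sent≤ true) (∑-sent≤ false))
    (ℚₚ.+-mono-≤ (ℚₚ.≤-reflexive (φ→-cong (λ x → keep-+ (msg x) (f x)))) Ξ-sent≤)

  φ←-sent : φ← (sent true) + φ← (sent false) ≤ φ← f + 128ℚ * (∑ (sent true) + ∑ (sent false))
  -- The tail term of `φ←-split` serves its own induction only; here it is dropped as nonnegative.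
  φ←-sent = ℚₚ.≤-trans (≤-by (64ℚ * ∑ shared) (0≤* (ℚₚ.nonNegative⁻¹ 64ℚ) (∑-nonneg 0≤shared)) refl)
    (ℚₚ.≤-trans (φ←-split J (sent true) (sent false) (sent⋆ true) (sent⋆ false) (∑-sent≤ true) (∑-sent≤ false))
      (ℚₚ.+-mono-≤ (ℚₚ.≤-reflexive (φ←-cong (λ x → keep-+ (msg x) (f x)))) Ξ-sent≤))
    where
    shared : Cube n → ℚ
    shared x = Ξ J (sent true x) (sent false x)
    0≤shared : ∀ x → 0ℚ ≤ shared x
    0≤shared x = 0≤Ξ J (ZeroOr≥1⇒0≤ (sent⋆ true x)) (ZeroOr≥1⇒0≤ (sent⋆ false x))

square-deviation : ∀ {n} → Protocol n → ℚ → Cube n → Cube n → ℚ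
square-deviation P l x y = sq (ip x y - l * value (run P x y))

-- Induction over the protocol tree. On the rectangle of a leaf the output is constant, so
-- `residual-bound` applies with a constant u and v = 0. A message cuts the weight of its sender:
-- Alice's bits raise only φ→ and Bob's only φ←, at the same price, so the opposite orders of
-- conditioning cause no conflict.
deviation-bound : ∀ {n} J (P : Protocol n) (l : ℚ) (f g : Cube n → ℚ) →
  (∀ x → ZeroOr≥1 (f x)) → (∀ y → ZeroOr≥1 (g y)) → ∑ f ≤ two^ J → ∑ g ≤ two^ J →
  lower (natℚ n) (∑ f) (∑ g) (φ→ f) (φ← g) (natℚ (cost P)) ≤ S (λ x y → f x * g y * square-deviation P l x y)
deviation-bound {n} J (output s) l f g f⋆ g⋆ _ _ = subst₂ _≤_
  (sym (no-cost (natℚ n * (∑ f * ∑ g) - ∑ g * φ→ f - ∑ f * φ← g) (∑ f * ∑ g)))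
  (S-cong (λ x y → cong (λ d → f x * g y * sq d) (drop-0 (ip x y) (l * value s))))
  (residual-bound f g (λ _ → l * value s) (λ _ → 0ℚ) (λ x → ZeroOr≥1⇒0≤ (f⋆ x)) (λ y → ZeroOr≥1⇒0≤ (g⋆ y)))
  where
  no-cost : ∀ p q → p - ℤ.+ 128 / 1 * 0ℚ * q ≡ p
  no-cost = solve-∀ ℚ-ring
  drop-0 : ∀ p q → p - q - 0ℚ ≡ p - q
  drop-0 = solve-∀ ℚ-ring
deviation-bound {n} J (alice msg next) l f g f⋆ g⋆ ∑f≤ ∑g≤ = begin
  lower N (∑ f) (∑ g) (φ→ f) (φ← g) (1ℚ + natℚ m)
    ≡⟨ cong (λ F → lower N F (∑ g) (φ→ f) (φ← g) (1ℚ + natℚ m)) (sym ∑-sent) ⟩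
  lower N (∑ (sent true) + ∑ (sent false)) (∑ g) (φ→ f) (φ← g) (1ℚ + natℚ m)
    ≤⟨ lower-split N (φ← g) (∑-nonneg (λ y → ZeroOr≥1⇒0≤ (g⋆ y))) (0≤∑sent true) (0≤∑sent false) φ→-sent
         (natℚ-mono (ℕₚ.m≤m⊔n (cost (next true)) (cost (next false))))
         (natℚ-mono (ℕₚ.m≤n⊔m (cost (next true)) (cost (next false)))) ⟩
  branch true + branch false
    ≤⟨ ℚₚ.+-mono-≤ (deviation-bound J (next true) l (sent true) g (sent⋆ true) g⋆ (∑-sent≤ true) ∑g≤)
                   (deviation-bound J (next false) l (sent false) g (sent⋆ false) g⋆ (∑-sent≤ false) ∑g≤) ⟩
  S (leaf true) + S (leaf false)
    ≡⟨ sym (S-+ (leaf true) (leaf false)) ⟩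
  S (λ x y → leaf true x y + leaf false x y)
    ≡⟨ S-cong (λ x y → keep-select (msg x) (f x) (g y) (λ b → square-deviation (next b) l x y)) ⟩
  S (λ x y → f x * g y * square-deviation (alice msg next) l x y) ∎
  where
  open ℚₚ.≤-Reasoning
  open Message msg f f⋆ {J} ∑f≤
  N : ℚ
  N = natℚ n
  m : ℕ
  m = cost (next true) ℕ.⊔ cost (next false)
  branch : Bool → ℚ
  branch b = lower N (∑ (sent b)) (∑ g) (φ→ (sent b)) (φ← g) (natℚ (cost (next b)))
  leaf : Bool → Cube n → Cube n → ℚ
  leaf b x y = sent b x * g y * square-deviation (next b) l x y
deviation-bound {n} J (bob msg next) l f g f⋆ g⋆ ∑f≤ ∑g≤ = begin
  lower N (∑ f) (∑ g) (φ→ f) (φ← g) (1ℚ + natℚ m)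
    ≡⟨ lower-swap N (∑ f) (∑ g) (φ→ f) (φ← g) (1ℚ + natℚ m) ⟩
  lower N (∑ g) (∑ f) (φ← g) (φ→ f) (1ℚ + natℚ m)
    ≡⟨ cong (λ G → lower N G (∑ f) (φ← g) (φ→ f) (1ℚ + natℚ m)) (sym ∑-sent) ⟩
  lower N (∑ (sent true) + ∑ (sent false)) (∑ f) (φ← g) (φ→ f) (1ℚ + natℚ m)
    ≤⟨ lower-split N (φ→ f) (∑-nonneg (λ y → ZeroOr≥1⇒0≤ (f⋆ y))) (0≤∑sent true) (0≤∑sent false) φ←-sent
         (natℚ-mono (ℕₚ.m≤m⊔n (cost (next true)) (cost (next false))))
         (natℚ-mono (ℕₚ.m≤n⊔m (cost (next true)) (cost (next false)))) ⟩
  branch true + branch false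
    ≡⟨ cong₂ _+_ (swap-branch true) (swap-branch false) ⟩
  branch′ true + branch′ false
    ≤⟨ ℚₚ.+-mono-≤ (deviation-bound J (next true) l f (sent true) f⋆ (sent⋆ true) ∑f≤ (∑-sent≤ true))
                   (deviation-bound J (next false) l f (sent false) f⋆ (sent⋆ false) ∑f≤ (∑-sent≤ false)) ⟩
  S (leaf true) + S (leaf false)
    ≡⟨ sym (S-+ (leaf true) (leaf false)) ⟩
  S (λ x y → leaf true x y + leaf false x y)
    ≡⟨ S-cong select ⟩
  S (λ x y → f x * g y * square-deviation (bob msg next) l x y) ∎
  where
  open ℚₚ.≤-Reasoning
  open Message msg g g⋆ {J} ∑g≤
  N : ℚ
  N = natℚ n
  m : ℕ
  m = cost (next true) ℕ.⊔ cost (next false)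
  branch branch′ : Bool → ℚ
  branch b = lower N (∑ (sent b)) (∑ f) (φ← (sent b)) (φ→ f) (natℚ (cost (next b)))
  branch′ b = lower N (∑ f) (∑ (sent b)) (φ→ f) (φ← (sent b)) (natℚ (cost (next b)))
  swap-branch : ∀ b → branch b ≡ branch′ b
  swap-branch b = lower-swap N (∑ (sent b)) (∑ f) (φ← (sent b)) (φ→ f) (natℚ (cost (next b)))
  leaf : Bool → Cube n → Cube n → ℚ
  leaf b x y = f x * sent b y * square-deviation (next b) l x y
  select : ∀ x y → leaf true x y + leaf false x y ≡ f x * g y * square-deviation (bob msg next) l x y
  select x y = trans
    (cong₂ _+_ (cong (_* square-deviation (next true) l x y) (ℚₚ.*-comm (f x) (sent true y)))
               (cong (_* square-deviation (next false) l x y) (ℚₚ.*-comm (f x) (sent false y))))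
    (trans (keep-select (msg y) (g y) (f x) (λ b → square-deviation (next b) l x y))
           (cong (_* square-deviation (bob msg next) l x y) (ℚₚ.*-comm (g y) (f x))))

-- Uniform second moments and the level-one bound

∑-const : ∀ n c → ∑ {n} (λ _ → c) ≡ two^ n * c
∑-const zero    c = sym (ℚₚ.*-identityˡ c)
∑-const (suc n) c = trans (cong₂ _+_ (∑-const n c) (∑-const n c)) (double (two^ n) c)
  where
  double : ∀ t c → t * c + t * c ≡ ℤ.+ 2 / 1 * t * c
  double = solve-∀ ℚ-ring

S-const : ∀ n c → S {n} (λ _ _ → c) ≡ two^ n * (two^ n * c)
S-const n c = trans (∑-cong {n} (λ _ → ∑-const n c)) (∑-const n (two^ n * c))

rt-diagonal : ∀ c → rt c c ≡ 0ℚ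
rt-diagonal c = vanish c (inv (c + c))
  where
  vanish : ∀ c i → (c - c) * (c - c) * i ≡ 0ℚ
  vanish = solve-∀ ℚ-ring

φ→-const : ∀ n c → φ→ {n} (λ _ → c) ≡ 0ℚ
φ→-const zero    c = refl
φ→-const (suc n) c = cong₂ _+_ (rt-diagonal (∑ {n} (λ _ → c))) (cong₂ _+_ (φ→-const n c) (φ→-const n c))

φ←-const : ∀ n c → φ← {n} (λ _ → c) ≡ 0ℚ
φ←-const zero    c = refl
φ←-const (suc n) c = cong₂ _+_ (trans (∑-cong {n} (λ _ → rt-diagonal c)) (∑-0 n)) (φ←-const n (c + c))

value-sq : ∀ s → value s * value s ≡ 1ℚ
value-sq Sign.+ = refl
value-sq Sign.- = refl

S-ip² : ∀ n → S {n} (λ x y → sq (ip x y)) ≡ natℚ n * (two^ n * two^ n)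
S-ip² zero    = refl
S-ip² (suc n) = begin
  S {suc n} (λ x y → sq (ip x y))
    ≡⟨ S-suc {n} (λ x y → sq (ip x y)) ⟩
  (S (C Sign.+ Sign.+) + S (C Sign.+ Sign.-)) + (S (C Sign.- Sign.+) + S (C Sign.- Sign.-))
    ≡⟨ cong₂ _+_ (pair (C Sign.+ Sign.+) (C Sign.+ Sign.-) (λ x y → expand (ip x y)))
                 (pair (C Sign.- Sign.+) (C Sign.- Sign.-) (λ x y → expand′ (ip x y))) ⟩
  (T * (T * 2ℚ) + 2ℚ * (natℚ n * (T * T))) + (T * (T * 2ℚ) + 2ℚ * (natℚ n * (T * T)))
    ≡⟨ collect (natℚ n) T ⟩
  (1ℚ + natℚ n) * (2ℚ * T * (2ℚ * T)) ∎
  where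
  open ≡-Reasoning
  T : ℚ
  T = two^ n
  C : Sign → Sign → Cube n → Cube n → ℚ
  C s t = (λ x y → sq (ip {suc n} x y)) ⟦ s , t ⟧
  pair : (D D′ : Cube n → Cube n → ℚ) → (∀ x y → D x y + D′ x y ≡ 2ℚ + 2ℚ * sq (ip x y)) →
    S D + S D′ ≡ T * (T * 2ℚ) + 2ℚ * (natℚ n * (T * T))
  pair D D′ h = trans (sym (S-+ D D′)) (trans (S-cong h) (trans (S-+ {n} (λ _ _ → 2ℚ) (λ x y → 2ℚ * sq (ip x y)))
    (cong₂ _+_ (S-const n 2ℚ) (trans (S-*ˡ {n} 2ℚ (λ x y → sq (ip x y))) (cong (2ℚ *_) (S-ip² n))))))
  expand : ∀ p → (1ℚ * 1ℚ + p) * (1ℚ * 1ℚ + p) + (1ℚ * - 1ℚ + p) * (1ℚ * - 1ℚ + p) ≡ ℤ.+ 2 / 1 + ℤ.+ 2 / 1 * (p * p)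
  expand = solve-∀ ℚ-ring
  expand′ : ∀ p → (- 1ℚ * 1ℚ + p) * (- 1ℚ * 1ℚ + p) + (- 1ℚ * - 1ℚ + p) * (- 1ℚ * - 1ℚ + p) ≡ ℤ.+ 2 / 1 + ℤ.+ 2 / 1 * (p * p)
  expand′ = solve-∀ ℚ-ring
  collect : ∀ N T → let D = ℤ.+ 2 / 1 in
    (T * (T * D) + D * (N * (T * T))) + (T * (T * D) + D * (N * (T * T))) ≡ (1ℚ + N) * (D * T * (D * T))
  collect = solve-∀ ℚ-ring

quarter^ : ℕ → ℚ
quarter^ zero    = 1ℚ
quarter^ (suc n) = ℤ.+ 1 / 4 * quarter^ n

0≤quarter^ : ∀ n → 0ℚ ≤ quarter^ n
0≤quarter^ zero    = 0≤1
0≤quarter^ (suc n) = 0≤* (ℚₚ.nonNegative⁻¹ (ℤ.+ 1 / 4)) (0≤quarter^ n)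

quarter^-two^ : ∀ n → quarter^ n * (two^ n * two^ n) ≡ 1ℚ
quarter^-two^ zero    = refl
quarter^-two^ (suc n) = trans (cancel (quarter^ n) (two^ n)) (quarter^-two^ n)
  where
  cancel : ∀ q t → ℤ.+ 1 / 4 * q * (ℤ.+ 2 / 1 * t * (ℤ.+ 2 / 1 * t)) ≡ q * (t * t)
  cancel = solve-∀ ℚ-ring

U : ∀ {n} → (Cube n → Cube n → ℚ) → ℚ
U {n} C = quarter^ n * S C

U-cong : ∀ {n} {C D : Cube n → Cube n → ℚ} → (∀ x y → C x y ≡ D x y) → U C ≡ U D
U-cong {n} C≡D = cong (quarter^ n *_) (S-cong C≡D)

U-mono : ∀ {n} {C D : Cube n → Cube n → ℚ} → (∀ x y → C x y ≤ D x y) → U C ≤ U D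
U-mono {n} C≤D = *-monoˡ-≤ (0≤quarter^ n) (S-mono C≤D)

U-+ : ∀ {n} (C D : Cube n → Cube n → ℚ) → U (λ x y → C x y + D x y) ≡ U C + U D
U-+ {n} C D = trans (cong (quarter^ n *_) (S-+ C D)) (ℚₚ.*-distribˡ-+ (quarter^ n) (S C) (S D))

U-*ˡ : ∀ {n} c (C : Cube n → Cube n → ℚ) → U (λ x y → c * C x y) ≡ c * U C
U-*ˡ {n} c C = trans (cong (quarter^ n *_) (S-*ˡ c C)) (swap (quarter^ n) c (S C))
  where
  swap : ∀ q c s → q * (c * s) ≡ c * (q * s)
  swap = solve-∀ ℚ-ring

U-const : ∀ n c → U {n} (λ _ _ → c) ≡ c
U-const n c = trans (cong (quarter^ n *_) (S-const n c)) (trans (regroup (quarter^ n) (two^ n) c)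
  (trans (cong (c *_) (quarter^-two^ n)) (ℚₚ.*-identityʳ c)))
  where
  regroup : ∀ q t c → q * (t * (t * c)) ≡ c * (q * (t * t))
  regroup = solve-∀ ℚ-ring

U-ip² : ∀ n → U {n} (λ x y → sq (ip x y)) ≡ natℚ n
U-ip² n = trans (cong (quarter^ n *_) (S-ip² n)) (trans (swap (quarter^ n) (natℚ n) (two^ n * two^ n))
  (trans (cong (natℚ n *_) (quarter^-two^ n)) (ℚₚ.*-identityʳ (natℚ n))))
  where
  swap : ∀ q c s → q * (c * s) ≡ c * (q * s)
  swap = solve-∀ ℚ-ring

out : ∀ {n} → Protocol n → Cube n → Cube n → ℚ
out P x y = value (run P x y)

U-deviation-bound : ∀ {n} (P : Protocol n) (l : ℚ) → natℚ n - 128ℚ * natℚ (cost P) ≤ U (square-deviation P l)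
U-deviation-bound {n} P l = begin
  natℚ n - 128ℚ * natℚ (cost P)
    ≡⟨ sym (trans (normalise (quarter^ n) (natℚ n) (two^ n) (natℚ (cost P)))
         (trans (cong ((natℚ n - 128ℚ * natℚ (cost P)) *_) (quarter^-two^ n)) (ℚₚ.*-identityʳ (natℚ n - 128ℚ * natℚ (cost P))))) ⟩
  quarter^ n * lower (natℚ n) (two^ n) (two^ n) 0ℚ 0ℚ (natℚ (cost P))
    ≡⟨ cong (quarter^ n *_) (sym arguments) ⟩
  quarter^ n * lower (natℚ n) (∑ 𝟙) (∑ 𝟙) (φ→ 𝟙) (φ← 𝟙) (natℚ (cost P))
    -- The whole cube has mass 2ⁿ, so J = n is enough, and both potentials start at 0.
    ≤⟨ *-monoˡ-≤ (0≤quarter^ n) (deviation-bound n P l 𝟙 𝟙 (λ _ → inj₂ ℚₚ.≤-refl) (λ _ → inj₂ ℚₚ.≤-refl) ∑𝟙≤ ∑𝟙≤) ⟩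
  U (λ x y → 1ℚ * 1ℚ * square-deviation P l x y)
    ≡⟨ U-cong (λ x y → ℚₚ.*-identityˡ (square-deviation P l x y)) ⟩
  U (square-deviation P l) ∎
  where
  open ℚₚ.≤-Reasoning
  𝟙 : Cube n → ℚ
  𝟙 _ = 1ℚ
  ∑𝟙 : ∑ 𝟙 ≡ two^ n
  ∑𝟙 = trans (∑-const n 1ℚ) (ℚₚ.*-identityʳ (two^ n))
  ∑𝟙≤ : ∑ 𝟙 ≤ two^ n
  ∑𝟙≤ = ℚₚ.≤-reflexive ∑𝟙
  arguments : lower (natℚ n) (∑ 𝟙) (∑ 𝟙) (φ→ 𝟙) (φ← 𝟙) (natℚ (cost P))
    ≡ lower (natℚ n) (two^ n) (two^ n) 0ℚ 0ℚ (natℚ (cost P))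
  arguments = trans (cong₂ (λ φ ψ → lower (natℚ n) (∑ 𝟙) (∑ 𝟙) φ ψ (natℚ (cost P))) (φ→-const n 1ℚ) (φ←-const n 1ℚ))
                    (cong (λ F → lower (natℚ n) F F 0ℚ 0ℚ (natℚ (cost P))) ∑𝟙)
  normalise : ∀ q N T c → q * (N * (T * T) - T * 0ℚ - T * 0ℚ - ℤ.+ 128 / 1 * c * (T * T))
    ≡ (N - ℤ.+ 128 / 1 * c) * (q * (T * T))
  normalise = solve-∀ ℚ-ring

U-deviation : ∀ {n} (P : Protocol n) (l : ℚ) →
  U (square-deviation P l) ≡ natℚ n + (- (2ℚ * l) * U (λ x y → ip x y * out P x y) + l * l)
U-deviation {n} P l = begin
  U (square-deviation P l)
    ≡⟨ U-cong (λ x y → trans (expand (ip x y) l (out P x y))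
         (cong (λ v → sq (ip x y) + (- (2ℚ * l) * (ip x y * out P x y) + l * l * v)) (value-sq (run P x y)))) ⟩
  U (λ x y → sq (ip x y) + (- (2ℚ * l) * (ip x y * out P x y) + l * l * 1ℚ))
    ≡⟨ U-+ {n} (λ x y → sq (ip x y)) (λ x y → - (2ℚ * l) * (ip x y * out P x y) + l * l * 1ℚ) ⟩
  U {n} (λ x y → sq (ip x y)) + U (λ x y → - (2ℚ * l) * (ip x y * out P x y) + l * l * 1ℚ)
    ≡⟨ cong₂ _+_ (U-ip² n) (U-+ (λ x y → - (2ℚ * l) * (ip x y * out P x y)) (λ _ _ → l * l * 1ℚ)) ⟩
  natℚ n + (U (λ x y → - (2ℚ * l) * (ip x y * out P x y)) + U {n} (λ _ _ → l * l * 1ℚ))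
    ≡⟨ cong₂ (λ p q → natℚ n + (p + q)) (U-*ˡ (- (2ℚ * l)) (λ x y → ip x y * out P x y))
         (trans (U-const n (l * l * 1ℚ)) (ℚₚ.*-identityʳ (l * l))) ⟩
  natℚ n + (- (2ℚ * l) * U (λ x y → ip x y * out P x y) + l * l) ∎
  where
  open ≡-Reasoning
  expand : ∀ p l v → (p - l * v) * (p - l * v) ≡ p * p + (- (ℤ.+ 2 / 1 * l) * (p * v) + l * l * (v * v))
  expand = solve-∀ ℚ-ring

level-one : ∀ {n} (P : Protocol n) (l : ℚ) →
  2ℚ * l * U (λ x y → ip x y * out P x y) ≤ l * l + 128ℚ * natℚ (cost P)
level-one {n} P l = ≤-by (U (square-deviation P l) - (natℚ n - 128ℚ * natℚ (cost P)))
  (0≤q-p (U-deviation-bound P l))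
  (trans (cong (λ u → 2ℚ * l * L + (u - (natℚ n - 128ℚ * natℚ (cost P)))) (U-deviation P l))
         (cancel (natℚ n) l L (natℚ (cost P))))
  where
  L : ℚ
  L = U (λ x y → ip x y * out P x y)
  cancel : ∀ N l L c → let K = ℤ.+ 128 / 1; D = ℤ.+ 2 / 1 in
    D * l * L + ((N + (- (D * l) * L + l * l)) - (N - K * c)) ≡ l * l + K * c
  cancel = solve-∀ ℚ-ring

∣p∣≤-by : ∀ {p q} → p ≤ q → - p ≤ q → ∣ p ∣ ≤ q
∣p∣≤-by {p} {q} p≤q -p≤q with ℚₚ.∣p∣≡p∨∣p∣≡-p p
... | inj₁ eq = subst (_≤ q) (sym eq) p≤q
... | inj₂ eq = subst (_≤ q) (sym eq) -p≤q

-- Apply level-one with l = ± 32 ω.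
level-one-bound : ∀ {n} (P : Protocol n) {ω} → 0ℚ < ω → natℚ (cost P) ≤ ℤ.+ 4 / 1 * (ω * ω) →
  ∣ U (λ x y → ip x y * out P x y) ∣ ≤ ℤ.+ 24 / 1 * ω
level-one-bound {n} P {ω} 0<ω c≤ = ∣p∣≤-by
  (ℚₚ.*-cancelˡ-≤-pos (ℤ.+ 64 / 1 * ω) {{positive 0<64ω}} upper)
  (ℚₚ.*-cancelˡ-≤-pos (ℤ.+ 64 / 1 * ω) {{positive 0<64ω}} lower′)
  where
  open ℚₚ.≤-Reasoning
  L l : ℚ
  L = U (λ x y → ip x y * out P x y)
  -- A rational stand-in for the optimal √512 ω: l² + 128 · 4 ω² = 1536 ω², and division by 2 l = 64
  -- ω leaves 24 ω.
  l = ℤ.+ 32 / 1 * ω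
  0<64ω : 0ℚ < ℤ.+ 64 / 1 * ω
  0<64ω = subst (_< ℤ.+ 64 / 1 * ω) (ℚₚ.*-zeroʳ (ℤ.+ 64 / 1)) (ℚₚ.*-monoʳ-<-pos (ℤ.+ 64 / 1) 0<ω)
  sum : ∀ ω → ℤ.+ 32 / 1 * ω * (ℤ.+ 32 / 1 * ω) + ℤ.+ 128 / 1 * (ℤ.+ 4 / 1 * (ω * ω))
    ≡ ℤ.+ 64 / 1 * ω * (ℤ.+ 24 / 1 * ω)
  sum = solve-∀ ℚ-ring
  rescale : ∀ ω L → ℤ.+ 64 / 1 * ω * L ≡ ℤ.+ 2 / 1 * (ℤ.+ 32 / 1 * ω) * L
  rescale = solve-∀ ℚ-ring
  rescale′ : ∀ ω L → ℤ.+ 64 / 1 * ω * - L ≡ ℤ.+ 2 / 1 * - (ℤ.+ 32 / 1 * ω) * L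
  rescale′ = solve-∀ ℚ-ring
  neg-sq : ∀ l → - l * - l ≡ l * l
  neg-sq = solve-∀ ℚ-ring
  cost-term : l * l + 128ℚ * natℚ (cost P) ≤ ℤ.+ 64 / 1 * ω * (ℤ.+ 24 / 1 * ω)
  cost-term = subst (l * l + 128ℚ * natℚ (cost P) ≤_) (sum ω)
    (ℚₚ.+-monoʳ-≤ (l * l) (*-monoˡ-≤ (ℚₚ.nonNegative⁻¹ 128ℚ) c≤))
  upper : ℤ.+ 64 / 1 * ω * L ≤ ℤ.+ 64 / 1 * ω * (ℤ.+ 24 / 1 * ω)
  upper = begin
    ℤ.+ 64 / 1 * ω * L                ≡⟨ rescale ω L ⟩
    2ℚ * l * L                        ≤⟨ level-one P l ⟩
    l * l + 128ℚ * natℚ (cost P)      ≤⟨ cost-term ⟩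
    ℤ.+ 64 / 1 * ω * (ℤ.+ 24 / 1 * ω) ∎
  lower′ : ℤ.+ 64 / 1 * ω * - L ≤ ℤ.+ 64 / 1 * ω * (ℤ.+ 24 / 1 * ω)
  lower′ = begin
    ℤ.+ 64 / 1 * ω * - L              ≡⟨ rescale′ ω L ⟩
    2ℚ * - l * L                      ≤⟨ level-one P (- l) ⟩
    - l * - l + 128ℚ * natℚ (cost P)  ≡⟨ cong (_+ 128ℚ * natℚ (cost P)) (neg-sq l) ⟩
    l * l + 128ℚ * natℚ (cost P)      ≤⟨ cost-term ⟩
    ℤ.+ 64 / 1 * ω * (ℤ.+ 24 / 1 * ω) ∎

-- The correlated expectation and its first-order expansion

p≤∣p∣ : ∀ p → p ≤ ∣ p ∣
p≤∣p∣ p with ℚₚ.≤-total 0ℚ p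
... | inj₁ 0≤p = ℚₚ.≤-reflexive (sym (ℚₚ.0≤p⇒∣p∣≡p 0≤p))
... | inj₂ p≤0 = ℚₚ.≤-trans p≤0 (ℚₚ.0≤∣p∣ p)

-p≤∣p∣ : ∀ p → - p ≤ ∣ p ∣
-p≤∣p∣ p = subst (- p ≤_) (ℚₚ.∣-p∣≡∣p∣ p) (p≤∣p∣ (- p))

U-abs : ∀ {n} (C : Cube n → Cube n → ℚ) {B} → (∀ x y → ∣ C x y ∣ ≤ B) → ∣ U C ∣ ≤ B
U-abs {n} C {B} ∣C∣≤B = ∣p∣≤-by
  (subst (U C ≤_) (U-const n B) (U-mono (λ x y → ℚₚ.≤-trans (p≤∣p∣ (C x y)) (∣C∣≤B x y))))
  (subst₂ _≤_ (trans (U-*ˡ (- 1ℚ) C) (minus-one (U C))) (U-const n B)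
    (U-mono (λ x y → subst (_≤ B) (sym (minus-one (C x y))) (ℚₚ.≤-trans (-p≤∣p∣ (C x y)) (∣C∣≤B x y)))))
  where
  minus-one : ∀ p → - 1ℚ * p ≡ - p
  minus-one = solve-∀ ℚ-ring

-- The density of the pair (x , y) with x ⊙ y distributed as ν ρ, relative to
-- independent uniform x and y.
k : ∀ {n} → ℚ → Cube n → Cube n → ℚ
k ρ []      []      = 1ℚ
k ρ (s ∷ x) (t ∷ y) = (1ℚ + ρ * (value s * value t)) * k ρ x y

E : ∀ {n} → ℚ → (Cube n → Cube n → ℚ) → ℚ
E ρ C = U (λ x y → k ρ x y * C x y)

∣value∣ : ∀ s → ∣ value s ∣ ≤ 1ℚ
∣value∣ Sign.+ = ℚₚ.≤-refl
∣value∣ Sign.- = ℚₚ.≤-refl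

∣value*value∣ : ∀ s t → ∣ value s * value t ∣ ≤ 1ℚ
∣value*value∣ s t = ∣*∣-mono-≤ {value s} {value t} {1ℚ} {1ℚ} (∣value∣ s) (∣value∣ t)

k-0 : ∀ {n} (x y : Cube n) → k 0ℚ x y ≡ 1ℚ
k-0 []      []      = refl
k-0 (s ∷ x) (t ∷ y) = trans (cong ((1ℚ + 0ℚ * (value s * value t)) *_) (k-0 x y)) (one (value s * value t))
  where
  one : ∀ z → (1ℚ + 0ℚ * z) * 1ℚ ≡ 1ℚ
  one = solve-∀ ℚ-ring

module Taylor {ρ : ℚ} (∣ρ∣≤1 : ∣ ρ ∣ ≤ 1ℚ) where

  ∣ρz∣ : ∀ s t → ∣ ρ * (value s * value t) ∣ ≤ ∣ ρ ∣
  ∣ρz∣ s t = subst (∣ ρ * (value s * value t) ∣ ≤_) (ℚₚ.*-identityʳ ∣ ρ ∣)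
    (∣*∣-mono-≤ {ρ} {value s * value t} {∣ ρ ∣} {1ℚ} ℚₚ.≤-refl (∣value*value∣ s t))

  factor : ∀ s t → ∣ 1ℚ + ρ * (value s * value t) ∣ ≤ 2ℚ
  factor s t = ℚₚ.≤-trans (ℚₚ.∣p+q∣≤∣p∣+∣q∣ 1ℚ (ρ * (value s * value t)))
    (ℚₚ.+-monoʳ-≤ 1ℚ (ℚₚ.≤-trans (∣ρz∣ s t) ∣ρ∣≤1))

  ∣k∣ : ∀ {n} (x y : Cube n) → ∣ k ρ x y ∣ ≤ two^ n
  ∣k∣ []      []      = ℚₚ.≤-refl
  ∣k∣ {suc n} (s ∷ x) (t ∷ y) = ∣*∣-mono-≤ {1ℚ + ρ * (value s * value t)} {k ρ x y} {2ℚ} {two^ n} (factor s t) (∣k∣ x y)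

  ∣k-1∣ : ∀ {n} (x y : Cube n) → ∣ k ρ x y - 1ℚ ∣ ≤ ∣ ρ ∣ * two^ n
  ∣k-1∣ [] [] = subst (0ℚ ≤_) (sym (ℚₚ.*-identityʳ ∣ ρ ∣)) (ℚₚ.0≤∣p∣ ρ)
  ∣k-1∣ {suc n} (s ∷ x) (t ∷ y) = begin
    ∣ (1ℚ + ρ * z) * k ρ x y - 1ℚ ∣         ≡⟨ cong ∣_∣ (expand (ρ * z) (k ρ x y)) ⟩
    ∣ (k ρ x y - 1ℚ) + ρ * z * k ρ x y ∣    ≤⟨ ℚₚ.∣p+q∣≤∣p∣+∣q∣ (k ρ x y - 1ℚ) (ρ * z * k ρ x y) ⟩
    ∣ k ρ x y - 1ℚ ∣ + ∣ ρ * z * k ρ x y ∣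
      ≤⟨ ℚₚ.+-mono-≤ (∣k-1∣ x y) (∣*∣-mono-≤ {ρ * z} {k ρ x y} {∣ ρ ∣} {two^ n} (∣ρz∣ s t) (∣k∣ x y)) ⟩
    ∣ ρ ∣ * two^ n + ∣ ρ ∣ * two^ n          ≡⟨ collect ∣ ρ ∣ (two^ n) ⟩
    ∣ ρ ∣ * (2ℚ * two^ n)                   ∎
    where
    open ℚₚ.≤-Reasoning
    z : ℚ
    z = value s * value t
    expand : ∀ q k → (1ℚ + q) * k - 1ℚ ≡ (k - 1ℚ) + q * k
    expand = solve-∀ ℚ-ring
    collect : ∀ r t → r * t + r * t ≡ r * (ℤ.+ 2 / 1 * t)
    collect = solve-∀ ℚ-ring

  remainder : ∀ {n} → Cube n → Cube n → ℚ
  remainder x y = k ρ x y - 1ℚ - ρ * ip x y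

  ∣remainder∣ : ∀ {n} (x y : Cube n) → ∣ remainder x y ∣ ≤ ∣ ρ ∣ * ∣ ρ ∣ * two^ n
  ∣remainder∣ [] [] = subst (λ p → ∣ p ∣ ≤ ∣ ρ ∣ * ∣ ρ ∣ * 1ℚ) (sym (zero-at ρ))
    (0≤* (0≤* (ℚₚ.0≤∣p∣ ρ) (ℚₚ.0≤∣p∣ ρ)) 0≤1)
    where
    zero-at : ∀ r → 1ℚ - 1ℚ - r * 0ℚ ≡ 0ℚ
    zero-at = solve-∀ ℚ-ring
  ∣remainder∣ {suc n} (s ∷ x) (t ∷ y) = begin
    ∣ (1ℚ + ρ * z) * k ρ x y - 1ℚ - ρ * (z + ip x y) ∣
      ≡⟨ cong ∣_∣ (expand ρ z (k ρ x y) (ip x y)) ⟩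
    ∣ remainder x y + ρ * z * (k ρ x y - 1ℚ) ∣
      ≤⟨ ℚₚ.∣p+q∣≤∣p∣+∣q∣ (remainder x y) (ρ * z * (k ρ x y - 1ℚ)) ⟩
    ∣ remainder x y ∣ + ∣ ρ * z * (k ρ x y - 1ℚ) ∣
      ≤⟨ ℚₚ.+-mono-≤ (∣remainder∣ x y)
           (∣*∣-mono-≤ {ρ * z} {k ρ x y - 1ℚ} {∣ ρ ∣} {∣ ρ ∣ * two^ n} (∣ρz∣ s t) (∣k-1∣ x y)) ⟩
    ∣ ρ ∣ * ∣ ρ ∣ * two^ n + ∣ ρ ∣ * (∣ ρ ∣ * two^ n)
      ≡⟨ collect ∣ ρ ∣ (two^ n) ⟩
    ∣ ρ ∣ * ∣ ρ ∣ * (2ℚ * two^ n) ∎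
    where
    open ℚₚ.≤-Reasoning
    z : ℚ
    z = value s * value t
    expand : ∀ r z k i → (1ℚ + r * z) * k - 1ℚ - r * (z + i) ≡ (k - 1ℚ - r * i) + r * z * (k - 1ℚ)
    expand = solve-∀ ℚ-ring
    collect : ∀ r t → r * r * t + r * (r * t) ≡ r * r * (ℤ.+ 2 / 1 * t)
    collect = solve-∀ ℚ-ring

  -- The error is exponential in n, which is harmless because it is quadratic in ρ: the expansion is
  -- used only for correlations of order 2⁻ⁿ.
  E-Taylor : ∀ {n} (C : Cube n → Cube n → ℚ) → (∀ x y → ∣ C x y ∣ ≤ 1ℚ) →
    ∣ E ρ C - E 0ℚ C ∣ ≤ ∣ ρ ∣ * ∣ U (λ x y → ip x y * C x y) ∣ + ∣ ρ ∣ * ∣ ρ ∣ * two^ n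
  E-Taylor {n} C ∣C∣≤1 = begin
    ∣ E ρ C - E 0ℚ C ∣                                ≡⟨ cong ∣_∣ difference ⟩
    ∣ ρ * U first + U rest ∣                          ≤⟨ ℚₚ.∣p+q∣≤∣p∣+∣q∣ (ρ * U first) (U rest) ⟩
    ∣ ρ * U first ∣ + ∣ U rest ∣
      ≤⟨ ℚₚ.+-mono-≤ (ℚₚ.≤-reflexive (ℚₚ.∣p*q∣≡∣p∣*∣q∣ ρ (U first))) (U-abs rest ∣rest∣) ⟩
    ∣ ρ ∣ * ∣ U first ∣ + ∣ ρ ∣ * ∣ ρ ∣ * two^ n       ∎
    where
    open ℚₚ.≤-Reasoning
    first rest : Cube n → Cube n → ℚ
    first x y = ip x y * C x y
    rest x y = remainder x y * C x y
    ∣rest∣ : ∀ x y → ∣ rest x y ∣ ≤ ∣ ρ ∣ * ∣ ρ ∣ * two^ n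
    ∣rest∣ x y = subst (∣ rest x y ∣ ≤_) (ℚₚ.*-identityʳ (∣ ρ ∣ * ∣ ρ ∣ * two^ n))
      (∣*∣-mono-≤ {remainder x y} {C x y} {∣ ρ ∣ * ∣ ρ ∣ * two^ n} {1ℚ} (∣remainder∣ x y) (∣C∣≤1 x y))
    expand : ∀ k r i c → k * c ≡ 1ℚ * c + (r * (i * c) + (k - 1ℚ - r * i) * c)
    expand = solve-∀ ℚ-ring
    cancel : ∀ p q → (p + q) - p ≡ q
    cancel = solve-∀ ℚ-ring
    split : E ρ C ≡ E 0ℚ C + (ρ * U first + U rest)
    split = trans (U-cong (λ x y → trans (expand (k ρ x y) ρ (ip x y) (C x y))
        (cong (λ κ₀ → κ₀ * C x y + (ρ * first x y + rest x y)) (sym (k-0 x y)))))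
      (trans (U-+ (λ x y → k 0ℚ x y * C x y) (λ x y → ρ * first x y + rest x y))
        (cong (E 0ℚ C +_) (trans (U-+ (λ x y → ρ * first x y) rest) (cong (_+ U rest) (U-*ˡ ρ first)))))
    difference : E ρ C - E 0ℚ C ≡ ρ * U first + U rest
    difference = trans (cong (_- E 0ℚ C) split) (cancel (E 0ℚ C) (ρ * U first + U rest))

-- Random restrictions

Mask : ℕ → Set
Mask n = Vec (Maybe Sign) n

-- A fixed coordinate ignores the input instead of disappearing, so a restricted protocol is again a
-- `Protocol n`. Both players read the same mask, Alice with the sign + and Bob with σ, which gives
-- a fixed coordinate the product σ.
fix : ∀ {n} → Sign → Mask n → Cube n → Cube n
fix σ []            []      = []
fix σ (nothing ∷ w) (s ∷ x) = s ∷ fix σ w x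
fix σ (just u ∷ w)  (s ∷ x) = (σ Sign.* u) ∷ fix σ w x

-- The expectation over masks with independent entries, equal to just + and
-- just - with probability a / 2 each.
R : ∀ {n} → ℚ → (Mask n → ℚ) → ℚ
R {zero}  a F = F []
R {suc n} a F = (1ℚ - a) * R a (λ w → F (nothing ∷ w))
              + ½ * a * (R a (λ w → F (just Sign.+ ∷ w)) + R a (λ w → F (just Sign.- ∷ w)))

R-cong : ∀ {n} a {F G : Mask n → ℚ} → (∀ w → F w ≡ G w) → R a F ≡ R a G
R-cong {zero}  a F≡G = F≡G []
R-cong {suc n} a F≡G = cong₂ (λ p q → (1ℚ - a) * p + ½ * a * q) (R-cong a (λ w → F≡G (nothing ∷ w)))
  (cong₂ _+_ (R-cong a (λ w → F≡G (just Sign.+ ∷ w))) (R-cong a (λ w → F≡G (just Sign.- ∷ w))))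

R-+ : ∀ {n} a (F G : Mask n → ℚ) → R a (λ w → F w + G w) ≡ R a F + R a G
R-+ {zero}  a F G = refl
R-+ {suc n} a F G = trans
  (cong₂ (λ p q → (1ℚ - a) * p + ½ * a * q) (R-+ a (λ w → F (nothing ∷ w)) (λ w → G (nothing ∷ w)))
    (cong₂ _+_ (R-+ a (λ w → F (just Sign.+ ∷ w)) (λ w → G (just Sign.+ ∷ w)))
               (R-+ a (λ w → F (just Sign.- ∷ w)) (λ w → G (just Sign.- ∷ w)))))
  (regroup a (R a (λ w → F (nothing ∷ w))) (R a (λ w → G (nothing ∷ w)))
             (R a (λ w → F (just Sign.+ ∷ w))) (R a (λ w → G (just Sign.+ ∷ w)))
             (R a (λ w → F (just Sign.- ∷ w))) (R a (λ w → G (just Sign.- ∷ w))))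
  where
  regroup : ∀ a p p′ q q′ r r′ → (1ℚ - a) * (p + p′) + ½ * a * ((q + q′) + (r + r′))
    ≡ ((1ℚ - a) * p + ½ * a * (q + r)) + ((1ℚ - a) * p′ + ½ * a * (q′ + r′))
  regroup = solve-∀ ℚ-ring

R-*ˡ : ∀ {n} a c (F : Mask n → ℚ) → R a (λ w → c * F w) ≡ c * R a F
R-*ˡ {zero}  a c F = refl
R-*ˡ {suc n} a c F = trans
  (cong₂ (λ p q → (1ℚ - a) * p + ½ * a * q) (R-*ˡ a c (λ w → F (nothing ∷ w)))
    (cong₂ _+_ (R-*ˡ a c (λ w → F (just Sign.+ ∷ w))) (R-*ˡ a c (λ w → F (just Sign.- ∷ w)))))
  (regroup a c (R a (λ w → F (nothing ∷ w))) (R a (λ w → F (just Sign.+ ∷ w))) (R a (λ w → F (just Sign.- ∷ w))))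
  where
  regroup : ∀ a c p q r → (1ℚ - a) * (c * p) + ½ * a * (c * q + c * r) ≡ c * ((1ℚ - a) * p + ½ * a * (q + r))
  regroup = solve-∀ ℚ-ring

R-shift-≤ : ∀ {n a B} → 0ℚ ≤ a → a ≤ 1ℚ → {F G : Mask n → ℚ} → (∀ w → F w ≤ G w + B) → R a F ≤ R a G + B
R-shift-≤ {zero}  0≤a a≤1 F≤ = F≤ []
R-shift-≤ {suc n} {a} {B} 0≤a a≤1 {F} {G} F≤ = subst
  (R a F ≤_)
  (regroup a B (R a (λ w → G (nothing ∷ w))) (R a (λ w → G (just Sign.+ ∷ w))) (R a (λ w → G (just Sign.- ∷ w))))
  (ℚₚ.+-mono-≤
    (*-monoˡ-≤ (0≤q-p a≤1) (R-shift-≤ {n} {a} {B} 0≤a a≤1 (λ w → F≤ (nothing ∷ w))))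
    (*-monoˡ-≤ (0≤* (ℚₚ.nonNegative⁻¹ ½) 0≤a) (ℚₚ.+-mono-≤
      (R-shift-≤ {n} {a} {B} 0≤a a≤1 (λ w → F≤ (just Sign.+ ∷ w)))
      (R-shift-≤ {n} {a} {B} 0≤a a≤1 (λ w → F≤ (just Sign.- ∷ w))))))
  where
  regroup : ∀ a B p q r → (1ℚ - a) * (p + B) + ½ * a * ((q + B) + (r + B)) ≡ ((1ℚ - a) * p + ½ * a * (q + r)) + B
  regroup = solve-∀ ℚ-ring

mix : (ρ p q r s : ℚ) → ℚ
mix ρ p q r s = ((1ℚ + ρ * (1ℚ * 1ℚ)) * p + (1ℚ + ρ * (1ℚ * - 1ℚ)) * q)
              + ((1ℚ + ρ * (- 1ℚ * 1ℚ)) * r + (1ℚ + ρ * (- 1ℚ * - 1ℚ)) * s)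

S-k-suc : ∀ {n} ρ (C : Cube (suc n) → Cube (suc n) → ℚ) → let D = λ s t → S (λ x y → k ρ x y * (C ⟦ s , t ⟧) x y) in
  S (λ x y → k ρ x y * C x y) ≡ mix ρ (D Sign.+ Sign.+) (D Sign.+ Sign.-) (D Sign.- Sign.+) (D Sign.- Sign.-)
S-k-suc {n} ρ C = trans (S-suc (λ x y → k ρ x y * C x y))
  (cong₂ _+_ (cong₂ _+_ (pull Sign.+ Sign.+) (pull Sign.+ Sign.-)) (cong₂ _+_ (pull Sign.- Sign.+) (pull Sign.- Sign.-)))
  where
  pull : ∀ s t → S (λ x y → (1ℚ + ρ * (value s * value t)) * k ρ x y * (C ⟦ s , t ⟧) x y)
    ≡ (1ℚ + ρ * (value s * value t)) * S (λ x y → k ρ x y * (C ⟦ s , t ⟧) x y)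
  pull s t = trans
    (S-cong (λ x y → ℚₚ.*-assoc (1ℚ + ρ * (value s * value t)) (k ρ x y) ((C ⟦ s , t ⟧) x y)))
    (S-*ˡ (1ℚ + ρ * (value s * value t)) (λ x y → k ρ x y * (C ⟦ s , t ⟧) x y))

R-mix : ∀ {n} a ρ (F G H I : Mask n → ℚ) → R a (λ w → mix ρ (F w) (G w) (H w) (I w)) ≡ mix ρ (R a F) (R a G) (R a H) (R a I)
R-mix a ρ F G H I = trans
  (R-+ a (λ w → c₁ * F w + c₂ * G w) (λ w → c₃ * H w + c₄ * I w))
  (cong₂ _+_ (trans (R-+ a (λ w → c₁ * F w) (λ w → c₂ * G w)) (cong₂ _+_ (R-*ˡ a c₁ F) (R-*ˡ a c₂ G)))
             (trans (R-+ a (λ w → c₃ * H w) (λ w → c₄ * I w)) (cong₂ _+_ (R-*ˡ a c₃ H) (R-*ˡ a c₄ I))))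
  where
  c₁ c₂ c₃ c₄ : ℚ
  c₁ = 1ℚ + ρ * (1ℚ * 1ℚ)
  c₂ = 1ℚ + ρ * (1ℚ * - 1ℚ)
  c₃ = 1ℚ + ρ * (- 1ℚ * 1ℚ)
  c₄ = 1ℚ + ρ * (- 1ℚ * - 1ℚ)

-- A random restriction: fixing each coordinate with probability a raises the
-- correlation from t to σ a + (1 - a) t.
S-restriction : ∀ {n} σ a t (C : Cube n → Cube n → ℚ) →
  S (λ x y → k (value σ * a + (1ℚ - a) * t) x y * C x y)
  ≡ R a (λ w → S (λ x y → k t x y * C (fix Sign.+ w x) (fix σ w y)))
S-restriction {zero}  σ a t C = refl
S-restriction {suc n} σ a t C = begin
  S (λ x y → k ρ x y * C x y)
    ≡⟨ S-k-suc ρ C ⟩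
  mix ρ (X Sign.+ Sign.+) (X Sign.+ Sign.-) (X Sign.- Sign.+) (X Sign.- Sign.-)
    ≡⟨ cong₂ (λ p q → p + q)
         (cong₂ (λ p q → (1ℚ + ρ * (1ℚ * 1ℚ)) * p + (1ℚ + ρ * (1ℚ * - 1ℚ)) * q) (ih Sign.+ Sign.+) (ih Sign.+ Sign.-))
         (cong₂ (λ p q → (1ℚ + ρ * (- 1ℚ * 1ℚ)) * p + (1ℚ + ρ * (- 1ℚ * - 1ℚ)) * q) (ih Sign.- Sign.+) (ih Sign.- Sign.-)) ⟩
  mix ρ (Y Sign.+ Sign.+) (Y Sign.+ Sign.-) (Y Sign.- Sign.+) (Y Sign.- Sign.-)
    ≡⟨ combine σ ⟩
  (1ℚ - a) * mix t (Y Sign.+ Sign.+) (Y Sign.+ Sign.-) (Y Sign.- Sign.+) (Y Sign.- Sign.-)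
    + ½ * a * (ℤ.+ 4 / 1 * Y Sign.+ (σ Sign.* Sign.+) + ℤ.+ 4 / 1 * Y Sign.- (σ Sign.* Sign.-))
    ≡⟨ sym (cong₂ (λ p q → (1ℚ - a) * p + ½ * a * q) free (cong₂ _+_ (fixed Sign.+) (fixed Sign.-))) ⟩
  R a (λ w → S (λ x y → k t x y * C (fix Sign.+ w x) (fix σ w y))) ∎
  where
  open ≡-Reasoning
  ρ : ℚ
  ρ = value σ * a + (1ℚ - a) * t
  X Y : Sign → Sign → ℚ
  X s s′ = S (λ x y → k ρ x y * (C ⟦ s , s′ ⟧) x y)
  Z : Sign → Sign → Mask n → ℚ
  Z s s′ w = S (λ x y → k t x y * (C ⟦ s , s′ ⟧) (fix Sign.+ w x) (fix σ w y))
  Y s s′ = R a (Z s s′)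
  ih : ∀ s s′ → X s s′ ≡ Y s s′
  ih s s′ = S-restriction σ a t (C ⟦ s , s′ ⟧)
  free : R a (λ w → S {suc n} (λ x y → k t x y * C (fix Sign.+ (nothing ∷ w) x) (fix σ (nothing ∷ w) y)))
    ≡ mix t (Y Sign.+ Sign.+) (Y Sign.+ Sign.-) (Y Sign.- Sign.+) (Y Sign.- Sign.-)
  free = trans (R-cong a (λ w → S-k-suc t (λ x y → C (fix Sign.+ (nothing ∷ w) x) (fix σ (nothing ∷ w) y))))
    (R-mix a t (Z Sign.+ Sign.+) (Z Sign.+ Sign.-) (Z Sign.- Sign.+) (Z Sign.- Sign.-))
  mix-same : ∀ t p → ((1ℚ + t * (1ℚ * 1ℚ)) * p + (1ℚ + t * (1ℚ * - 1ℚ)) * p)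
    + ((1ℚ + t * (- 1ℚ * 1ℚ)) * p + (1ℚ + t * (- 1ℚ * - 1ℚ)) * p) ≡ ℤ.+ 4 / 1 * p
  mix-same = solve-∀ ℚ-ring
  fixed : ∀ u → R a (λ w → S {suc n} (λ x y → k t x y * C (fix Sign.+ (just u ∷ w) x) (fix σ (just u ∷ w) y)))
    ≡ ℤ.+ 4 / 1 * Y u (σ Sign.* u)
  fixed u = trans (R-cong a (λ w → trans
      (S-k-suc t (λ x y → C (fix Sign.+ (just u ∷ w) x) (fix σ (just u ∷ w) y)))
      (mix-same t (Z u (σ Sign.* u) w))))
    (R-*ˡ a (ℤ.+ 4 / 1) (Z u (σ Sign.* u)))
  -- Coordinatewise, with z the product of the two signs, 1 + ρ z = (1 - a) (1 + t z) + a (1 + σ z),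
  -- and 1 + σ z is 2 for z = σ and 0 otherwise. The factors 4 count the sign pairs that a fixed
  -- coordinate ignores.
  combine : ∀ σ → mix (value σ * a + (1ℚ - a) * t) (Y Sign.+ Sign.+) (Y Sign.+ Sign.-) (Y Sign.- Sign.+) (Y Sign.- Sign.-)
    ≡ (1ℚ - a) * mix t (Y Sign.+ Sign.+) (Y Sign.+ Sign.-) (Y Sign.- Sign.+) (Y Sign.- Sign.-)
      + ½ * a * (ℤ.+ 4 / 1 * Y Sign.+ (σ Sign.* Sign.+) + ℤ.+ 4 / 1 * Y Sign.- (σ Sign.* Sign.-))
  combine Sign.+ = combine⁺ a t (Y Sign.+ Sign.+) (Y Sign.+ Sign.-) (Y Sign.- Sign.+) (Y Sign.- Sign.-)
    where
    combine⁺ : ∀ a t p q r s → let ρ = 1ℚ * a + (1ℚ - a) * t in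
      ((1ℚ + ρ * (1ℚ * 1ℚ)) * p + (1ℚ + ρ * (1ℚ * - 1ℚ)) * q) + ((1ℚ + ρ * (- 1ℚ * 1ℚ)) * r + (1ℚ + ρ * (- 1ℚ * - 1ℚ)) * s)
      ≡ (1ℚ - a) * (((1ℚ + t * (1ℚ * 1ℚ)) * p + (1ℚ + t * (1ℚ * - 1ℚ)) * q) + ((1ℚ + t * (- 1ℚ * 1ℚ)) * r + (1ℚ + t * (- 1ℚ * - 1ℚ)) * s))
        + ½ * a * (ℤ.+ 4 / 1 * p + ℤ.+ 4 / 1 * s)
    combine⁺ = solve-∀ ℚ-ring
  combine Sign.- = combine⁻ a t (Y Sign.+ Sign.+) (Y Sign.+ Sign.-) (Y Sign.- Sign.+) (Y Sign.- Sign.-)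
    where
    combine⁻ : ∀ a t p q r s → let ρ = - 1ℚ * a + (1ℚ - a) * t in
      ((1ℚ + ρ * (1ℚ * 1ℚ)) * p + (1ℚ + ρ * (1ℚ * - 1ℚ)) * q) + ((1ℚ + ρ * (- 1ℚ * 1ℚ)) * r + (1ℚ + ρ * (- 1ℚ * - 1ℚ)) * s)
      ≡ (1ℚ - a) * (((1ℚ + t * (1ℚ * 1ℚ)) * p + (1ℚ + t * (1ℚ * - 1ℚ)) * q) + ((1ℚ + t * (- 1ℚ * 1ℚ)) * r + (1ℚ + t * (- 1ℚ * - 1ℚ)) * s))
        + ½ * a * (ℤ.+ 4 / 1 * q + ℤ.+ 4 / 1 * r)
    combine⁻ = solve-∀ ℚ-ring

reindex : ∀ {n} → (Cube n → Cube n) → (Cube n → Cube n) → Protocol n → Protocol n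
reindex α β (output s)       = output s
reindex α β (alice msg next) = alice (λ x → msg (α x)) (λ b → reindex α β (next b))
reindex α β (bob msg next)   = bob (λ y → msg (β y)) (λ b → reindex α β (next b))

run-reindex : ∀ {n} α β (P : Protocol n) x y → run (reindex α β P) x y ≡ run P (α x) (β y)
run-reindex α β (output s)       x y = refl
run-reindex α β (alice msg next) x y = run-reindex α β (next (msg (α x))) x y
run-reindex α β (bob msg next)   x y = run-reindex α β (next (msg (β y))) x y

cost-reindex : ∀ {n} α β (P : Protocol n) → cost (reindex α β P) ≡ cost P
cost-reindex α β (output s)       = refl
cost-reindex α β (alice msg next) = cong suc (cong₂ ℕ._⊔_ (cost-reindex α β (next true)) (cost-reindex α β (next false)))
cost-reindex α β (bob msg next)   = cong suc (cong₂ ℕ._⊔_ (cost-reindex α β (next true)) (cost-reindex α β (next false)))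

∣p-q∣≤r⇒p≤q+r : ∀ {p q r} → ∣ p - q ∣ ≤ r → p ≤ q + r
∣p-q∣≤r⇒p≤q+r {p} {q} {r} h = subst (_≤ q + r) (cancel p q) (ℚₚ.+-monoʳ-≤ q (ℚₚ.≤-trans (p≤∣p∣ (p - q)) h))
  where
  cancel : ∀ p q → q + (p - q) ≡ p
  cancel = solve-∀ ℚ-ring

∣p-q∣≡∣q-p∣ : ∀ p q → ∣ p - q ∣ ≡ ∣ q - p ∣
∣p-q∣≡∣q-p∣ p q = trans (sym (ℚₚ.∣-p∣≡∣p∣ (p - q))) (cong ∣_∣ (flip p q))
  where
  flip : ∀ p q → - (p - q) ≡ q - p
  flip = solve-∀ ℚ-ring

∣p-r∣-triangle : ∀ {p q r a b} → ∣ p - q ∣ ≤ a → ∣ q - r ∣ ≤ b → ∣ p - r ∣ ≤ a + b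
∣p-r∣-triangle {p} {q} {r} {a} {b} h₁ h₂ = subst (λ s → ∣ s ∣ ≤ a + b) (cancel p q r)
  (ℚₚ.≤-trans (ℚₚ.∣p+q∣≤∣p∣+∣q∣ (p - q) (q - r)) (ℚₚ.+-mono-≤ h₁ h₂))
  where
  cancel : ∀ p q r → (p - q) + (q - r) ≡ p - r
  cancel = solve-∀ ℚ-ring

out-bound : ∀ {n} (P : Protocol n) x y → ∣ out P x y ∣ ≤ 1ℚ
out-bound P x y = ∣value∣ (run P x y)

E-restriction : ∀ {n} σ a t (C : Cube n → Cube n → ℚ) →
  E (value σ * a + (1ℚ - a) * t) C ≡ R a (λ w → E t (λ x y → C (fix Sign.+ w x) (fix σ w y)))
E-restriction {n} σ a t C = trans (cong (quarter^ n *_) (S-restriction σ a t C))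
  (sym (R-*ˡ a (quarter^ n) (λ w → S (λ x y → k t x y * C (fix Sign.+ w x) (fix σ w y)))))

-- The Lipschitz bound for correlations up to 1/2

module Lipschitz {n : ℕ} (P : Protocol n) {ω : ℚ} (1≤ω : 1ℚ ≤ ω) (cost≤ : natℚ (cost P) ≤ ℤ.+ 4 / 1 * (ω * ω)) (σ : Sign) where

  0≤ω : 0ℚ ≤ ω
  0≤ω = ℚₚ.≤-trans 0≤1 1≤ω

  near-0 : ∀ w {t} → ∣ t ∣ ≤ 1ℚ → let C = λ x y → out P (fix Sign.+ w x) (fix σ w y) in
    ∣ E t C - E 0ℚ C ∣ ≤ ∣ t ∣ * (ℤ.+ 24 / 1 * ω) + ∣ t ∣ * ∣ t ∣ * two^ n
  near-0 w {t} ∣t∣≤1 = ℚₚ.≤-trans (Taylor.E-Taylor {t} ∣t∣≤1 C (λ x y → out-bound P (fix Sign.+ w x) (fix σ w y)))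
    (ℚₚ.+-monoˡ-≤ (∣ t ∣ * ∣ t ∣ * two^ n) (*-monoˡ-≤ (ℚₚ.0≤∣p∣ t)
      (subst (λ u → ∣ u ∣ ≤ ℤ.+ 24 / 1 * ω)
        (U-cong (λ x y → cong (λ s → ip x y * value s) (run-reindex (fix Sign.+ w) (fix σ w) P x y)))
        (level-one-bound Q (ℚₚ.<-≤-trans 0<1 1≤ω)
          (subst (λ c → natℚ c ≤ ℤ.+ 4 / 1 * (ω * ω)) (sym (cost-reindex (fix Sign.+ w) (fix σ w) P)) cost≤)))))
    where
    C : Cube n → Cube n → ℚ
    C x y = out P (fix Sign.+ w x) (fix σ w y)
    Q : Protocol n
    Q = reindex (fix Sign.+ w) (fix σ w) P

  -- Both expectations are averages over the same random masks, of restricted protocols at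
  -- correlation t and at 0. The estimate near 0 holds for each mask uniformly, hence for the
  -- average.
  near : ∀ {a t} → 0ℚ ≤ a → a ≤ 1ℚ → ∣ t ∣ ≤ 1ℚ →
    ∣ E (value σ * a + (1ℚ - a) * t) (out P) - E (value σ * a) (out P) ∣
      ≤ ∣ t ∣ * (ℤ.+ 24 / 1 * ω) + ∣ t ∣ * ∣ t ∣ * two^ n
  near {a} {t} 0≤a a≤1 ∣t∣≤1 = subst₂ (λ p q → ∣ p - q ∣ ≤ B)
    (sym (E-restriction σ a t (out P)))
    (trans (sym (E-restriction σ a 0ℚ (out P))) (cong (λ r → E r (out P)) (no-shift (value σ) a)))
    (∣p-q∣≤r {R a (F t)} {R a (F 0ℚ)} {B}
      (R-shift-≤ 0≤a a≤1 (λ w → ∣p-q∣≤r⇒p≤q+r (near-0 w ∣t∣≤1)))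
      (R-shift-≤ 0≤a a≤1 (λ w → ∣p-q∣≤r⇒p≤q+r (subst (_≤ B) (∣p-q∣≡∣q-p∣ (F t w) (F 0ℚ w)) (near-0 w ∣t∣≤1)))))
    where
    B : ℚ
    B = ∣ t ∣ * (ℤ.+ 24 / 1 * ω) + ∣ t ∣ * ∣ t ∣ * two^ n
    F : ℚ → Mask n → ℚ
    F t w = E t (λ x y → out P (fix Sign.+ w x) (fix σ w y))
    no-shift : ∀ v a → v * a + (1ℚ - a) * 0ℚ ≡ v * a
    no-shift = solve-∀ ℚ-ring

  β : ℚ → ℚ
  β δ = 2ℚ * δ * (ℤ.+ 24 / 1 * ω) + 2ℚ * δ * (2ℚ * δ) * two^ n

  step : ∀ {a δ} → 0ℚ ≤ a → 0ℚ ≤ δ → a + δ ≤ ½ →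
    ∣ E (value σ * (a + δ)) (out P) - E (value σ * a) (out P) ∣ ≤ β δ
  step {a} {δ} 0≤a 0≤δ a+δ≤½ = subst (λ r → ∣ E r (out P) - E (value σ * a) (out P) ∣ ≤ β δ) reach
    (ℚₚ.≤-trans (near 0≤a (ℚₚ.≤-trans a≤½ ½≤1) (ℚₚ.≤-trans ∣t∣≤ 2δ≤1))
      (ℚₚ.+-mono-≤ (*-monoʳ-≤ (0≤* (ℚₚ.nonNegative⁻¹ (ℤ.+ 24 / 1)) 0≤ω) ∣t∣≤)
        (*-monoʳ-≤ (0≤two^ n) (*-mono-≤ (ℚₚ.0≤∣p∣ t) 0≤2δ ∣t∣≤ ∣t∣≤))))
    where
    i t : ℚ
    i = inv (1ℚ - a)
    -- The solution of σ a + (1 - a) t = σ (a + δ); a ≤ ½ keeps it within 2 δ.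
    t = value σ * (δ * i)
    ½≤1 : ½ ≤ 1ℚ
    ½≤1 = ≤-by ½ (ℚₚ.nonNegative⁻¹ ½) refl
    a≤½ : a ≤ ½
    a≤½ = ℚₚ.≤-trans (≤-by {a} δ 0≤δ refl) a+δ≤½
    δ≤½ : δ ≤ ½
    δ≤½ = ℚₚ.≤-trans (≤-by {δ} a 0≤a (ℚₚ.+-comm δ a)) a+δ≤½
    ½≤1-a : ½ ≤ 1ℚ - a
    ½≤1-a = ≤-by (½ - a) (0≤q-p a≤½) (halves a)
      where
      halves : ∀ a → ½ + (½ - a) ≡ 1ℚ - a
      halves = solve-∀ ℚ-ring
    1-a≢0 : 1ℚ - a ≢ 0ℚ
    1-a≢0 eq = ℚₚ.<⇒≢ (ℚₚ.<-≤-trans (ℚₚ.positive⁻¹ ½) ½≤1-a) (sym eq)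
    0≤i : 0ℚ ≤ i
    0≤i = 0≤inv (ℚₚ.≤-trans (ℚₚ.nonNegative⁻¹ ½) ½≤1-a)
    i≤2 : i ≤ 2ℚ
    i≤2 = subst₂ _≤_ (cancel i) (trans (cong (2ℚ *_) (*-inv 1-a≢0)) (ℚₚ.*-identityʳ 2ℚ))
      (*-monoˡ-≤ (ℚₚ.nonNegative⁻¹ 2ℚ) (*-monoʳ-≤ 0≤i ½≤1-a))
      where
      cancel : ∀ i → ℤ.+ 2 / 1 * (½ * i) ≡ i
      cancel = solve-∀ ℚ-ring
    0≤2δ : 0ℚ ≤ 2ℚ * δ
    0≤2δ = 0≤* (ℚₚ.nonNegative⁻¹ 2ℚ) 0≤δ
    2δ≤1 : 2ℚ * δ ≤ 1ℚ
    2δ≤1 = *-monoˡ-≤ {r = 2ℚ} (ℚₚ.nonNegative⁻¹ 2ℚ) δ≤½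
    ∣t∣≤ : ∣ t ∣ ≤ 2ℚ * δ
    ∣t∣≤ = subst (∣ t ∣ ≤_) (ℚₚ.*-identityˡ (2ℚ * δ))
      (∣*∣-mono-≤ {value σ} {δ * i} {1ℚ} {2ℚ * δ} (∣value∣ σ)
        (subst (_≤ 2ℚ * δ) (sym (ℚₚ.0≤p⇒∣p∣≡p (0≤* 0≤δ 0≤i)))
          (subst (δ * i ≤_) (ℚₚ.*-comm δ 2ℚ) (*-monoˡ-≤ 0≤δ i≤2))))
    reach : value σ * a + (1ℚ - a) * t ≡ value σ * (a + δ)
    reach = trans (regroup (value σ) a δ i) (trans (cong (λ u → value σ * (a + δ * u)) (*-inv 1-a≢0))
      (cong (λ u → value σ * (a + u)) (ℚₚ.*-identityʳ δ)))
      where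
      regroup : ∀ v a δ i → v * a + (1ℚ - a) * (v * (δ * i)) ≡ v * (a + δ * ((1ℚ - a) * i))
      regroup = solve-∀ ℚ-ring

  -- The triangle inequality over 2ᵐ equal steps, organised by doubling so that the induction runs
  -- over m.
  steps : ∀ m {a δ} → 0ℚ ≤ a → 0ℚ ≤ δ → a + two^ m * δ ≤ ½ →
    ∣ E (value σ * (a + two^ m * δ)) (out P) - E (value σ * a) (out P) ∣ ≤ two^ m * β δ
  steps zero {a} {δ} 0≤a 0≤δ h = subst₂ (λ d b → ∣ E (value σ * (a + d)) (out P) - E (value σ * a) (out P) ∣ ≤ b)
    (sym (ℚₚ.*-identityˡ δ)) (sym (ℚₚ.*-identityˡ (β δ)))
    (step 0≤a 0≤δ (subst (λ d → a + d ≤ ½) (ℚₚ.*-identityˡ δ) h))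
  steps (suc m) {a} {δ} 0≤a 0≤δ h = subst₂ (λ d b → ∣ E (value σ * d) (out P) - E (value σ * a) (out P) ∣ ≤ b)
    (double a (two^ m) δ) (double′ (two^ m) (β δ))
    (∣p-r∣-triangle {E (value σ * (mid + two^ m * δ)) (out P)} {E (value σ * mid) (out P)} {E (value σ * a) (out P)}
      (steps m 0≤mid 0≤δ (subst (_≤ ½) (sym (double a (two^ m) δ)) h))
      (steps m 0≤a 0≤δ (ℚₚ.≤-trans (≤-by (two^ m * δ) 0≤jump (double a (two^ m) δ)) h)))
    where
    mid : ℚ
    mid = a + two^ m * δ
    0≤jump : 0ℚ ≤ two^ m * δ
    0≤jump = 0≤* (0≤two^ m) 0≤δ
    0≤mid : 0ℚ ≤ mid
    0≤mid = 0≤+ 0≤a 0≤jump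
    double : ∀ a t δ → (a + t * δ) + t * δ ≡ a + ℤ.+ 2 / 1 * t * δ
    double = solve-∀ ℚ-ring
    double′ : ∀ t b → t * b + t * b ≡ ℤ.+ 2 / 1 * t * b
    double′ = solve-∀ ℚ-ring

  -- With 2ⁿ steps the accumulated second-order error 4 ρ² no longer depends on n.
  Lipschitz-½ : ∀ {ρ} → 0ℚ ≤ ρ → ρ ≤ ½ → ∣ E (value σ * ρ) (out P) - E 0ℚ (out P) ∣ ≤ ℤ.+ 50 / 1 * ω * ρ
  Lipschitz-½ {ρ} 0≤ρ ρ≤½ = ℚₚ.≤-trans
    (subst₂ (λ r r₀ → ∣ E (value σ * r) (out P) - E r₀ (out P) ∣ ≤ two^ n * β δ)
      arrive (ℚₚ.*-zeroʳ (value σ))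
      (steps n {0ℚ} {δ} ℚₚ.≤-refl (0≤* (0≤inv (0≤two^ n)) 0≤ρ) (subst (_≤ ½) (sym arrive) ρ≤½)))
    total
    where
    open ℚₚ.≤-Reasoning
    δ : ℚ
    δ = inv (two^ n) * ρ
    two^≢0 : ∀ n → two^ n ≢ 0ℚ
    two^≢0 zero    = ℚₚ.1≢0
    two^≢0 (suc n) eq = two^≢0 n (*-zero-pos (ℚₚ.positive⁻¹ 2ℚ) eq)
    2ⁿδ≡ρ : two^ n * δ ≡ ρ
    2ⁿδ≡ρ = trans (sym (ℚₚ.*-assoc (two^ n) (inv (two^ n)) ρ))
      (trans (cong (_* ρ) (*-inv (two^≢0 n))) (ℚₚ.*-identityˡ ρ))
    arrive : 0ℚ + two^ n * δ ≡ ρ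
    arrive = trans (ℚₚ.+-identityˡ (two^ n * δ)) 2ⁿδ≡ρ
    expand : ∀ t δ ω → t * (ℤ.+ 2 / 1 * δ * (ℤ.+ 24 / 1 * ω) + ℤ.+ 2 / 1 * δ * (ℤ.+ 2 / 1 * δ) * t)
      ≡ ℤ.+ 48 / 1 * ω * (t * δ) + ℤ.+ 4 / 1 * (t * δ) * (t * δ)
    expand = solve-∀ ℚ-ring
    -- As ρ ≤ ½ and ω ≥ 1, the second-order error 4 ρ² is at most 2 ω ρ; added to the first-order 48
    -- ω ρ it yields the constant 50.
    4ρ≤2ω : ℤ.+ 4 / 1 * ρ ≤ 2ℚ * ω
    4ρ≤2ω = ℚₚ.≤-trans (*-monoˡ-≤ {r = ℤ.+ 4 / 1} (ℚₚ.nonNegative⁻¹ (ℤ.+ 4 / 1)) ρ≤½)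
      (*-monoˡ-≤ {r = 2ℚ} (ℚₚ.nonNegative⁻¹ 2ℚ) 1≤ω)
    collect : ∀ ω ρ → ℤ.+ 48 / 1 * ω * ρ + ℤ.+ 2 / 1 * ω * ρ ≡ ℤ.+ 50 / 1 * ω * ρ
    collect = solve-∀ ℚ-ring
    total : two^ n * β δ ≤ ℤ.+ 50 / 1 * ω * ρ
    total = begin
      two^ n * β δ                                    ≡⟨ expand (two^ n) δ ω ⟩
      ℤ.+ 48 / 1 * ω * (two^ n * δ) + ℤ.+ 4 / 1 * (two^ n * δ) * (two^ n * δ)
        ≡⟨ cong (λ r → ℤ.+ 48 / 1 * ω * r + ℤ.+ 4 / 1 * r * r) 2ⁿδ≡ρ ⟩
      ℤ.+ 48 / 1 * ω * ρ + ℤ.+ 4 / 1 * ρ * ρ           ≤⟨ ℚₚ.+-monoʳ-≤ (ℤ.+ 48 / 1 * ω * ρ) (*-monoʳ-≤ 0≤ρ 4ρ≤2ω) ⟩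
      ℤ.+ 48 / 1 * ω * ρ + 2ℚ * ω * ρ                 ≡⟨ collect ω ρ ⟩
      ℤ.+ 50 / 1 * ω * ρ                              ∎

-- Correlations above 1/2 and slightly outside [-1 , 1]

U-suc : ∀ {n} (C : Cube (suc n) → Cube (suc n) → ℚ) → U C ≡ ℤ.+ 1 / 4 *
  ((U (C ⟦ Sign.+ , Sign.+ ⟧) + U (C ⟦ Sign.+ , Sign.- ⟧)) + (U (C ⟦ Sign.- , Sign.+ ⟧) + U (C ⟦ Sign.- , Sign.- ⟧)))
U-suc {n} C = trans (cong (ℤ.+ 1 / 4 * quarter^ n *_) (S-suc C))
  (distribute (quarter^ n) (S (C ⟦ Sign.+ , Sign.+ ⟧)) (S (C ⟦ Sign.+ , Sign.- ⟧)) (S (C ⟦ Sign.- , Sign.+ ⟧)) (S (C ⟦ Sign.- , Sign.- ⟧)))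
  where
  distribute : ∀ c p q r s → ℤ.+ 1 / 4 * c * ((p + q) + (r + s)) ≡ ℤ.+ 1 / 4 * ((c * p + c * q) + (c * r + c * s))
  distribute = solve-∀ ℚ-ring

E-const : ∀ n ρ c → E {n} ρ (λ _ _ → c) ≡ c
E-const zero    ρ c = trans (ℚₚ.*-identityˡ (1ℚ * c)) (ℚₚ.*-identityˡ c)
E-const (suc n) ρ c = trans (U-suc {n} (λ x y → k ρ x y * c)) (trans
  (cong (ℤ.+ 1 / 4 *_) (cong₂ _+_ (cong₂ _+_ (pull Sign.+ Sign.+) (pull Sign.+ Sign.-)) (cong₂ _+_ (pull Sign.- Sign.+) (pull Sign.- Sign.-))))
  (average ρ c))
  where
  pull : ∀ s t → U {n} (λ x y → (1ℚ + ρ * (value s * value t)) * k ρ x y * c) ≡ (1ℚ + ρ * (value s * value t)) * c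
  pull s t = trans (U-cong {n} (λ x y → ℚₚ.*-assoc (1ℚ + ρ * (value s * value t)) (k ρ x y) c))
    (trans (U-*ˡ {n} (1ℚ + ρ * (value s * value t)) (λ x y → k ρ x y * c))
           (cong ((1ℚ + ρ * (value s * value t)) *_) (E-const n ρ c)))
  average : ∀ t p → ℤ.+ 1 / 4 * (((1ℚ + t * (1ℚ * 1ℚ)) * p + (1ℚ + t * (1ℚ * - 1ℚ)) * p)
    + ((1ℚ + t * (- 1ℚ * 1ℚ)) * p + (1ℚ + t * (- 1ℚ * - 1ℚ)) * p)) ≡ p
  average = solve-∀ ℚ-ring

power : ℚ → ℕ → ℚ
power b zero    = 1ℚ
power b (suc n) = b * power b n

0≤power : ∀ {b} → 0ℚ ≤ b → ∀ n → 0ℚ ≤ power b n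
0≤power 0≤b zero    = 0≤1
0≤power 0≤b (suc n) = 0≤* 0≤b (0≤power 0≤b n)

-- The convex function (1 + η)ⁿ lies below its chord between η = 0 and η = 1.
power-1+ : ∀ {η} → 0ℚ ≤ η → η ≤ 1ℚ → ∀ n → power (1ℚ + η) n ≤ 1ℚ + η * (two^ n - 1ℚ)
power-1+ {η} 0≤η η≤1 zero    = ℚₚ.≤-reflexive (start η)
  where
  start : ∀ η → 1ℚ ≡ 1ℚ + η * (1ℚ - 1ℚ)
  start = solve-∀ ℚ-ring
power-1+ {η} 0≤η η≤1 (suc n) = ℚₚ.≤-trans
  (*-monoˡ-≤ (0≤+ 0≤1 0≤η) (power-1+ 0≤η η≤1 n))
  (≤-by (η * (1ℚ - η) * (two^ n - 1ℚ)) (0≤* (0≤* 0≤η (0≤q-p η≤1)) (0≤q-p (1≤two^ n))) (expand η (two^ n)))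
  where
  expand : ∀ η t → (1ℚ + η) * (1ℚ + η * (t - 1ℚ)) + η * (1ℚ - η) * (t - 1ℚ) ≡ 1ℚ + η * (ℤ.+ 2 / 1 * t - 1ℚ)
  expand = solve-∀ ℚ-ring

∣1+ρ∣+∣1-ρ∣ : ∀ {ρ b} → 1ℚ ≤ b → ∣ ρ ∣ ≤ b → ∣ 1ℚ + ρ ∣ + ∣ 1ℚ - ρ ∣ ≤ 2ℚ * b
∣1+ρ∣+∣1-ρ∣ {ρ} {b} 1≤b ∣ρ∣≤b = cases (ℚₚ.∣p∣≡p∨∣p∣≡-p (1ℚ + ρ)) (ℚₚ.∣p∣≡p∨∣p∣≡-p (1ℚ - ρ))
  where
  from : ∀ {q} → q ≤ b → ∀ {r} → r ≡ 2ℚ * q → r ≤ 2ℚ * b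
  from q≤b refl = *-monoˡ-≤ (ℚₚ.nonNegative⁻¹ 2ℚ) q≤b
  ρ≤b : ρ ≤ b
  ρ≤b = ℚₚ.≤-trans (p≤∣p∣ ρ) ∣ρ∣≤b
  -ρ≤b : - ρ ≤ b
  -ρ≤b = ℚₚ.≤-trans (-p≤∣p∣ ρ) ∣ρ∣≤b
  -1≤b : - 1ℚ ≤ b
  -1≤b = ℚₚ.≤-trans (≤-by 2ℚ (ℚₚ.nonNegative⁻¹ 2ℚ) refl) 1≤b
  e₁ : ∀ r → (1ℚ + r) + (1ℚ - r) ≡ ℤ.+ 2 / 1 * 1ℚ
  e₁ = solve-∀ ℚ-ring
  e₂ : ∀ r → (1ℚ + r) + - (1ℚ - r) ≡ ℤ.+ 2 / 1 * r
  e₂ = solve-∀ ℚ-ring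
  e₃ : ∀ r → - (1ℚ + r) + (1ℚ - r) ≡ ℤ.+ 2 / 1 * - r
  e₃ = solve-∀ ℚ-ring
  e₄ : ∀ r → - (1ℚ + r) + - (1ℚ - r) ≡ ℤ.+ 2 / 1 * - 1ℚ
  e₄ = solve-∀ ℚ-ring
  cases : (∣ 1ℚ + ρ ∣ ≡ 1ℚ + ρ) ⊎ (∣ 1ℚ + ρ ∣ ≡ - (1ℚ + ρ)) → (∣ 1ℚ - ρ ∣ ≡ 1ℚ - ρ) ⊎ (∣ 1ℚ - ρ ∣ ≡ - (1ℚ - ρ)) →
    ∣ 1ℚ + ρ ∣ + ∣ 1ℚ - ρ ∣ ≤ 2ℚ * b
  cases (inj₁ p) (inj₁ q) = from 1≤b (trans (cong₂ _+_ p q) (e₁ ρ))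
  cases (inj₁ p) (inj₂ q) = from ρ≤b (trans (cong₂ _+_ p q) (e₂ ρ))
  cases (inj₂ p) (inj₁ q) = from -ρ≤b (trans (cong₂ _+_ p q) (e₃ ρ))
  cases (inj₂ p) (inj₂ q) = from -1≤b (trans (cong₂ _+_ p q) (e₄ ρ))

-- For |ρ| ≤ 1 the kernel is a density; beyond, it takes negative values and its L¹ norm exceeds 1.
-- The norm is a product over the coordinates, with factor (|1 + ρ| + |1 - ρ|) / 2 = max(1 , |ρ|).
U-∣k∣ : ∀ n {ρ b} → 1ℚ ≤ b → ∣ ρ ∣ ≤ b → U {n} (λ x y → ∣ k ρ x y ∣) ≤ power b n
U-∣k∣ zero    1≤b ∣ρ∣≤b = ℚₚ.≤-refl
U-∣k∣ (suc n) {ρ} {b} 1≤b ∣ρ∣≤b = begin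
  U {suc n} (λ x y → ∣ k ρ x y ∣)
    ≡⟨ U-suc {n} (λ x y → ∣ k ρ x y ∣) ⟩
  ℤ.+ 1 / 4 * ((U (row Sign.+ Sign.+) + U (row Sign.+ Sign.-)) + (U (row Sign.- Sign.+) + U (row Sign.- Sign.-)))
    ≡⟨ cong (ℤ.+ 1 / 4 *_) (cong₂ _+_
         (cong₂ _+_ (pull Sign.+ Sign.+ (c₊ ρ)) (pull Sign.+ Sign.- (c₋ ρ)))
         (cong₂ _+_ (pull Sign.- Sign.+ (c₋′ ρ)) (pull Sign.- Sign.- (c₊′ ρ)))) ⟩
  ℤ.+ 1 / 4 * ((∣ 1ℚ + ρ ∣ * K + ∣ 1ℚ - ρ ∣ * K) + (∣ 1ℚ - ρ ∣ * K + ∣ 1ℚ + ρ ∣ * K))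
    ≡⟨ collect ∣ 1ℚ + ρ ∣ ∣ 1ℚ - ρ ∣ K ⟩
  ½ * (∣ 1ℚ + ρ ∣ + ∣ 1ℚ - ρ ∣) * K
    ≤⟨ *-mono-≤ (0≤* (ℚₚ.nonNegative⁻¹ ½) (0≤+ (ℚₚ.0≤∣p∣ (1ℚ + ρ)) (ℚₚ.0≤∣p∣ (1ℚ - ρ)))) (0≤power (ℚₚ.≤-trans 0≤1 1≤b) n)
         (*-monoˡ-≤ (ℚₚ.nonNegative⁻¹ ½) (∣1+ρ∣+∣1-ρ∣ 1≤b ∣ρ∣≤b)) (U-∣k∣ n 1≤b ∣ρ∣≤b) ⟩
  ½ * (2ℚ * b) * power b n
    ≡⟨ halve b (power b n) ⟩
  b * power b n ∎
  where
  open ℚₚ.≤-Reasoning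
  K : ℚ
  K = U {n} (λ x y → ∣ k ρ x y ∣)
  row : Sign → Sign → Cube n → Cube n → ℚ
  row s t x y = ∣ (1ℚ + ρ * (value s * value t)) * k ρ x y ∣
  pull : ∀ s t {e} → 1ℚ + ρ * (value s * value t) ≡ e → U (row s t) ≡ ∣ e ∣ * K
  pull s t {e} eq = trans (U-cong {n} (λ x y → trans (cong (λ c → ∣ c * k ρ x y ∣) eq) (ℚₚ.∣p*q∣≡∣p∣*∣q∣ e (k ρ x y))))
    (U-*ˡ {n} ∣ e ∣ (λ x y → ∣ k ρ x y ∣))
  c₊ : ∀ r → 1ℚ + r * (1ℚ * 1ℚ) ≡ 1ℚ + r
  c₊ = solve-∀ ℚ-ring
  c₋ : ∀ r → 1ℚ + r * (1ℚ * - 1ℚ) ≡ 1ℚ - r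
  c₋ = solve-∀ ℚ-ring
  c₋′ : ∀ r → 1ℚ + r * (- 1ℚ * 1ℚ) ≡ 1ℚ - r
  c₋′ = solve-∀ ℚ-ring
  c₊′ : ∀ r → 1ℚ + r * (- 1ℚ * - 1ℚ) ≡ 1ℚ + r
  c₊′ = solve-∀ ℚ-ring
  collect : ∀ p q K → ℤ.+ 1 / 4 * ((p * K + q * K) + (q * K + p * K)) ≡ ½ * (p + q) * K
  collect = solve-∀ ℚ-ring
  halve : ∀ b p → ½ * (ℤ.+ 2 / 1 * b) * p ≡ b * p
  halve = solve-∀ ℚ-ring

-- The permitted overshoot of an approximation of ρ beyond [-1 , 1]: for η = 2⁻ⁿ the chord bound
-- gives (1 + η)ⁿ ≤ 2.
margin : ℕ → ℚ
margin n = inv (two^ n)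

0<two^ : ∀ n → 0ℚ < two^ n
0<two^ zero    = 0<1
0<two^ (suc n) = 0<2* (0<two^ n)

0<margin : ∀ n → 0ℚ < margin n
0<margin n = ≢0⇒0< (0≤inv (ℚₚ.<⇒≤ (0<two^ n))) (λ eq → ℚₚ.1≢0
  (trans (sym (*-inv (λ z → ℚₚ.<⇒≢ (0<two^ n) (sym z)))) (trans (cong (two^ n *_) eq) (ℚₚ.*-zeroʳ (two^ n)))))

margin-two^ : ∀ n → margin n * two^ n ≡ 1ℚ
margin-two^ n = trans (ℚₚ.*-comm (margin n) (two^ n)) (*-inv (λ z → ℚₚ.<⇒≢ (0<two^ n) (sym z)))

margin≤1 : ∀ n → margin n ≤ 1ℚ
margin≤1 n = subst₂ _≤_ (ℚₚ.*-identityʳ (margin n)) (margin-two^ n)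
  (*-monoˡ-≤ (ℚₚ.<⇒≤ (0<margin n)) (1≤two^ n))

E-bounded : ∀ {n} (P : Protocol n) {ρ} → ∣ ρ ∣ ≤ 1ℚ + margin n → ∣ E ρ (out P) ∣ ≤ 2ℚ
E-bounded {n} P {ρ} ∣ρ∣≤ = ℚₚ.≤-trans (∣p∣≤-by above below) (ℚₚ.≤-trans
  (U-∣k∣ n {ρ} {1ℚ + margin n} (≤-by {1ℚ} (margin n) 0≤η refl) ∣ρ∣≤)
  (ℚₚ.≤-trans (power-1+ 0≤η (margin≤1 n) n) (≤-by (margin n) 0≤η
    (trans (regroup (margin n) (two^ n)) (cong (1ℚ +_) (margin-two^ n))))))
  where
  0≤η : 0ℚ ≤ margin n
  0≤η = ℚₚ.<⇒≤ (0<margin n)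
  regroup : ∀ η t → 1ℚ + η * (t - 1ℚ) + η ≡ 1ℚ + η * t
  regroup = solve-∀ ℚ-ring
  point : ∀ x y → ∣ k ρ x y * out P x y ∣ ≤ ∣ k ρ x y ∣
  point x y = subst (∣ k ρ x y * out P x y ∣ ≤_) (ℚₚ.*-identityʳ ∣ k ρ x y ∣)
    (∣*∣-mono-≤ {k ρ x y} {out P x y} {∣ k ρ x y ∣} {1ℚ} ℚₚ.≤-refl (out-bound P x y))
  minus-one : ∀ p → - 1ℚ * p ≡ - p
  minus-one = solve-∀ ℚ-ring
  above : E ρ (out P) ≤ U {n} (λ x y → ∣ k ρ x y ∣)
  above = U-mono (λ x y → ℚₚ.≤-trans (p≤∣p∣ (k ρ x y * out P x y)) (point x y))
  below : - E ρ (out P) ≤ U {n} (λ x y → ∣ k ρ x y ∣)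
  below = subst (_≤ U {n} (λ x y → ∣ k ρ x y ∣))
    (trans (U-*ˡ (- 1ℚ) (λ x y → k ρ x y * out P x y)) (minus-one (E ρ (out P))))
    (U-mono (λ x y → subst (_≤ ∣ k ρ x y ∣) (sym (minus-one (k ρ x y * out P x y)))
      (ℚₚ.≤-trans (-p≤∣p∣ (k ρ x y * out P x y)) (point x y))))

E-bound : ∀ {n} (P : Protocol n) {ω} → 1ℚ ≤ ω → natℚ (cost P) ≤ ℤ.+ 4 / 1 * (ω * ω) → ∀ {ρ} → ∣ ρ ∣ ≤ 1ℚ + margin n →
  ∣ E ρ (out P) - E 0ℚ (out P) ∣ ≤ ℤ.+ 50 / 1 * ∣ ρ ∣ * ω
E-bound {n} P {ω} 1≤ω cost≤ {ρ} ∣ρ∣≤ = cases (ℚₚ.≤-total ∣ ρ ∣ ½)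
  where
  open ℚₚ.≤-Reasoning
  commute : ∀ ω r → ℤ.+ 50 / 1 * ω * r ≡ ℤ.+ 50 / 1 * r * ω
  commute = solve-∀ ℚ-ring
  small : ∣ ρ ∣ ≤ ½ → ∀ σ → ρ ≡ value σ * ∣ ρ ∣ → ∣ E ρ (out P) - E 0ℚ (out P) ∣ ≤ ℤ.+ 50 / 1 * ∣ ρ ∣ * ω
  small ∣ρ∣≤½ σ ρ≡ = subst₂ (λ r b → ∣ E r (out P) - E 0ℚ (out P) ∣ ≤ b) (sym ρ≡) (commute ω ∣ ρ ∣)
    (Lipschitz.Lipschitz-½ P 1≤ω cost≤ σ (ℚₚ.0≤∣p∣ ρ) ∣ρ∣≤½)
  negate : ∀ p → p ≡ - 1ℚ * - p
  negate = solve-∀ ℚ-ring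
  sign-cases : ∣ ρ ∣ ≤ ½ → (∣ ρ ∣ ≡ ρ) ⊎ (∣ ρ ∣ ≡ - ρ) → ∣ E ρ (out P) - E 0ℚ (out P) ∣ ≤ ℤ.+ 50 / 1 * ∣ ρ ∣ * ω
  sign-cases h (inj₁ eq) = small h Sign.+ (sym (trans (ℚₚ.*-identityˡ ∣ ρ ∣) eq))
  sign-cases h (inj₂ eq) = small h Sign.- (trans (negate ρ) (cong (- 1ℚ *_) (sym eq)))
  cases : (∣ ρ ∣ ≤ ½) ⊎ (½ ≤ ∣ ρ ∣) → ∣ E ρ (out P) - E 0ℚ (out P) ∣ ≤ ℤ.+ 50 / 1 * ∣ ρ ∣ * ω
  cases (inj₁ ∣ρ∣≤½) = sign-cases ∣ρ∣≤½ (ℚₚ.∣p∣≡p∨∣p∣≡-p ρ)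
  cases (inj₂ ½≤∣ρ∣) = begin
    ∣ E ρ (out P) - E 0ℚ (out P) ∣        ≤⟨ ℚₚ.∣p-q∣≤∣p∣+∣q∣ (E ρ (out P)) (E 0ℚ (out P)) ⟩
    ∣ E ρ (out P) ∣ + ∣ E 0ℚ (out P) ∣     ≤⟨ ℚₚ.+-mono-≤ (E-bounded P ∣ρ∣≤) (E-bounded P (0≤+ 0≤1 (ℚₚ.<⇒≤ (0<margin n)))) ⟩
    -- Here |ρ| ≥ ½ and ω ≥ 1, so the claimed bound is at least 25.
    2ℚ + 2ℚ                               ≤⟨ ≤-by (ℤ.+ 21 / 1) (ℚₚ.nonNegative⁻¹ (ℤ.+ 21 / 1)) refl ⟩
    ℤ.+ 50 / 1 * ½ * 1ℚ                   ≤⟨ *-mono-≤ {ℤ.+ 50 / 1 * ½} {ℤ.+ 50 / 1 * ∣ ρ ∣} (ℚₚ.nonNegative⁻¹ (ℤ.+ 50 / 1 * ½)) (ℚₚ.≤-trans 0≤1 1≤ω)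
                                               (*-monoˡ-≤ (ℚₚ.nonNegative⁻¹ (ℤ.+ 50 / 1)) ½≤∣ρ∣) 1≤ω ⟩
    ℤ.+ 50 / 1 * ∣ ρ ∣ * ω                ∎

-- Square roots, XOR-fibers and real numbers

natℚ-+ : ∀ m n → natℚ (m ℕ.+ n) ≡ natℚ m + natℚ n
natℚ-+ zero    n = sym (ℚₚ.+-identityˡ (natℚ n))
natℚ-+ (suc m) n = trans (cong (1ℚ +_) (natℚ-+ m n)) (sym (ℚₚ.+-assoc 1ℚ (natℚ m) (natℚ n)))

natℚ-* : ∀ m n → natℚ (m ℕ.* n) ≡ natℚ m * natℚ n
natℚ-* zero    n = sym (ℚₚ.*-zeroˡ (natℚ n))
natℚ-* (suc m) n = trans (natℚ-+ n (m ℕ.* n)) (trans (cong (natℚ n +_) (natℚ-* m n)) (distribute (natℚ m) (natℚ n)))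
  where
  distribute : ∀ p q → q + p * q ≡ (1ℚ + p) * q
  distribute = solve-∀ ℚ-ring

/-as-* : ∀ a k → ℤ.+ a / suc k ≡ natℚ a * (ℤ.+ 1 / suc k)
/-as-* zero    k = trans (ℚₚ.0/n≡0 (suc k)) (sym (ℚₚ.*-zeroˡ (ℤ.+ 1 / suc k)))
/-as-* (suc a) k = trans (√-Lemmas./-suc a k) (trans (cong (_+ ℤ.+ 1 / suc k) (/-as-* a k)) (collect (natℚ a) (ℤ.+ 1 / suc k)))
  where
  collect : ∀ p i → p * i + i ≡ (1ℚ + p) * i
  collect = solve-∀ ℚ-ring

natℚ-1/ : ∀ k → natℚ (suc k) * (ℤ.+ 1 / suc k) ≡ 1ℚ
natℚ-1/ k = trans (sym (/-as-* (suc k) k)) (ℚₚ.≤-antisym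
  (√-Lemmas./-mono-≤ (suc k) 1 k 0 (ℕₚ.≤-reflexive (ℕₚ.*-comm (suc k) 1)))
  (√-Lemmas./-mono-≤ 1 (suc k) 0 k (ℕₚ.≤-reflexive (ℕₚ.*-comm 1 (suc k)))))

/-*-cancel : ∀ a k → (ℤ.+ a / suc k) * natℚ (suc k) ≡ natℚ a
/-*-cancel a k = trans (cong (_* natℚ (suc k)) (/-as-* a k)) (trans (regroup (natℚ a) (ℤ.+ 1 / suc k) (natℚ (suc k)))
  (trans (cong (natℚ a *_) (natℚ-1/ k)) (ℚₚ.*-identityʳ (natℚ a))))
  where
  regroup : ∀ p i q → p * i * q ≡ p * (q * i)
  regroup = solve-∀ ℚ-ring

0≤√-seq : ∀ d k → 0ℚ ≤ √-seq d k
0≤√-seq d k = √-Lemmas./-mono-≤ 0 (isqrt (d ℕ.* (suc k ℕ.* suc k))) 0 k ℕ.z≤n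

module √-approximation (d k : ℕ) where

  K s : ℕ
  K = suc k
  s = isqrt (suc d ℕ.* (K ℕ.* K))

  K≤s : K ℕ.≤ s
  K≤s with K ℕₚ.≤? s
  ... | yes K≤s = K≤s
  ... | no  K≰s = contradiction
    (ℕₚ.≤-trans (isqrt-upper (suc d ℕ.* (K ℕ.* K))) (ℕₚ.*-mono-≤ (ℕₚ.≰⇒> K≰s) (ℕₚ.≰⇒> K≰s)))
    (ℕₚ.≤⇒≯ (ℕₚ.m≤m+n (K ℕ.* K) (d ℕ.* (K ℕ.* K))))

  dK²≤4s² : suc d ℕ.* (K ℕ.* K) ℕ.≤ (s ℕ.+ s) ℕ.* (s ℕ.+ s)
  dK²≤4s² = ℕₚ.≤-trans (ℕₚ.<⇒≤ (isqrt-upper (suc d ℕ.* (K ℕ.* K)))) (ℕₚ.*-mono-≤ 1+s≤2s 1+s≤2s)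
    where
    1+s≤2s : suc s ℕ.≤ s ℕ.+ s
    1+s≤2s = ℕₚ.+-monoˡ-≤ s (ℕₚ.≤-trans (ℕ.s≤s ℕ.z≤n) K≤s)

  ω : ℚ
  ω = √-seq (suc d) k

  ωK≡s : ω * natℚ K ≡ natℚ s
  ωK≡s = /-*-cancel s k

  1≤natℚK : 1ℚ ≤ natℚ K
  1≤natℚK = ≤-by {1ℚ} (natℚ k) (natℚ-mono {0} {k} ℕ.z≤n) refl

  0<natℚK : 0ℚ < natℚ K
  0<natℚK = ℚₚ.<-≤-trans 0<1 1≤natℚK

  1≤ω : 1ℚ ≤ ω
  1≤ω = ℚₚ.*-cancelʳ-≤-pos (natℚ K) {{positive 0<natℚK}}
    (subst₂ _≤_ (sym (ℚₚ.*-identityˡ (natℚ K))) (sym ωK≡s) (natℚ-mono K≤s))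

  d≤4ω² : natℚ (suc d) ≤ ℤ.+ 4 / 1 * (ω * ω)
  d≤4ω² = ℚₚ.*-cancelʳ-≤-pos (natℚ K) {{positive 0<natℚK}} (ℚₚ.*-cancelʳ-≤-pos (natℚ K) {{positive 0<natℚK}}
    (subst₂ _≤_ left right (natℚ-mono dK²≤4s²)))
    where
    left : natℚ (suc d ℕ.* (K ℕ.* K)) ≡ natℚ (suc d) * natℚ K * natℚ K
    left = trans (natℚ-* (suc d) (K ℕ.* K)) (trans (cong (natℚ (suc d) *_) (natℚ-* K K))
      (sym (ℚₚ.*-assoc (natℚ (suc d)) (natℚ K) (natℚ K))))
    double : ∀ w K → (w * K + w * K) * (w * K + w * K) ≡ ℤ.+ 4 / 1 * (w * w) * K * K
    double = solve-∀ ℚ-ring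
    right : natℚ ((s ℕ.+ s) ℕ.* (s ℕ.+ s)) ≡ ℤ.+ 4 / 1 * (ω * ω) * natℚ K * natℚ K
    right = trans (natℚ-* (s ℕ.+ s) (s ℕ.+ s)) (trans (cong (λ q → q * q) (trans (natℚ-+ s s) (cong (λ q → q + q) (sym ωK≡s))))
      (double ω (natℚ K)))

-- XOR-fibers as sums over the cube

sum : List ℚ → ℚ
sum = foldr _+_ 0ℚ

sum-++ : ∀ xs ys → sum (xs ++ ys) ≡ sum xs + sum ys
sum-++ []       ys = sym (ℚₚ.+-identityˡ (sum ys))
sum-++ (x ∷ xs) ys = trans (cong (x +_) (sum-++ xs ys)) (sym (ℚₚ.+-assoc x (sum xs) (sum ys)))

sum-map-++ : ∀ {A : Set} (f : A → ℚ) xs ys → sum (map f (xs ++ ys)) ≡ sum (map f xs) + sum (map f ys)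
sum-map-++ f xs ys = trans (cong sum (map-++ f xs ys)) (sum-++ (map f xs) (map f ys))

sum-map-∘ : ∀ {A B : Set} (f : B → ℚ) (g : A → B) xs → sum (map f (map g xs)) ≡ sum (map (λ x → f (g x)) xs)
sum-map-∘ f g xs = cong sum (sym (map-∘ xs))

sum-cube : ∀ {n} (f : Cube n → ℚ) → sum (map f (cube n)) ≡ ∑ f
sum-cube {zero}  f = ℚₚ.+-identityʳ (f [])
sum-cube {suc n} f = trans (sum-map-++ f (map (Sign.+ ∷_) (cube n)) (map (Sign.- ∷_) (cube n)))
  (cong₂ _+_ (trans (sum-map-∘ f (Sign.+ ∷_) (cube n)) (sum-cube (f ⁺)))
             (trans (sum-map-∘ f (Sign.- ∷_) (cube n)) (sum-cube (f ⁻))))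

sum-cartesianProduct : ∀ {A B : Set} (f : A × B → ℚ) xs ys →
  sum (map f (cartesianProduct xs ys)) ≡ sum (map (λ x → sum (map (λ y → f (x , y)) ys)) xs)
sum-cartesianProduct f []       ys = refl
sum-cartesianProduct f (x ∷ xs) ys = trans (sum-map-++ f (map (x ,_) ys) (cartesianProduct xs ys))
  (cong₂ _+_ (sum-map-∘ f (x ,_) ys) (sum-cartesianProduct f xs ys))

indicator : ∀ {P : Set} → Dec P → ℚ
indicator (yes _) = 1ℚ
indicator (no _)  = 0ℚ

sum-filter : ∀ {A : Set} {P : A → Set} (P? : ∀ a → Dec (P a)) (f : A → ℚ) xs →
  sum (map f (filter P? xs)) ≡ sum (map (λ a → indicator (P? a) * f a) xs)
sum-filter P? f []       = refl
sum-filter P? f (x ∷ xs) with P? x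
... | yes _ = cong₂ _+_ (sym (ℚₚ.*-identityˡ (f x))) (sum-filter P? f xs)
... | no _  = trans (sum-filter P? f xs) (sym (trans
  (cong (_+ sum (map (λ a → indicator (P? a) * f a) xs)) (ℚₚ.*-zeroˡ (f x)))
  (ℚₚ.+-identityˡ (sum (map (λ a → indicator (P? a) * f a) xs)))))

sum-ones : (qs : List ℚ) → sum (map (λ _ → 1ℚ) qs) ≡ natℚ (length qs)
sum-ones []       = refl
sum-ones (q ∷ qs) = cong (1ℚ +_) (sum-ones qs)

mean-* : ∀ qs → mean qs * sum (map (λ _ → 1ℚ) qs) ≡ sum qs
mean-* []           = refl
mean-* qs@(_ ∷ qs′) = trans (cong (mean qs *_) (sum-ones qs))
  (trans (regroup (sum qs) (ℤ.+ 1 / length qs) (natℚ (length qs)))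
    (trans (cong (sum qs *_) (natℚ-1/ (length qs′))) (ℚₚ.*-identityʳ (sum qs))))
  where
  regroup : ∀ p i q → p * i * q ≡ p * (q * i)
  regroup = solve-∀ ℚ-ring

∑-concentrated : ∀ {n} (f : Cube n → ℚ) x₀ → (∀ x → x ≢ x₀ → f x ≡ 0ℚ) → ∑ f ≡ f x₀
∑-concentrated f [] _ = refl
∑-concentrated {suc n} f (Sign.+ ∷ x₀) vanish = trans
  (cong₂ _+_ (∑-concentrated (f ⁺) x₀ (λ x x≢ → vanish (Sign.+ ∷ x) (λ eq → x≢ (∷-injectiveʳ eq))))
             (trans (∑-cong (λ x → vanish (Sign.- ∷ x) λ ())) (∑-0 n)))
  (ℚₚ.+-identityʳ (f (Sign.+ ∷ x₀)))
∑-concentrated {suc n} f (Sign.- ∷ x₀) vanish = trans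
  (cong₂ _+_ (trans (∑-cong (λ x → vanish (Sign.+ ∷ x) λ ())) (∑-0 n))
             (∑-concentrated (f ⁻) x₀ (λ x x≢ → vanish (Sign.- ∷ x) (λ eq → x≢ (∷-injectiveʳ eq)))))
  (ℚₚ.+-identityˡ (f (Sign.- ∷ x₀)))

⊙-involutive : ∀ {n} (x y : Cube n) → x ⊙ (x ⊙ y) ≡ y
⊙-involutive []      []      = refl
⊙-involutive (s ∷ x) (t ∷ y) = cong₂ _∷_ (involutive s t) (⊙-involutive x y)
  where
  involutive : ∀ s t → s Sign.* (s Sign.* t) ≡ t
  involutive Sign.+ t      = refl
  involutive Sign.- Sign.+ = refl
  involutive Sign.- Sign.- = refl

∑-⊙ : ∀ {n} (x : Cube n) (f : Cube n → ℚ) → ∑ (λ y → f (x ⊙ y)) ≡ ∑ f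
∑-⊙ []           f = refl
∑-⊙ (Sign.+ ∷ x) f = cong₂ _+_ (∑-⊙ x (f ⁺)) (∑-⊙ x (f ⁻))
∑-⊙ (Sign.- ∷ x) f = trans (cong₂ _+_ (∑-⊙ x (f ⁻)) (∑-⊙ x (f ⁺))) (ℚₚ.+-comm (∑ (f ⁻)) (∑ (f ⁺)))

module Fiber {n : ℕ} (z : Cube n) where

  on-fiber? : (xy : Cube n × Cube n) → Dec (proj₁ xy ⊙ proj₂ xy ≡ z)
  on-fiber? (x , y) = ≡-dec Signₚ._≟_ (x ⊙ y) z

  sum-fiber : (f : Cube n × Cube n → ℚ) →
    sum (map f (filter on-fiber? (cartesianProduct (cube n) (cube n)))) ≡ ∑ (λ x → f (x , x ⊙ z))
  sum-fiber f = begin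
    sum (map f (filter on-fiber? (cartesianProduct (cube n) (cube n))))
      ≡⟨ sum-filter on-fiber? f (cartesianProduct (cube n) (cube n)) ⟩
    sum (map g (cartesianProduct (cube n) (cube n)))
      ≡⟨ sum-cartesianProduct g (cube n) (cube n) ⟩
    sum (map (λ x → sum (map (λ y → g (x , y)) (cube n))) (cube n))
      ≡⟨ sum-cube (λ x → sum (map (λ y → g (x , y)) (cube n))) ⟩
    ∑ (λ x → sum (map (λ y → g (x , y)) (cube n)))
      ≡⟨ ∑-cong (λ x → trans (sum-cube (λ y → g (x , y))) (trans (∑-concentrated (λ y → g (x , y)) (x ⊙ z) (off x)) (on x))) ⟩
    ∑ (λ x → f (x , x ⊙ z)) ∎
    where
    open ≡-Reasoning
    g : Cube n × Cube n → ℚ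
    g xy = indicator (on-fiber? xy) * f xy
    indicator-yes : ∀ {P : Set} (d : Dec P) → P → ∀ q → indicator d * q ≡ q
    indicator-yes (yes _) _ q = ℚₚ.*-identityˡ q
    indicator-yes (no ¬p) p q = contradiction p ¬p
    indicator-no : ∀ {P : Set} (d : Dec P) → ¬ P → ∀ q → indicator d * q ≡ 0ℚ
    indicator-no (yes p) ¬p q = contradiction p ¬p
    indicator-no (no _)  _  q = ℚₚ.*-zeroˡ q
    on : ∀ x → g (x , x ⊙ z) ≡ f (x , x ⊙ z)
    on x = indicator-yes (on-fiber? (x , x ⊙ z)) (⊙-involutive x z) (f (x , x ⊙ z))
    off : ∀ x y → y ≢ x ⊙ z → g (x , y) ≡ 0ℚ
    off x y y≢ = indicator-no (on-fiber? (x , y)) (λ eq → y≢ (trans (sym (⊙-involutive x y)) (cong (x ⊙_) eq))) (f (x , y))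

-- The fiber over z is the graph of y = x ⊙ z. `sum-fiber` is used twice, for the outputs and for
-- the constant 1, which counts its 2ⁿ points; the product form avoids dividing by the length of a
-- list.
xorFiber-* : ∀ {n} (f : Cube n → Cube n → Sign) z → xorFiber f z * two^ n ≡ ∑ (λ x → value (f x (x ⊙ z)))
xorFiber-* {n} f z = trans (cong (mean qs *_) (sym ones)) (trans (mean-* qs) (sum-fiber g))
  where
  open Fiber z
  g : Cube n × Cube n → ℚ
  g (x , y) = value (f x y)
  qs : List ℚ
  qs = map g (filter on-fiber? (cartesianProduct (cube n) (cube n)))
  ones : sum (map (λ _ → 1ℚ) qs) ≡ two^ n
  ones = trans (sum-map-∘ (λ _ → 1ℚ) g (filter on-fiber? (cartesianProduct (cube n) (cube n))))
    (trans (sum-fiber (λ _ → 1ℚ)) (trans (∑-const n 1ℚ) (ℚₚ.*-identityʳ (two^ n))))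

-- Expectations under ν ρ, term by term

weight : ∀ {n} → ℚ → Cube n → ℚ
weight ρ []      = 1ℚ
weight ρ (s ∷ z) = ½ * (1ℚ + ρ * value s) * weight ρ z

seq-ν : ∀ {n} ρ (z : Cube n) j → seq (ν ρ z) j ≡ weight (seq ρ j) z
seq-ν ρ []      j = refl
seq-ν ρ (s ∷ z) j = cong (½ * (1ℚ + seq ρ j * value s) *_) (seq-ν ρ z j)

weight-k : ∀ {n} ρ (x y : Cube n) → weight ρ (x ⊙ y) * two^ n ≡ k ρ x y
weight-k ρ []      []      = refl
weight-k {suc n} ρ (s ∷ x) (t ∷ y) = trans (regroup ρ (value (s Sign.* t)) (weight ρ (x ⊙ y)) (two^ n))
  (cong₂ (λ v w → (1ℚ + ρ * v) * w) (value-* s t) (weight-k ρ x y))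
  where
  regroup : ∀ r v w t → ½ * (1ℚ + r * v) * w * (ℤ.+ 2 / 1 * t) ≡ (1ℚ + r * v) * (w * t)
  regroup = solve-∀ ℚ-ring
  value-* : ∀ s t → value (s Sign.* t) ≡ value s * value t
  value-* Sign.+ Sign.+ = refl
  value-* Sign.+ Sign.- = refl
  value-* Sign.- Sign.+ = refl
  value-* Sign.- Sign.- = refl

seq-foldr : ∀ {A : Set} (g : A → ℝ) xs j → seq (foldr _+ℝ_ 0ℝ (map g xs)) j ≡ sum (map (λ a → seq (g a) j) xs)
seq-foldr g []       j = refl
seq-foldr g (x ∷ xs) j = cong (seq (g x) j +_) (seq-foldr g xs j)

∑-weight-xorFiber : ∀ {n} ρ (f : Cube n → Cube n → Sign) →
  ∑ (λ z → weight ρ z * xorFiber f z) ≡ E ρ (λ x y → value (f x y))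
∑-weight-xorFiber {n} ρ f = begin
  ∑ (λ z → weight ρ z * xorFiber f z)
    ≡⟨ scale (∑ (λ z → weight ρ z * xorFiber f z)) ⟩
  quarter^ n * (∑ (λ z → weight ρ z * xorFiber f z) * (two^ n * two^ n))
    ≡⟨ cong (quarter^ n *_) unfold ⟩
  E ρ (λ x y → value (f x y)) ∎
  where
  open ≡-Reasoning
  T : ℚ
  T = two^ n
  F : Cube n → Cube n → ℚ
  F x y = value (f x y)
  scale : ∀ p → p ≡ quarter^ n * (p * (T * T))
  scale p = trans (sym (ℚₚ.*-identityʳ p)) (trans (cong (p *_) (sym (quarter^-two^ n))) (swap p (quarter^ n) (T * T)))
    where
    swap : ∀ p q t → p * (q * t) ≡ q * (p * t)
    swap = solve-∀ ℚ-ring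
  regroup : ∀ w h t → w * h * (t * t) ≡ w * t * (h * t)
  regroup = solve-∀ ℚ-ring
  unfold : ∑ (λ z → weight ρ z * xorFiber f z) * (T * T) ≡ S (λ x y → k ρ x y * F x y)
  unfold = begin
    ∑ (λ z → weight ρ z * xorFiber f z) * (T * T)
      ≡⟨ sym (∑-*ʳ (T * T) (λ z → weight ρ z * xorFiber f z)) ⟩
    ∑ (λ z → weight ρ z * xorFiber f z * (T * T))
      ≡⟨ ∑-cong (λ z → trans (regroup (weight ρ z) (xorFiber f z) T) (trans
           (cong (weight ρ z * T *_) (xorFiber-* f z)) (sym (∑-*ˡ (weight ρ z * T) (λ x → F x (x ⊙ z)))))) ⟩
    ∑ (λ z → ∑ (λ x → weight ρ z * T * F x (x ⊙ z)))
      ≡⟨ ∑-swap (λ z x → weight ρ z * T * F x (x ⊙ z)) ⟩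
    ∑ (λ x → ∑ (λ z → weight ρ z * T * F x (x ⊙ z)))
      -- Change of variables from z to y = x ⊙ z, a bijection for each x, under which z = x ⊙ y.
      ≡⟨ ∑-cong (λ x → trans
           (∑-cong (λ z → cong (λ z′ → weight ρ z′ * T * F x (x ⊙ z)) (sym (⊙-involutive x z))))
           (∑-⊙ x (λ y → weight ρ (x ⊙ y) * T * F x y))) ⟩
    ∑ (λ x → ∑ (λ y → weight ρ (x ⊙ y) * T * F x y))
      ≡⟨ S-cong (λ x y → cong (_* F x y) (weight-k ρ x y)) ⟩
    S (λ x y → k ρ x y * F x y) ∎

seq-𝔼ν : ∀ {n} ρ (P : Protocol n) j → seq (𝔼ν ρ (xorFiber (run P))) j ≡ E (seq ρ j) (out P)
seq-𝔼ν {n} ρ P j = trans (seq-foldr (λ z → ν ρ z *ℝ fromℚ (xorFiber (run P) z)) (cube n) j)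
  (trans (sum-cube (λ z → seq (ν ρ z) j * xorFiber (run P) z))
    (trans (∑-cong (λ z → cong (_* xorFiber (run P) z) (seq-ν ρ z j))) (∑-weight-xorFiber (seq ρ j) (run P))))

∣p-p∣≤ : ∀ {p q b} → p ≡ q → 0ℚ ≤ b → ∣ p - q ∣ ≤ b
∣p-p∣≤ {p} {b = b} refl 0≤b = subst (λ r → ∣ r ∣ ≤ b) (sym (ℚₚ.+-inverseʳ p)) 0≤b

-- For d = 0 the approximations of √ d are 0 and 1 ≤ ω fails; but without communication the output
-- is constant, and its expectation is the same at every ρ.
E-√-bound : ∀ {n} d (P : Protocol n) → cost P ℕ.≤ d → ∀ {ρ} j → ∣ ρ ∣ ≤ 1ℚ + margin n →
  ∣ E ρ (out P) - E 0ℚ (out P) ∣ ≤ ℤ.+ 50 / 1 * ∣ ρ ∣ * √-seq d j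
E-√-bound {n} zero (output s) ℕ.z≤n {ρ} j _ = ∣p-p∣≤ (trans (E-const n ρ (value s)) (sym (E-const n 0ℚ (value s))))
  (0≤* (0≤* (ℚₚ.nonNegative⁻¹ (ℤ.+ 50 / 1)) (ℚₚ.0≤∣p∣ ρ)) (0≤√-seq 0 j))
E-√-bound (suc d) P cost≤ j ∣ρ∣≤ = E-bound P 1≤ω (ℚₚ.≤-trans (natℚ-mono cost≤) d≤4ω²) ∣ρ∣≤
  where open √-approximation d j

theorem1p5 : ∃[ C ] (0ℝ <ℝ C ×
    (∀ (n d : ℕ) (P : Protocol n) → cost P ℕ.≤ d →
    ∀ (ρ : ℝ) → (-ℝ 1ℝ) ≤ℝ ρ → ρ ≤ℝ 1ℝ →
    ∣ 𝔼ν ρ (xorFiber (run P)) -ℝ 𝔼ν 0ℝ (xorFiber (run P)) ∣ℝ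
    ≤ℝ C *ℝ ∣ ρ ∣ℝ *ℝ (√ d)))
theorem1p5 = fromℚ (ℤ.+ 50 / 1) , (1ℚ , 0<1 , 0 , λ _ _ → ≤-by (ℤ.+ 49 / 1) (ℚₚ.nonNegative⁻¹ (ℤ.+ 49 / 1)) refl) , bounded
  where
  bounded : ∀ (n d : ℕ) (P : Protocol n) → cost P ℕ.≤ d → ∀ (ρ : ℝ) → (-ℝ 1ℝ) ≤ℝ ρ → ρ ≤ℝ 1ℝ →
    ∣ 𝔼ν ρ (xorFiber (run P)) -ℝ 𝔼ν 0ℝ (xorFiber (run P)) ∣ℝ ≤ℝ fromℚ (ℤ.+ 50 / 1) *ℝ ∣ ρ ∣ℝ *ℝ (√ d)
  bounded n d P cost≤ ρ -1≤ρ ρ≤1 ε 0<ε = M ℕ.⊔ N , λ j j≥ → begin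
    ∣ seq (𝔼ν ρ (xorFiber (run P))) j - seq (𝔼ν 0ℝ (xorFiber (run P))) j ∣
      ≡⟨ cong₂ (λ p q → ∣ p - q ∣) (seq-𝔼ν ρ P j) (seq-𝔼ν 0ℝ P j) ⟩
    ∣ E (seq ρ j) (out P) - E 0ℚ (out P) ∣
      ≤⟨ E-√-bound d P cost≤ {seq ρ j} j (∣p∣≤-by
           (proj₂ above j (ℕₚ.≤-trans (ℕₚ.m≤n⊔m M N) j≥))
           (negate (seq ρ j) (margin n) (proj₂ below j (ℕₚ.≤-trans (ℕₚ.m≤m⊔n M N) j≥)))) ⟩
    ℤ.+ 50 / 1 * ∣ seq ρ j ∣ * √-seq d j
      ≤⟨ ≤-by {ℤ.+ 50 / 1 * ∣ seq ρ j ∣ * √-seq d j} ε (ℚₚ.<⇒≤ 0<ε) refl ⟩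
    ℤ.+ 50 / 1 * ∣ seq ρ j ∣ * √-seq d j + ε ∎
    where
    open ℚₚ.≤-Reasoning
    below : ∃[ M ] (∀ j → M ℕ.≤ j → - 1ℚ ≤ seq ρ j + margin n)
    -- The order on ℝ places the terms of ρ in [-1 , 1] only up to a positive tolerance and from
    -- some index on. The tolerance chosen is the one under which `E-√-bound` holds.
    below = -1≤ρ (margin n) (0<margin n)
    above : ∃[ N ] (∀ j → N ℕ.≤ j → seq ρ j ≤ 1ℚ + margin n)
    above = ρ≤1 (margin n) (0<margin n)
    M N : ℕ
    M = proj₁ below
    N = proj₁ above
    negate : ∀ r η → - 1ℚ ≤ r + η → - r ≤ 1ℚ + η
    negate r η h = subst₂ _≤_ (left r) (right r η) (ℚₚ.+-monoˡ-≤ (1ℚ - r) h)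
      where
      left : ∀ r → - 1ℚ + (1ℚ - r) ≡ - r
      left = solve-∀ ℚ-ring
      right : ∀ r η → (r + η) + (1ℚ - r) ≡ 1ℚ + η
      right = solve-∀ ℚ-ring
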